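{- Let $\mu$ be a diagram and let $d$ be the number of boxes on the main diagonal of $\mu$. The dual Schur function $\widehat s_\mu(x\|a)$ has the expansion $$\widehat s_\mu(x\|a)=\sum_\lambda(-1)^{n(\lambda/\mu)}\,\varphi_{\lambda/\mu}(a)\,s_\lambda(x),$$ summed over diagrams $\lambda$ which contain $\mu$ and such that $\lambda$ has $d$ boxes on the main diagonal, where $n(\lambda/\mu)$ denotes the total number of boxes of $\lambda/\mu$ in rows $d+1,d+2,\dots$, and $s_\lambda(x)$ are the ordinary Schur functions.
   Context: Let $a=(a_i)_{i\in\mathbb Z}$ be a sequence of commuting indeterminates and $\mathbb Q[a]$ the polynomial ring in the $a_i$; $x=(x_1,x_2,\dots)$. Dual Schur functions: let $\widehat\Lambda(x\|a)$ be the ring of formal (possibly infinite) sums $\sum_{\lambda}c_\lambda(a)s_\lambda(x)$, $c_\lambda(a)\in\mathbb Q[a]$. For a partition $\mu$ with $d$ boxes on the main diagonal and $n\geqslant\ell(\mu)$, $$\widehat s_\mu(x_1,\dots,x_n\|a)=\frac{\det[A_{ij}]_{i,j=1}^n}{\prod_{1\leqslant i<j\leqslant n}(x_i-x_j)},$$ where $A_{ij}=\dfrac{x_i^{\mu_j+n-j}}{(1-a_0x_i)(1-a_{ -1}x_i)\cdots(1-a_{j-\mu_j}x_i)}$ for $1\leqslant j\leqslant d$ and $A_{ij}=x_i^{\mu_j+n-j}(1-a_1x_i)\cdots(1-a_{j-\mu_j-1}x_i)$ for $d<j\leqslant n$; it is $0$ if $\ell(\mu)>n$. These are compatible with setting $x_n=0$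 and define $\widehat s_\mu(x\|a)\in\widehat\Lambda(x\|a)$. Suppose $\mu\subseteq\lambda$ both have $d$ boxes on the main diagonal. A hook $\lambda/\mu$-tableau is a filling $T$ of the boxes of $\lambda/\mu$ with integers such that: the entries in the first $d$ rows weakly increase along the rows and strictly increase down the columns, and all entries in row $i$ belong to $\{i-\mu_i,\dots,-1,0\}$ for $i=1,\dots,d$; the entries in the first $d$ columns weakly decrease down the columns and strictly decrease along the rows, and all entries in column $j$ belong to $\{1,2,\dots,\mu'_j-j+1\}$ for $j=1,\dots,d$ ($\mu'$ is the conjugate of $\mu$). Then $\varphi_{\lambda/\mu}(a)=\sum_T\prod_{\alpha\in\lambda/\mu}a_{T(\alpha)}$, summed over the hook $\lambda/\mu$-tableaux $T$. -}

module Defs where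

open import Level using (Level; 0ℓ)
open import Algebra.Bundles using (CommutativeRing)
open import Algebra.Bundles.Raw using (RawRing)
import Algebra.Consequences.Setoid
import Algebra.Definitions.RawSemiring
import Algebra.Properties.CommutativeMonoid.Sum
import Algebra.Properties.Ring
import Relation.Binary.Reasoning.Setoid
open import Data.Bool.Base using (if_then_else_)
open import Data.Fin.Base as Fin using (Fin; zero; suc; toℕ; punchIn)
import Data.Fin.Properties as Fin
open import Data.Integer.Base as ℤ using (ℤ; +_)
import Data.Integer.Properties as ℤ
open import Data.List.Base as List using (List; []; _∷_; length; map; filter; foldr; foldl; upTo; applyUpTo; concatMap; cartesianProduct; cartesianProductWith; allFin)
open import Data.List.Relation.Unary.All as All using (All; []; _∷_)
open import Data.List.Relation.Unary.All.Properties using (all-filter)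
open import Data.List.Relation.Unary.Linked using (Linked; linked?)
open import Data.List.Relation.Binary.Prefix.Heterogeneous using (Prefix)
open import Data.List.Relation.Binary.Prefix.Heterogeneous.Properties using (prefix?)
open import Data.Nat.Base as ℕ using (ℕ; zero; suc; z≤n; s≤s; _≤_; _<_; _≥_; _∸_)
open import Data.Nat.ListAction using () renaming (sum to size)
import Data.Nat.Properties as ℕ
open import Data.Product.Base using (_×_; _,_; proj₁)
open import Data.Rational.Base as ℚ using (ℚ; 0ℚ; 1ℚ)
open import Data.Vec.Base as Vec using (Vec; []; _∷_; lookup; updateAt; replicate; _[_]≔_)
import Data.Vec.Properties as Vec
import Data.Vec.Functional as Vector
open import Function.Base using (_∘_)
open import Relation.Binary.Bundles using (Setoid)
open import Relation.Binary.Core using (Rel)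
open import Relation.Binary.Structures using (IsEquivalence)
open import Relation.Binary.PropositionalEquality as ≡ using (_≡_; _≢_)
open import Relation.Nullary.Decidable using (Dec; does; yes; no; _×-dec_; _→-dec_)

-- The polynomial ring ℚ[a] in the indeterminates aᵢ, i ∈ ℤ, presented as
-- the free commutative ℚ-algebra on ℤ: terms modulo the congruence
-- generated by the commutative ring axioms and the arithmetic of ℚ.
infixl 6 _⊕_
infixl 7 _⊗_
infix  8 ⊝_
infix  4 _≋_

data ℚ[a] : Set where
  con     : ℚ → ℚ[a]
  a       : ℤ → ℚ[a]
  _⊕_ _⊗_ : ℚ[a] → ℚ[a] → ℚ[a]
  ⊝_      : ℚ[a] → ℚ[a]

data _≋_ : Rel ℚ[a] 0ℓ where
  ≋-refl      : ∀ {p} → p ≋ p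
  ≋-sym       : ∀ {p q} → p ≋ q → q ≋ p
  ≋-trans     : ∀ {p q r} → p ≋ q → q ≋ r → p ≋ r
  ⊕-cong      : ∀ {p p′ q q′} → p ≋ p′ → q ≋ q′ → p ⊕ q ≋ p′ ⊕ q′
  ⊗-cong      : ∀ {p p′ q q′} → p ≋ p′ → q ≋ q′ → p ⊗ q ≋ p′ ⊗ q′
  ⊝-cong      : ∀ {p p′} → p ≋ p′ → ⊝ p ≋ ⊝ p′
  ⊕-assoc     : ∀ p q r → (p ⊕ q) ⊕ r ≋ p ⊕ (q ⊕ r)
  ⊕-comm      : ∀ p q → p ⊕ q ≋ q ⊕ p
  ⊕-identityˡ : ∀ p → con 0ℚ ⊕ p ≋ p
  ⊕-inverseˡ  : ∀ p → (⊝ p) ⊕ p ≋ con 0ℚ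
  ⊗-assoc     : ∀ p q r → (p ⊗ q) ⊗ r ≋ p ⊗ (q ⊗ r)
  ⊗-comm      : ∀ p q → p ⊗ q ≋ q ⊗ p
  ⊗-identityˡ : ∀ p → con 1ℚ ⊗ p ≋ p
  ⊗-distribˡ  : ∀ p q r → p ⊗ (q ⊕ r) ≋ p ⊗ q ⊕ p ⊗ r
  con-⊕       : ∀ x y → con (x ℚ.+ y) ≋ con x ⊕ con y
  con-⊗       : ∀ x y → con (x ℚ.* y) ≋ con x ⊗ con y

ℚ[a]-commutativeRing : CommutativeRing 0ℓ 0ℓ
ℚ[a]-commutativeRing = record
  { Carrier = ℚ[a] ; _≈_ = _≋_ ; _+_ = _⊕_ ; _*_ = _⊗_ ; -_ = ⊝_
  ; 0# = con 0ℚ ; 1# = con 1ℚ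
  ; isCommutativeRing = record
    { isRing = record
      { +-isAbelianGroup = record
        { isGroup = record
          { isMonoid = record
            { isSemigroup = record
              { isMagma = record { isEquivalence = isEquivalence ; ∙-cong = ⊕-cong }
              ; assoc = ⊕-assoc }
            ; identity = comm∧idˡ⇒id ⊕-comm ⊕-identityˡ }
          ; inverse = comm∧invˡ⇒inv ⊕-comm ⊕-inverseˡ
          ; ⁻¹-cong = ⊝-cong }
        ; comm = ⊕-comm }
      ; *-cong = ⊗-cong
      ; *-assoc = ⊗-assoc
      ; *-identity = comm∧idˡ⇒id ⊗-comm ⊗-identityˡ
      ; distrib = comm∧distrˡ⇒distr ⊕-cong ⊗-comm ⊗-distribˡ }
    ; *-comm = ⊗-comm } }
  where
  isEquivalence : IsEquivalence _≋_
  isEquivalence = record { refl = ≋-refl ; sym = ≋-sym ; trans = ≋-trans }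

  setoid : Setoid 0ℓ 0ℓ
  setoid = record { isEquivalence = isEquivalence }

  open Algebra.Consequences.Setoid setoid

module Determinant {c ℓ : Level} (R : RawRing c ℓ) where
  open RawRing R
  open Algebra.Definitions.RawSemiring rawSemiring using (sum; _^_)

  det : ∀ {n} → (Fin n → Fin n → Carrier) → Carrier
  det {zero}  M = 1#
  det {suc n} M = sum λ j →
    (- 1#) ^ toℕ j * M zero j * det (λ i k → M (suc i) (punchIn j k))

module PowerSeries {c ℓ : Level} (R : CommutativeRing c ℓ) where
  open CommutativeRing R hiding (zero)
  open Algebra.Definitions.RawSemiring (RawRing.rawSemiring rawRing) using (_^_)
  open Algebra.Properties.CommutativeMonoid.Sum +-commutativeMonoid using (sum; sum⁺-syntax; sum-cong-≋)

  -- One variable; f k is the coefficient of xᵏ.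
  R⟦x⟧ : Set c
  R⟦x⟧ = ℕ → Carrier

  infixl 7 _⊛_
  _⊛_ : R⟦x⟧ → R⟦x⟧ → R⟦x⟧
  (f ⊛ g) m = ∑[ i ≤ m ] (f (toℕ i) * g (m ∸ toℕ i))

  x^_ : ℕ → R⟦x⟧
  (x^ k) m = if does (m ℕ.≟ k) then 1# else 0#

  1-_x : Carrier → R⟦x⟧
  1- u x zero          = 1#
  1- u x (suc zero)    = - u
  1- u x (suc (suc _)) = 0#

  1/[1-_x] : Carrier → R⟦x⟧
  1/[1- u x] k = u ^ k

  ∏ : ∀ {m} → (Fin m → R⟦x⟧) → R⟦x⟧
  ∏ = Vector.foldr _⊛_ (x^ 0)

  -- n variables; f α is the coefficient of x₁^α₁ ⋯ xₙ^αₙ.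
  R⟦x₁⋯_⟧ : ℕ → Set c
  R⟦x₁⋯ n ⟧ = Vec ℕ n → Carrier

  infix 4 _≈ₛ_
  _≈ₛ_ : ∀ {n} → Rel R⟦x₁⋯ n ⟧ ℓ
  f ≈ₛ g = ∀ α → f α ≈ g α

  _e_ : ∀ {n} → ℕ → Fin n → Vec ℕ n
  k e i = replicate _ 0 [ i ]≔ k

  -- f(xᵢ) for a series f in one variable
  _⟨x_⟩ : ∀ {n} → R⟦x⟧ → Fin n → R⟦x₁⋯ n ⟧
  (f ⟨x i ⟩) α = if does (Vec.≡-dec ℕ._≟_ α (lookup α i e i)) then f (lookup α i) else 0#

  monomial : ∀ {n} → Vec ℕ n → R⟦x₁⋯ n ⟧
  monomial α β = if does (Vec.≡-dec ℕ._≟_ β α) then 1# else 0#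

  0ₛ 1ₛ : ∀ {n} → R⟦x₁⋯ n ⟧
  0ₛ _ = 0#
  1ₛ = monomial (replicate _ 0)

  X : ∀ {n} → Fin n → R⟦x₁⋯ n ⟧
  X i = monomial (1 e i)

  infixl 6 _+ₛ_
  infixl 7 _*ₛ_
  infix  8 -ₛ_

  _+ₛ_ _*ₛ_ : ∀ {n} → R⟦x₁⋯ n ⟧ → R⟦x₁⋯ n ⟧ → R⟦x₁⋯ n ⟧
  (f +ₛ g) α = f α + g α
  _*ₛ_ {zero}  f g []      = f [] * g []
  _*ₛ_ {suc n} f g (k ∷ α) =
    ∑[ i ≤ k ] ((λ β → f (toℕ i ∷ β)) *ₛ (λ γ → g (k ∸ toℕ i ∷ γ))) α

  -ₛ_ : ∀ {n} → R⟦x₁⋯ n ⟧ → R⟦x₁⋯ n ⟧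
  (-ₛ f) α = - f α

  seriesRawRing : ℕ → RawRing c ℓ
  seriesRawRing n = record
    { Carrier = R⟦x₁⋯ n ⟧ ; _≈_ = _≈ₛ_ ; _+_ = _+ₛ_ ; _*_ = _*ₛ_ ; -_ = -ₛ_
    ; 0# = 0ₛ ; 1# = 1ₛ }

  -- The quotient q = f / (xᵢ - xⱼ).  Comparing coefficients of x^(β + eᵢ) in
  -- (xᵢ - xⱼ) q = f gives q_β = f_(β + eᵢ) + q_(β + eᵢ - eⱼ), hence
  -- q_β = Σ_{k ≤ βⱼ} f_(β + (k+1) eᵢ - k eⱼ).  The value is meaningful for
  -- divisible f only; see /[x-x]-exact.
  _/[x_-x_] : ∀ {n} → R⟦x₁⋯ n ⟧ → Fin n → Fin n → R⟦x₁⋯ n ⟧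
  (f /[x i -x j ]) β =
    ∑[ k ≤ lookup β j ] f (updateAt (updateAt β i (suc (toℕ k) ℕ.+_)) j (_∸ toℕ k))

  pairs : ∀ n → List (Fin n × Fin n)
  pairs n = filter (λ (i , j) → i Fin.<? j) (cartesianProduct (allFin n) (allFin n))

  -- Δ is the product of all xᵢ - xⱼ, i < j.  Antisymmetric series are divisible
  -- by it, and for f = g ·Δ the series f /Δ is g by /Δ-exact.
  _/Δ _·Δ : ∀ {n} → R⟦x₁⋯ n ⟧ → R⟦x₁⋯ n ⟧
  _/Δ {n} f = foldr (λ (i , j) g → g /[x i -x j ]) f (pairs n)
  _·Δ {n} f = foldl (λ g (i , j) → (X i +ₛ -ₛ X j) *ₛ g) f (pairs n)

  open import Algebra.Properties.Ring ring using (+-inverseˡ-unique; -0#≈0#)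
  open Algebra.Properties.CommutativeMonoid.Sum +-commutativeMonoid using (∑-distrib-+; sum-replicate-zero)
  open Relation.Binary.Reasoning.Setoid setoid

  private
    sum-0 : ∀ {m} {t : Fin m → Carrier} → (∀ i → t i ≈ 0#) → sum t ≈ 0#
    sum-0 {m} t≈0 = trans (sum-cong-≋ t≈0) (sum-replicate-zero m)

    *ₛ-cong : ∀ {n} {f f′ g g′ : R⟦x₁⋯ n ⟧} → f ≈ₛ f′ → g ≈ₛ g′ → f *ₛ g ≈ₛ f′ *ₛ g′
    *ₛ-cong {zero}  p q []      = *-cong (p []) (q [])
    *ₛ-cong {suc n} p q (k ∷ α) =
      sum-cong-≋ {suc k} λ i → *ₛ-cong (λ β → p (toℕ i ∷ β)) (λ β → q (k ∸ toℕ i ∷ β)) α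

    *ₛ-zeroˡ : ∀ {n} (g : R⟦x₁⋯ n ⟧) → 0ₛ *ₛ g ≈ₛ 0ₛ
    *ₛ-zeroˡ {zero}  g []      = zeroˡ _
    *ₛ-zeroˡ {suc n} g (k ∷ α) = sum-0 {suc k} λ i → *ₛ-zeroˡ (λ β → g (k ∸ toℕ i ∷ β)) α

    *ₛ-identityˡ : ∀ {n} (g : R⟦x₁⋯ n ⟧) → 1ₛ *ₛ g ≈ₛ g
    *ₛ-identityˡ {zero}  g []      = *-identityˡ _
    *ₛ-identityˡ {suc n} g (k ∷ α) = trans
      (+-cong (*ₛ-identityˡ (λ β → g (k ∷ β)) α)
              (sum-0 {k} λ i → *ₛ-zeroˡ (λ β → g (k ∸ suc (toℕ i) ∷ β)) α))
      (+-identityʳ _)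

    *ₛ-distribʳ : ∀ {n} (g f f′ : R⟦x₁⋯ n ⟧) → (f +ₛ f′) *ₛ g ≈ₛ (f *ₛ g) +ₛ (f′ *ₛ g)
    *ₛ-distribʳ {zero}  g f f′ []      = distribʳ _ _ _
    *ₛ-distribʳ {suc n} g f f′ (k ∷ α) = trans
      (sum-cong-≋ {suc k} λ i → *ₛ-distribʳ (λ β → g (k ∸ toℕ i ∷ β)) (λ β → f (toℕ i ∷ β)) (λ β → f′ (toℕ i ∷ β)) α)
      (∑-distrib-+ {suc k} (λ i → ((λ β → f (toℕ i ∷ β)) *ₛ (λ β → g (k ∸ toℕ i ∷ β))) α)
                           (λ i → ((λ β → f′ (toℕ i ∷ β)) *ₛ (λ β → g (k ∸ toℕ i ∷ β))) α))

    -ₛ-distribˡ-*ₛ : ∀ {n} (f g : R⟦x₁⋯ n ⟧) → (-ₛ f) *ₛ g ≈ₛ -ₛ (f *ₛ g)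
    -ₛ-distribˡ-*ₛ f g α = +-inverseˡ-unique _ _ (begin
      ((-ₛ f) *ₛ g) α + (f *ₛ g) α  ≈⟨ *ₛ-distribʳ g (-ₛ f) f α ⟨
      ((-ₛ f +ₛ f) *ₛ g) α          ≈⟨ *ₛ-cong (λ β → -‿inverseˡ (f β)) (λ _ → refl) α ⟩
      (0ₛ *ₛ g) α                   ≈⟨ *ₛ-zeroˡ g α ⟩
      0#                            ∎)

    shift : ∀ {n} → Fin n → R⟦x₁⋯ n ⟧ → R⟦x₁⋯ n ⟧
    shift zero    g (zero  ∷ α) = 0#
    shift zero    g (suc k ∷ α) = g (k ∷ α)
    shift (suc i) g (k     ∷ α) = shift i (λ β → g (k ∷ β)) α

    X-*ₛ : ∀ {n} (i : Fin n) (g : R⟦x₁⋯ n ⟧) → X i *ₛ g ≈ₛ shift i g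
    X-*ₛ zero g (zero ∷ α) = trans (+-identityʳ _) (*ₛ-zeroˡ (λ β → g (0 ∷ β)) α)
    X-*ₛ zero g (suc k ∷ α) = begin
      (0ₛ *ₛ (λ β → g (suc k ∷ β))) α + ((1ₛ *ₛ (λ β → g (k ∷ β))) α + _)
        ≈⟨ +-cong (*ₛ-zeroˡ (λ β → g (suc k ∷ β)) α)
                  (+-cong (*ₛ-identityˡ (λ β → g (k ∷ β)) α)
                          (sum-0 {k} λ i → *ₛ-zeroˡ (λ β → g (k ∸ suc (toℕ i) ∷ β)) α)) ⟩
      0# + (g (k ∷ α) + 0#)
        ≈⟨ trans (+-identityˡ _) (+-identityʳ _) ⟩
      g (k ∷ α) ∎
    X-*ₛ (suc i) g (k ∷ α) = trans
      (+-cong (X-*ₛ i (λ β → g (k ∷ β)) α)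
              (sum-0 {k} λ i → *ₛ-zeroˡ (λ β → g (k ∸ suc (toℕ i) ∷ β)) α))
      (+-identityʳ _)

    shift-suc : ∀ {n} (i : Fin n) (g : R⟦x₁⋯ n ⟧) (p : ℕ → ℕ) α →
                shift i g (updateAt α i (suc ∘ p)) ≡ g (updateAt α i p)
    shift-suc zero    g p (x ∷ α) = ≡.refl
    shift-suc (suc i) g p (x ∷ α) = shift-suc i (λ β → g (x ∷ β)) p α

    shift-∸ : ∀ {n} (i : Fin n) (g : R⟦x₁⋯ n ⟧) {k} α → k < lookup α i →
              shift i g (updateAt α i (_∸ k)) ≡ g (updateAt α i (_∸ suc k))
    shift-∸ zero    g {zero}  (suc x ∷ α) _         = ≡.refl
    shift-∸ zero    g {suc k} (suc x ∷ α) (s≤s k<x) = shift-∸ zero g (x ∷ α) k<x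
    shift-∸ (suc i) g         (x ∷ α)     k<        = shift-∸ i (λ β → g (x ∷ β)) α k<

    shift-0 : ∀ {n} (i : Fin n) (g : R⟦x₁⋯ n ⟧) {k} α → lookup α i ≡ k →
              shift i g (updateAt α i (_∸ k)) ≡ 0#
    shift-0 zero    g (x ∷ α) ≡.refl rewrite ℕ.n∸n≡0 x = ≡.refl
    shift-0 (suc i) g (x ∷ α) eq     = shift-0 i (λ β → g (x ∷ β)) α eq

    telescope : ∀ m (t s : ℕ → Carrier) → (∀ {k} → k < m → s k ≈ t (suc k)) → s m ≈ 0# →
                ∑[ k ≤ m ] (t (toℕ k) + - s (toℕ k)) ≈ t 0
    telescope zero t s _ s≈0 = begin
      (t 0 + - s 0) + 0#  ≈⟨ +-identityʳ _ ⟩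
      t 0 + - s 0         ≈⟨ +-congˡ (trans (-‿cong s≈0) -0#≈0#) ⟩
      t 0 + 0#            ≈⟨ +-identityʳ _ ⟩
      t 0                 ∎
    telescope (suc m) t s s≈t s≈0 = begin
      (t 0 + - s 0) + ∑[ k ≤ m ] (t (suc (toℕ k)) + - s (suc (toℕ k)))
        ≈⟨ +-cong (+-congˡ (-‿cong (s≈t (s≤s z≤n))))
                  (telescope m (t ∘ suc) (s ∘ suc) (λ k<m → s≈t (s≤s k<m)) s≈0) ⟩
      (t 0 + - t 1) + t 1  ≈⟨ +-assoc _ _ _ ⟩
      t 0 + (- t 1 + t 1)  ≈⟨ +-congˡ (-‿inverseˡ _) ⟩
      t 0 + 0#             ≈⟨ +-identityʳ _ ⟩
      t 0                  ∎

    /[x-x]-cong : ∀ {n} {f g : R⟦x₁⋯ n ⟧} i j → f ≈ₛ g → (f /[x i -x j ]) ≈ₛ (g /[x i -x j ])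
    /[x-x]-cong i j f≈g β = sum-cong-≋ {suc (lookup β j)} λ k →
      f≈g (updateAt (updateAt β i (suc (toℕ k) ℕ.+_)) j (_∸ toℕ k))

  /[x-x]-exact : ∀ {n} {i j : Fin n} → i ≢ j → (g : R⟦x₁⋯ n ⟧) →
                 (((X i +ₛ -ₛ X j) *ₛ g) /[x i -x j ]) ≈ₛ g
  /[x-x]-exact {i = i} {j} i≢j g β = begin
    ∑[ k ≤ m ] ((X i +ₛ -ₛ X j) *ₛ g) (β⟨ suc (toℕ k) , toℕ k ⟩)
      ≈⟨ sum-cong-≋ {suc m} (λ k → expand (toℕ k)) ⟩
    ∑[ k ≤ m ] (g (β⟨ toℕ k , toℕ k ⟩) + - s (toℕ k))
      ≈⟨ telescope m (λ k → g (β⟨ k , k ⟩)) s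
           (λ {k} k<m → reflexive (shift-∸ j g (updateAt β i (suc k ℕ.+_)) (≡.subst (k <_) (≡.sym (lookup-j (suc k))) k<m)))
           (reflexive (shift-0 j g (updateAt β i (suc m ℕ.+_)) (lookup-j (suc m)))) ⟩
    g (β⟨ 0 , 0 ⟩)
      ≡⟨ ≡.cong g (≡.trans (Vec.updateAt-id j _) (Vec.updateAt-id i β)) ⟩
    g β ∎
    where
    m = lookup β j

    β⟨_,_⟩ : ℕ → ℕ → Vec ℕ _
    β⟨ k , l ⟩ = updateAt (updateAt β i (k ℕ.+_)) j (_∸ l)

    s : ℕ → Carrier
    s k = shift j g (β⟨ suc k , k ⟩)

    lookup-j : ∀ k → lookup (updateAt β i (k ℕ.+_)) j ≡ m
    lookup-j k = Vec.lookup∘updateAt′ j i (i≢j ∘ ≡.sym) β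

    expand : ∀ k → ((X i +ₛ -ₛ X j) *ₛ g) (β⟨ suc k , k ⟩) ≈ g (β⟨ k , k ⟩) + - s k
    expand k = begin
      ((X i +ₛ -ₛ X j) *ₛ g) γ              ≈⟨ *ₛ-distribʳ g (X i) (-ₛ X j) γ ⟩
      (X i *ₛ g) γ + ((-ₛ X j) *ₛ g) γ      ≈⟨ +-cong (X-*ₛ i g γ) (trans (-ₛ-distribˡ-*ₛ (X j) g γ) (-‿cong (X-*ₛ j g γ))) ⟩
      shift i g γ + - s k                   ≡⟨ ≡.cong (λ δ → shift i g δ + - s k) (≡.sym (Vec.updateAt-commutes i j i≢j β)) ⟩
      shift i g (updateAt (updateAt β j (_∸ k)) i (suc k ℕ.+_)) + - s k
                                            ≡⟨ ≡.cong (_+ - s k) (shift-suc i g (k ℕ.+_) _) ⟩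
      g (updateAt (updateAt β j (_∸ k)) i (k ℕ.+_)) + - s k
                                            ≡⟨ ≡.cong (λ δ → g δ + - s k) (Vec.updateAt-commutes i j i≢j β) ⟩
      g (β⟨ k , k ⟩) + - s k                ∎
      where γ = β⟨ suc k , k ⟩

  /Δ-exact : ∀ {n} (g : R⟦x₁⋯ n ⟧) → (g ·Δ) /Δ ≈ₛ g
  /Δ-exact {n} g = go (pairs n) (All.map Fin.<⇒≢ (all-filter _ (cartesianProduct (allFin n) (allFin n)))) g
    where
    go : ∀ ps → All (λ (i , j) → i ≢ j) ps → (g : R⟦x₁⋯ n ⟧) →
         foldr (λ (i , j) h → h /[x i -x j ]) (foldl (λ h (i , j) → (X i +ₛ -ₛ X j) *ₛ h) g ps) ps ≈ₛ g
    go []             []           g α = refl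
    go ((i , j) ∷ ps) (i≢j ∷ i≢js) g α = trans
      (/[x-x]-cong i j (go ps i≢js ((X i +ₛ -ₛ X j) *ₛ g)) α)
      (/[x-x]-exact i≢j g α)

-- Partitions are weakly decreasing lists of positive parts; rows, columns and
-- parts are numbered from 1.
IsPartition : List ℕ → Set
IsPartition μ = Linked _≥_ μ × All (0 <_) μ

isPartition? : ∀ μ → Dec (IsPartition μ)
isPartition? μ = linked? ℕ._≥?_ μ ×-dec All.all? (0 ℕ.<?_) μ

-- The i-th part, 0 beyond the length (the index 0 is not used).
part : List ℕ → ℕ → ℕ
part []      _             = 0
part (x ∷ μ) zero          = 0
part (x ∷ μ) (suc zero)    = x
part (x ∷ μ) (suc (suc i)) = part μ (suc i)

conjugatePart : List ℕ → ℕ → ℕ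
conjugatePart μ j = length (filter (j ℕ.≤?_) μ)

diagonal : List ℕ → ℕ
diagonal μ = length (filter (λ i → i ℕ.≤? part μ i) (applyUpTo suc (length μ)))

-- Since all parts are positive, diagram inclusion bounds the length as well.
infix 4 _⊆_ _⊆?_
_⊆_ : Rel (List ℕ) 0ℓ
μ ⊆ ν = Prefix _≤_ μ ν

_⊆?_ : ∀ μ ν → Dec (μ ⊆ ν)
_⊆?_ = prefix? ℕ._≤?_

Box : Set
Box = ℕ × ℕ

-- The boxes (i , j), μᵢ < j ≤ νᵢ, of ν/μ
boxes : List ℕ → List ℕ → List Box
boxes ν μ = concatMap (λ i → applyUpTo (λ k → i , part μ i ℕ.+ suc k) (part ν i ∸ part μ i))
                      (applyUpTo suc (length ν))

choices : ∀ {A : Set} → List (List A) → List (List A)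
choices = foldr (cartesianProductWith _∷_) ([] ∷ [])

partitions : ℕ → List (List ℕ)
partitions N = filter (λ ν → isPartition? ν ×-dec size ν ℕ.≟ N)
  (concatMap (λ ℓ → choices (List.replicate ℓ (upTo (suc N)))) (upTo (suc N)))

-- A filling lists the boxes of ν/μ, each with its entry.
Filling : Set
Filling = List (Box × ℤ)

-- If μ ⊆ ν both have d diagonal boxes, then every box of ν/μ lies either in
-- the first d rows or in the first d columns, and not in both; its entry
-- ranges over {i - μᵢ, …, 0} or {1, …, μ′ⱼ - j + 1} respectively.
entries : List ℕ → Box → List ℤ
entries μ (i , j) =
  if does (i ℕ.≤? diagonal μ)
  then applyUpTo (λ k → ℤ.- (+ k)) (suc (part μ i ∸ i))
  else applyUpTo (λ k → + suc k) (suc (conjugatePart μ j ∸ j))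

fillings : List ℕ → List ℕ → List Filling
fillings ν μ = choices (map (λ b → map (b ,_) (entries μ b)) (boxes ν μ))

-- The conditions on rows and columns of the tableau, for entries s, t of two
-- boxes; all pairs of boxes are compared, which by transitivity amounts to
-- comparing neighbours.
Ordered : ℕ → Box × ℤ → Box × ℤ → Set
Ordered d ((i , j) , s) ((i′ , j′) , t) =
    (i  ≤ d × i ≡ i′ × j < j′ → s ℤ.≤ t)
  × (i′ ≤ d × j ≡ j′ × i < i′ → s ℤ.< t)
  × (j  ≤ d × j ≡ j′ × i < i′ → t ℤ.≤ s)
  × (j′ ≤ d × i ≡ i′ × j < j′ → t ℤ.< s)

ordered? : ∀ d p q → Dec (Ordered d p q)
ordered? d ((i , j) , s) ((i′ , j′) , t) =
        ((i  ℕ.≤? d ×-dec i ℕ.≟ i′ ×-dec j ℕ.<? j′) →-dec s ℤ.≤? t)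
  ×-dec ((i′ ℕ.≤? d ×-dec j ℕ.≟ j′ ×-dec i ℕ.<? i′) →-dec s ℤ.<? t)
  ×-dec ((j  ℕ.≤? d ×-dec j ℕ.≟ j′ ×-dec i ℕ.<? i′) →-dec t ℤ.≤? s)
  ×-dec ((j′ ℕ.≤? d ×-dec i ℕ.≟ i′ ×-dec j ℕ.<? j′) →-dec t ℤ.<? s)

IsHookTableau : ℕ → Filling → Set
IsHookTableau d T = All (λ p → All (Ordered d p) T) T

isHookTableau? : ∀ d T → Dec (IsHookTableau d T)
isHookTableau? d T = All.all? (λ p → All.all? (ordered? d p) T) T

hookTableaux : List ℕ → List ℕ → List Filling
hookTableaux ν μ = filter (isHookTableau? (diagonal μ)) (fillings ν μ)

lowerBoxes : List ℕ → List ℕ → ℕ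
lowerBoxes ν μ = length (filter (λ b → diagonal μ ℕ.<? proj₁ b) (boxes ν μ))

open CommutativeRing ℚ[a]-commutativeRing public using (_+_; _*_; -_; 0#; 1#; rawRing)
open Algebra.Definitions.RawSemiring (RawRing.rawSemiring rawRing) public using (_^_)
open PowerSeries ℚ[a]-commutativeRing public

sumOver prodOver : ∀ {A : Set} → List A → (A → ℚ[a]) → ℚ[a]
sumOver  xs f = foldr (λ x r → f x + r) 0# xs
prodOver xs f = foldr (λ x r → f x * r) 1# xs

φ : List ℕ → List ℕ → ℚ[a]
φ ν μ = sumOver (hookTableaux ν μ) λ T → prodOver T λ (_ , t) → a t

-- A symmetric function is given by its restrictions to x₁, …, xₙ for all n;
-- two of them are equal iff all their restrictions are.
SymmetricFunction : Set
SymmetricFunction = ∀ n → R⟦x₁⋯ n ⟧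

infix 4 _≈Λ_
_≈Λ_ : Rel SymmetricFunction 0ℓ
F ≈Λ G = ∀ n → F n ≈ₛ G n

-- det[cⱼ(xᵢ)] / ∏_{i<j} (xᵢ - xⱼ)
bialternant : ∀ {n} → (Fin n → R⟦x⟧) → R⟦x₁⋯ n ⟧
bialternant {n} c = Determinant.det (seriesRawRing n) (λ i j → c j ⟨x i ⟩) /Δ

schurColumn dualColumn : List ℕ → ∀ n → Fin n → R⟦x⟧
schurColumn ν n j₀ = let j = suc (toℕ j₀) in x^ (part ν j ℕ.+ n ∸ j)
dualColumn μ n j₀ =
  let j  = suc (toℕ j₀)
      μⱼ = part μ j
  in
  x^ (μⱼ ℕ.+ n ∸ j) ⊛
    (if does (j ℕ.≤? diagonal μ)
     then ∏ {suc (μⱼ ∸ j)} (λ k → 1/[1- a (ℤ.- (+ toℕ k)) x])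
     else ∏ {j ∸ μⱼ ∸ 1} (λ k → 1- a (+ suc (toℕ k)) x))

schur dualSchur : List ℕ → SymmetricFunction
schur     ν n = if does (length ν ℕ.≤? n) then bialternant (schurColumn ν n) else 0ₛ
dualSchur μ n = if does (length μ ℕ.≤? n) then bialternant (dualColumn μ n) else 0ₛ

-- The formal sum of c ν · s_ν over all partitions ν satisfying P.  As s_ν is
-- homogeneous of degree |ν|, only the partitions of |α| contribute to the
-- coefficient of x^α.
schurSeries : ∀ {P : List ℕ → Set} → (∀ ν → Dec (P ν)) → (List ℕ → ℚ[a]) → SymmetricFunction
schurSeries P? c n α =
  sumOver (filter P? (partitions (Vec.sum α))) λ ν → c ν * schur ν n α

{-# OPTIONS --safe #-}
module Submission where

-- The coefficient of x^β in det[cⱼ(xᵢ)] is the alternant det[cⱼ(βᵢ)], cⱼ(m) being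
-- the coefficient of x^m in cⱼ.  Division by Δ is linear and alternants alternate
-- in β, so it suffices to compare both sides at βᵢ = νᵢ + n - i for partitions ν,
-- where the Schur function s_λ contributes δ_λν.  There the dual alternant is
-- evaluated by peeling variables off its columns, which read
--   x^(mᵢ + n - i) h(a₀, …, a_{1-k})  or  x^(mᵢ + n - i) (1 - a₁x) ⋯ (1 - aₖx)
-- with k = kᵢ, h the generating series of the complete symmetric polynomials.
-- Splitting off the last variable of one column, chosen so that its index is the
-- extremal entry still allowed in a hook ν/m-tableau, decides whether the first
-- box of row i has that entry.  When this entry is forbidden by the box above it,
-- the corresponding determinant has two equal columns.

open import Defs using (module PowerSeries; module Determinant)
open import Algebra.Bundles using (CommutativeMonoid; CommutativeRing)
open import Algebra.Bundles.Raw using (RawRing)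
import Algebra.Definitions.RawSemiring
import Algebra.Properties.CommutativeMonoid.Sum
import Algebra.Properties.CommutativeSemigroup as CommutativeSemigroupProperties
import Algebra.Properties.Ring
open import Data.Bool.Base using (false; if_then_else_; true)
open import Data.Fin.Base as Fin using (Fin; punchIn; suc; toℕ; zero)
import Data.Fin.Properties as Fin
open import Data.Integer.Base as ℤ using (+_; ℤ)
import Data.Integer.Properties as ℤ
open import Data.List.Base
    using (List; []; [_]; _++_; _∷_; allFin; applyUpTo; cartesianProduct; cartesianProductWith;
    concatMap; filter; foldr; length; map; replicate; tabulate; upTo)
open import Data.List.Membership.Propositional using (_∈_; find; lose)
open import Data.List.Membership.Propositional.Properties
    using (∈-applyUpTo⁺; ∈-applyUpTo⁻; ∈-cartesianProductWith⁺; ∈-cartesianProductWith⁻;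
    ∈-concatMap⁺; ∈-concatMap⁻; ∈-filter⁺; ∈-filter⁻; ∈-map⁻; ∈-upTo⁺)
open import Data.List.Properties
    using (++-assoc; ++-identityʳ; applyUpTo-∷ʳ; filter-++; filter-accept; filter-all; filter-none;
    filter-reject; filter-≐; length-++; length-map; length-replicate; map-cong; map-tabulate; map-∘;
    tabulate-cong)
open import Data.List.Relation.Binary.Disjoint.Propositional using (Disjoint)
open import Data.List.Relation.Binary.Pointwise using (Pointwise; []; _∷_)
open import Data.List.Relation.Binary.Prefix.Heterogeneous using ([]; _∷_)
open import Data.List.Relation.Unary.All as All using (All; []; _∷_)
open import Data.List.Relation.Unary.All.Properties as All using (all-filter)
import Data.List.Relation.Unary.AllPairs as AllPairs
import Data.List.Relation.Unary.AllPairs.Properties as AllPairs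
open import Data.List.Relation.Unary.Any using (Any; here; there)
import Data.List.Relation.Unary.Any.Properties as Any
open import Data.List.Relation.Unary.Linked using (Linked; [-]; []; _∷_)
open import Data.List.Relation.Unary.Unique.Propositional using (Unique; []; _∷_)
import Data.List.Relation.Unary.Unique.Propositional.Properties as Unique
open import Data.Nat.Base as ℕ using (_<_; _∸_; _≤_; _≥_; suc; s≤s; zero; z≤n; ℕ)
open import Data.Nat.ListAction using () renaming (sum to size)
open import Data.Nat.Properties as ℕ using (_≟_)
open import Data.Nat.Solver using (module +-*-Solver)
open import Data.Product.Base using (_,_; _×_; proj₁; proj₂; swap; uncurry; ∃)
open import Data.Sum.Base using (_⊎_; inj₁; inj₂)
open import Data.Unit.Base using (tt; ⊤)
open import Data.Vec.Base as Vec using (Vec; []; _∷_; lookup; toList; updateAt)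
import Data.Vec.Properties as Vec
open import Data.Vec.Relation.Unary.All as VecAll using ([]; _∷_)
import Data.Vec.Relation.Unary.All.Properties as VecAll
open import Function.Base using (_∘_; id)
open import Level using (0ℓ; Level; Lift; lift)
open import Relation.Binary.Core using (Rel)
open import Relation.Binary.Definitions using (tri<; tri>; tri≈) renaming (Decidable to Decidable₂)
open import Relation.Binary.PropositionalEquality as ≡ using (_≡_; _≢_)
import Relation.Binary.Reasoning.Setoid
open import Relation.Nullary using (¬_)
open import Relation.Nullary.Decidable
  using (Dec; _×-dec_; _→-dec_; _⊎-dec_; dec-false; dec-true; does; no; yes)
open import Relation.Nullary.Negation using (contradiction)
open import Relation.Unary using (Decidable; Pred)

-- Alternants

-- Three obstacles shape the argument. An upper column is an infinite series, so peeling it can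
-- lengthen a row past the shape `ν`, where tableaux no longer make sense. The evaluation is
-- therefore proved together with a vanishing statement for such inner shapes, and the recursion is
-- cut off once a column starts beyond every exponent at which the alternant is taken. In `φ` an
-- entry of a lower box is bounded by its column, whereas a lower column of the determinant only
-- provides a bound for its row, which is weaker. The induction works with row bounds throughout;
-- only afterwards is it shown that in a tableau they force the column bounds. The series on the
-- right is available one degree at a time: its coefficient at α sums over the partitions of |α|
-- only. Alternants are therefore compared in the single degree that division by Δ reads at α, and
-- this degree has to survive the sorting of exponents.

data StrictlyDecreasing : ∀ {n} → ℕ → Vec ℕ n → Set where
  []  : ∀ {u} → StrictlyDecreasing u []
  _∷_ : ∀ {n u b} {β : Vec ℕ n} → b < u → StrictlyDecreasing b β → StrictlyDecreasing u (b ∷ β)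

applyUpTo-cong : ∀ {a} {A : Set a} {f g : ℕ → A} → (∀ i → f i ≡ g i) → ∀ n → applyUpTo f n ≡ applyUpTo g n
applyUpTo-cong f≡g zero    = ≡.refl
applyUpTo-cong f≡g (suc n) = ≡.cong₂ _∷_ (f≡g 0) (applyUpTo-cong (f≡g ∘ suc) n)

module Alternant {c ℓ : Level} (R : CommutativeRing c ℓ) where
  open CommutativeRing R hiding (zero)
  open PowerSeries R using (R⟦x⟧; x^_)
  open Algebra.Properties.Ring ring
  open CommutativeSemigroupProperties (CommutativeMonoid.commutativeSemigroup +-commutativeMonoid) public
    using (interchange; xy∙z≈xz∙y)
  open CommutativeSemigroupProperties (CommutativeMonoid.commutativeSemigroup *-commutativeMonoid) public
    using () renaming (x∙yz≈y∙xz to *-swap)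
  open Relation.Binary.Reasoning.Setoid setoid

  infix 4 _≈₁_
  _≈₁_ : Rel R⟦x⟧ ℓ
  f ≈₁ g = ∀ m → f m ≈ g m

  -- Laplace expansion of one row, with the minors given by a continuation `g` on the list of
  -- remaining columns. Composing `g` with `f ∷_` puts a skipped column back in its place, and the
  -- minus before the recursive call produces the alternating signs, so no column indices occur.
  expand : ℕ → (List R⟦x⟧ → Carrier) → List R⟦x⟧ → Carrier
  expand b g []       = 0#
  expand b g (f ∷ fs) = f b * g fs - expand b (g ∘ (f ∷_)) fs

  -- The determinant det[fⱼ(βᵢ)], where fⱼ(m) is the coefficient of xᵐ in fⱼ,
  -- expanded along the rows; it is the coefficient of x^β in det[fⱼ(xᵢ)].
  alternant : ∀ {n} → Vec ℕ n → List R⟦x⟧ → Carrier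
  alternant []      []      = 1#
  alternant []      (_ ∷ _) = 0#
  alternant (b ∷ β) fs      = expand b (alternant β) fs

  x-0≈x : ∀ x → x - 0# ≈ x
  x-0≈x x = trans (+-congˡ -0#≈0#) (+-identityʳ x)

  -‿+-distrib : ∀ x y → - (x + y) ≈ - x + - y
  -‿+-distrib x y = sym (-‿+-comm x y)

  -[x-y]≈-x+y : ∀ x y → - (x - y) ≈ - x + y
  -[x-y]≈-x+y x y = trans (-‿+-distrib x (- y)) (+-congˡ (-‿involutive y))

  x-[x-y]≈y : ∀ x y → x - (x - y) ≈ y
  x-[x-y]≈y x y = begin
    x - (x - y)    ≈⟨ +-congˡ (-[x-y]≈-x+y x y) ⟩
    x + (- x + y)  ≈⟨ +-assoc x (- x) y ⟨
    (x - x) + y    ≈⟨ +-congʳ (-‿inverseʳ x) ⟩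
    0# + y         ≈⟨ +-identityˡ y ⟩
    y              ∎

  expand-cong : ∀ b {g h} fs → (∀ fs → g fs ≈ h fs) → expand b g fs ≈ expand b h fs
  expand-cong b []       g≈h = refl
  expand-cong b (f ∷ fs) g≈h = +-cong (*-congˡ (g≈h fs)) (-‿cong (expand-cong b fs (g≈h ∘ (f ∷_))))

  expand-+ : ∀ b g h fs → expand b (λ fs → g fs + h fs) fs ≈ expand b g fs + expand b h fs
  expand-+ b g h []       = sym (+-identityˡ 0#)
  expand-+ b g h (f ∷ fs) = begin
    f b * (g fs + h fs) - expand b (λ fs → g (f ∷ fs) + h (f ∷ fs)) fs
      ≈⟨ +-cong (distribˡ _ _ _) (trans (-‿cong (expand-+ b (g ∘ (f ∷_)) (h ∘ (f ∷_)) fs)) (-‿+-distrib _ _)) ⟩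
    (f b * g fs + f b * h fs) + (- expand b (g ∘ (f ∷_)) fs + - expand b (h ∘ (f ∷_)) fs)
      ≈⟨ interchange _ _ _ _ ⟩
    expand b g (f ∷ fs) + expand b h (f ∷ fs) ∎

  expand-* : ∀ b w g fs → expand b (λ fs → w * g fs) fs ≈ w * expand b g fs
  expand-* b w g []       = sym (zeroʳ w)
  expand-* b w g (f ∷ fs) = begin
    f b * (w * g fs) - expand b (λ fs → w * g (f ∷ fs)) fs
      ≈⟨ +-cong (*-swap _ _ _) (-‿cong (expand-* b w (g ∘ (f ∷_)) fs)) ⟩
    w * (f b * g fs) - w * expand b (g ∘ (f ∷_)) fs
      ≈⟨ +-congˡ (-‿distribʳ-* w _) ⟩
    w * (f b * g fs) + w * - expand b (g ∘ (f ∷_)) fs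
      ≈⟨ distribˡ w _ _ ⟨
    w * expand b g (f ∷ fs) ∎

  expand-neg : ∀ b g fs → expand b (λ fs → - g fs) fs ≈ - expand b g fs
  expand-neg b g fs = begin
    expand b (λ fs → - g fs) fs       ≈⟨ expand-cong b fs (λ fs → sym (-1*x≈-x (g fs))) ⟩
    expand b (λ fs → - 1# * g fs) fs  ≈⟨ expand-* b (- 1#) g fs ⟩
    - 1# * expand b g fs              ≈⟨ -1*x≈-x _ ⟩
    - expand b g fs                   ∎

  expand-linear : ∀ b w g h fs → expand b (λ fs → w * g fs - h fs) fs ≈ w * expand b g fs - expand b h fs
  expand-linear b w g h fs =
    trans (expand-+ b _ _ fs) (+-cong (expand-* b w g fs) (expand-neg b h fs))

  -- Choosing the column `f` in the first of two equal rows cancels against choosing it in the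
  -- second. What remains skips `f` in both rows, which is the same statement for a shorter list and
  -- another continuation.
  expand-expand-≈0 : ∀ b g fs → expand b (expand b g) fs ≈ 0#
  expand-expand-≈0 b g []       = refl
  expand-expand-≈0 b g (f ∷ fs) = begin
    f b * expand b g fs - expand b (λ ds → f b * g ds - expand b (g ∘ (f ∷_)) ds) fs
      ≈⟨ +-congˡ (-‿cong (expand-linear b (f b) g _ fs)) ⟩
    f b * expand b g fs - (f b * expand b g fs - expand b (expand b (g ∘ (f ∷_))) fs)
      ≈⟨ x-[x-y]≈y _ _ ⟩
    expand b (expand b (g ∘ (f ∷_))) fs
      ≈⟨ expand-expand-≈0 b (g ∘ (f ∷_)) fs ⟩
    0# ∎

  -- The terms `u` and `v` use `f` in the first and in the second row. Exchanging the rows exchanges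
  -- them, with opposite sign; the terms avoiding `f` are covered by induction.
  expand-expand-swap : ∀ b₁ b g fs → expand b₁ (expand b g) fs ≈ - expand b (expand b₁ g) fs
  expand-expand-swap b₁ b g []       = sym -0#≈0#
  expand-expand-swap b₁ b g (f ∷ fs) = begin
    expand b₁ (expand b g) (f ∷ fs)
      ≈⟨ unfold b₁ b ⟩
    u - (v - expand b₁ (expand b g′) fs)
      ≈⟨ +-congˡ (-‿cong (+-congˡ (-‿cong (expand-expand-swap b₁ b g′ fs)))) ⟩
    u - (v - - t)
      ≈⟨ +-congˡ (-‿cong (+-congˡ (-‿involutive t))) ⟩
    u - (v + t)
      ≈⟨ +-congˡ (-‿+-distrib v t) ⟩
    u + (- v - t)
      ≈⟨ +-assoc _ _ _ ⟨
    (u - v) - t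
      ≈⟨ +-congʳ (+-comm u (- v)) ⟩
    (- v + u) - t
      ≈⟨ +-assoc _ _ _ ⟩
    - v + (u - t)
      ≈⟨ -[x-y]≈-x+y v (u - t) ⟨
    - (v - (u - t))
      ≈⟨ -‿cong (unfold b b₁) ⟨
    - expand b (expand b₁ g) (f ∷ fs) ∎
    where
    g′ = g ∘ (f ∷_)
    u = f b₁ * expand b g fs
    v = f b * expand b₁ g fs
    t = expand b (expand b₁ g′) fs

    unfold : ∀ b₁ b → expand b₁ (expand b g) (f ∷ fs) ≈
             f b₁ * expand b g fs - (f b * expand b₁ g fs - expand b₁ (expand b g′) fs)
    unfold b₁ b = +-congˡ (-‿cong (expand-linear b₁ (f b) g (expand b g′) fs))

  expand-≈0 : ∀ b g {fs} → All (λ f → f b ≈ 0#) fs → expand b g fs ≈ 0#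
  expand-≈0 b g []             = refl
  expand-≈0 b g {f ∷ fs} (f≈0 ∷ fs≈0) = begin
    f b * g fs - expand b (g ∘ (f ∷_)) fs  ≈⟨ +-cong (trans (*-congʳ f≈0) (zeroˡ _)) (-‿cong (expand-≈0 b _ fs≈0)) ⟩
    0# - 0#                                ≈⟨ x-0≈x 0# ⟩
    0#                                     ∎

  alternant-cong : ∀ {n} (β : Vec ℕ n) {fs gs} → Pointwise _≈₁_ fs gs → alternant β fs ≈ alternant β gs
  alternant-cong []      []       = refl
  alternant-cong []      (_ ∷ _)  = refl
  alternant-cong (b ∷ β) fs≈gs    = go (alternant-cong β) fs≈gs
    where
    go : ∀ {g h fs gs} → (∀ {fs gs} → Pointwise _≈₁_ fs gs → g fs ≈ h gs) →
         Pointwise _≈₁_ fs gs → expand b g fs ≈ expand b h gs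
    go g≈h []            = refl
    go g≈h (f≈g ∷ fs≈gs) = +-cong (*-cong (f≈g b) (g≈h fs≈gs)) (-‿cong (go (g≈h ∘ (f≈g ∷_)) fs≈gs))

  data Linear (w : Carrier) : (fs gs hs : List R⟦x⟧) → Set (c Level.⊔ ℓ) where
    here  : ∀ {f g h fs} → (∀ m → f m ≈ g m + w * h m) → Linear w (f ∷ fs) (g ∷ fs) (h ∷ fs)
    there : ∀ {f fs gs hs} → Linear w fs gs hs → Linear w (f ∷ fs) (f ∷ gs) (f ∷ hs)

  linear-applyUpTo : ∀ {n w} {f g h : ℕ → R⟦x⟧} {r} → r < n →
    (∀ {i} → i ≢ r → f i ≡ g i) → (∀ {i} → i ≢ r → f i ≡ h i) →
    (∀ m → f r m ≈ g r m + w * h r m) → Linear w (applyUpTo f n) (applyUpTo g n) (applyUpTo h n)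
  linear-applyUpTo {suc n} {f = f} {g} {h} {zero} _ f≡g f≡h f≈
    rewrite ≡.sym (applyUpTo-cong {f = f ∘ suc} {g ∘ suc} (λ i → f≡g λ ()) n)
          | ≡.sym (applyUpTo-cong {f = f ∘ suc} {h ∘ suc} (λ i → f≡h λ ()) n)
    = here f≈
  linear-applyUpTo {suc n} {f = f} {g} {h} {suc r} (s≤s r<n) f≡g f≡h f≈
    rewrite ≡.sym (f≡g {0} λ ()) | ≡.sym (f≡h {0} λ ())
    = there (linear-applyUpTo r<n (λ i≢r → f≡g (i≢r ∘ ℕ.suc-injective)) (λ i≢r → f≡h (i≢r ∘ ℕ.suc-injective)) f≈)

  alternant-linear : ∀ {n w fs gs hs} (β : Vec ℕ n) → Linear w fs gs hs →
                     alternant β fs ≈ alternant β gs + w * alternant β hs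
  alternant-linear []      (here _)  = sym (trans (+-identityˡ _) (zeroʳ _))
  alternant-linear []      (there _) = sym (trans (+-identityˡ _) (zeroʳ _))
  alternant-linear {w = w} (b ∷ β) lin = go (alternant-linear β) lin
    where
    go : ∀ {g fs gs hs} → (∀ {fs gs hs} → Linear w fs gs hs → g fs ≈ g gs + w * g hs) →
         Linear w fs gs hs → expand b g fs ≈ expand b g gs + w * expand b g hs
    go {g′} g-lin (here {f} {g} {h} {fs} f≈) = begin
      f b * g′ fs - expand b (g′ ∘ (f ∷_)) fs
        ≈⟨ +-cong (*-congʳ (f≈ b)) (-‿cong (expand-cong b fs λ ds → g-lin (here f≈))) ⟩
      (g b + w * h b) * g′ fs - expand b (λ ds → g′ (g ∷ ds) + w * g′ (h ∷ ds)) fs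
        ≈⟨ +-cong (distribʳ _ _ _) (-‿cong (trans (expand-+ b _ _ fs) (+-congˡ (expand-* b w _ fs)))) ⟩
      (g b * g′ fs + w * h b * g′ fs) - (expand b (g′ ∘ (g ∷_)) fs + w * expand b (g′ ∘ (h ∷_)) fs)
        ≈⟨ +-cong (+-congˡ (*-assoc _ _ _)) (-‿+-distrib _ _) ⟩
      (g b * g′ fs + w * (h b * g′ fs)) + (- expand b (g′ ∘ (g ∷_)) fs + - (w * expand b (g′ ∘ (h ∷_)) fs))
        ≈⟨ interchange _ _ _ _ ⟩
      expand b g′ (g ∷ fs) + (w * (h b * g′ fs) + - (w * expand b (g′ ∘ (h ∷_)) fs))
        ≈⟨ +-congˡ (trans (+-congˡ (-‿distribʳ-* w _)) (sym (distribˡ w _ _))) ⟩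
      expand b g′ (g ∷ fs) + w * expand b g′ (h ∷ fs) ∎
    go {g′} g-lin (there {f} {fs} {gs} {hs} lin) = begin
      f b * g′ fs - expand b (g′ ∘ (f ∷_)) fs
        ≈⟨ +-cong (*-congˡ (g-lin lin)) (-‿cong (go (g-lin ∘ there) lin)) ⟩
      f b * (g′ gs + w * g′ hs) - (expand b (g′ ∘ (f ∷_)) gs + w * expand b (g′ ∘ (f ∷_)) hs)
        ≈⟨ +-cong (trans (distribˡ _ _ _) (+-congˡ (*-swap _ _ _))) (-‿+-distrib _ _) ⟩
      (f b * g′ gs + w * (f b * g′ hs)) + (- expand b (g′ ∘ (f ∷_)) gs + - (w * expand b (g′ ∘ (f ∷_)) hs))
        ≈⟨ interchange _ _ _ _ ⟩
      expand b g′ (f ∷ gs) + (w * (f b * g′ hs) + - (w * expand b (g′ ∘ (f ∷_)) hs))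
        ≈⟨ +-congˡ (trans (+-congˡ (-‿distribʳ-* w _)) (sym (distribˡ w _ _))) ⟩
      expand b g′ (f ∷ gs) + w * expand b g′ (f ∷ hs) ∎

  -- Neighbouring columns suffice: a box is blocked by the box directly above it, so the two columns
  -- that coincide belong to consecutive rows.
  data Repeated : List R⟦x⟧ → Set c where
    here  : ∀ {f fs} → Repeated (f ∷ f ∷ fs)
    there : ∀ {f fs} → Repeated fs → Repeated (f ∷ fs)

  repeated-applyUpTo : ∀ {n} {f : ℕ → R⟦x⟧} {r} → suc r < n → f r ≡ f (suc r) → Repeated (applyUpTo f n)
  repeated-applyUpTo {suc (suc n)} {f} {zero}  _         f≡ rewrite f≡ = here
  repeated-applyUpTo {suc n}       {f} {suc r} (s≤s r<n) f≡ = there (repeated-applyUpTo r<n f≡)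

  alternant-repeated : ∀ {n fs} (β : Vec ℕ n) → Repeated fs → alternant β fs ≈ 0#
  alternant-repeated []      here      = refl
  alternant-repeated []      (there _) = refl
  alternant-repeated (b ∷ β) rep       = go (alternant-repeated β) rep
    where
    go : ∀ {g fs} → (∀ {fs} → Repeated fs → g fs ≈ 0#) → Repeated fs → expand b g fs ≈ 0#
    go {g} g≈0 (here {f} {fs}) = begin
      f b * g (f ∷ fs) - (f b * g (f ∷ fs) - expand b (g ∘ (f ∷_) ∘ (f ∷_)) fs)
        ≈⟨ x-[x-y]≈y _ _ ⟩
      expand b (g ∘ (f ∷_) ∘ (f ∷_)) fs
        -- The vanishing continuation is written as the product `0# * 0#`, so that `expand-*` can
        -- pull out the factor zero.
        ≈⟨ expand-cong b fs (λ ds → trans (g≈0 here) (sym (zeroˡ 0#))) ⟩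
      expand b (λ _ → 0# * 0#) fs
        ≈⟨ expand-* b 0# (λ _ → 0#) fs ⟩
      0# * expand b (λ _ → 0#) fs
        ≈⟨ zeroˡ _ ⟩
      0# ∎
    go {g} g≈0 (there {f} {fs} rep) = begin
      f b * g fs - expand b (g ∘ (f ∷_)) fs  ≈⟨ +-cong (trans (*-congˡ (g≈0 rep)) (zeroʳ _)) (-‿cong (go (g≈0 ∘ there) rep)) ⟩
      0# - 0#                                ≈⟨ x-0≈x 0# ⟩
      0#                                     ∎

  alternant-zeroColumn : ∀ {n fs} (β : Vec ℕ n) → Any (λ f → VecAll.All (λ b → f b ≈ 0#) β) fs →
                         alternant β fs ≈ 0#
  alternant-zeroColumn []      (here _)  = refl
  alternant-zeroColumn []      (there _) = refl
  alternant-zeroColumn (b ∷ β) z         = go (alternant-zeroColumn β) z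
    where
    go : ∀ {g fs} → (∀ {fs} → Any (λ f → VecAll.All (λ b → f b ≈ 0#) β) fs → g fs ≈ 0#) →
         Any (λ f → VecAll.All (λ b → f b ≈ 0#) (b ∷ β)) fs → expand b g fs ≈ 0#
    go {g} {f ∷ fs} g≈0 (here (fb≈0 ∷ fβ≈0)) = begin
      f b * g fs - expand b (g ∘ (f ∷_)) fs
        ≈⟨ +-cong (trans (*-congʳ fb≈0) (zeroˡ _))
             (-‿cong (expand-cong b fs (λ ds → trans (g≈0 (here fβ≈0)) (sym (zeroˡ 0#))))) ⟩
      0# - expand b (λ _ → 0# * 0#) fs
        ≈⟨ +-congˡ (-‿cong (trans (expand-* b 0# (λ _ → 0#) fs) (zeroˡ _))) ⟩
      0# - 0#
        ≈⟨ x-0≈x 0# ⟩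
      0# ∎
    go {g} {f ∷ fs} g≈0 (there z) = begin
      f b * g fs - expand b (g ∘ (f ∷_)) fs
        ≈⟨ +-cong (trans (*-congˡ (g≈0 (weaken z))) (zeroʳ _)) (-‿cong (go (g≈0 ∘ there) z)) ⟩
      0# - 0#
        ≈⟨ x-0≈x 0# ⟩
      0# ∎
      where
      weaken : ∀ {fs} → Any (λ f → VecAll.All (λ b → f b ≈ 0#) (b ∷ β)) fs → Any (λ f → VecAll.All (λ b → f b ≈ 0#) β) fs
      weaken (here (_ ∷ fβ≈0)) = here fβ≈0
      weaken (there z)         = there (weaken z)

  x^-diagonal : ∀ m → (x^ m) m ≈ 1#
  x^-diagonal m rewrite dec-true (m ℕ.≟ m) ≡.refl = refl

  x^-off-diagonal : ∀ {m k} → m ≢ k → (x^ k) m ≈ 0#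
  x^-off-diagonal {m} {k} m≢k rewrite dec-false (m ℕ.≟ k) m≢k = refl

  x^-beyond : ∀ {n b u} {ε : Vec ℕ n} → u ≤ b → StrictlyDecreasing u ε →
              All (λ f → f b ≈ 0#) (toList (Vec.map x^_ ε))
  x^-beyond u≤b []        = []
  x^-beyond u≤b (e<u ∷ d) =
    x^-off-diagonal (ℕ.>⇒≢ (ℕ.<-≤-trans e<u u≤b)) ∷ x^-beyond (ℕ.≤-trans (ℕ.<⇒≤ e<u) u≤b) d

  alternant-monomials-≡ : ∀ {n u} {β : Vec ℕ n} → StrictlyDecreasing u β →
                          alternant β (toList (Vec.map x^_ β)) ≈ 1#
  alternant-monomials-≡ []                    = refl
  alternant-monomials-≡ {β = b ∷ β} (_ ∷ β↓) = begin
    (x^ b) b * alternant β (toList (Vec.map x^_ β)) - expand b (alternant β ∘ ((x^ b) ∷_)) (toList (Vec.map x^_ β))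
      ≈⟨ +-cong (*-cong (x^-diagonal b) (alternant-monomials-≡ β↓)) (-‿cong (expand-≈0 b _ (x^-beyond ℕ.≤-refl β↓))) ⟩
    1# * 1# - 0#
      ≈⟨ trans (x-0≈x _) (*-identityˡ 1#) ⟩
    1# ∎

  strictlyDecreasing-weaken : ∀ {n u v} {β : Vec ℕ n} → u ≤ v → StrictlyDecreasing u β → StrictlyDecreasing v β
  strictlyDecreasing-weaken u≤v []        = []
  strictlyDecreasing-weaken u≤v (b<u ∷ d) = ℕ.<-≤-trans b<u u≤v ∷ d

  strictlyDecreasing-bound : ∀ {n u} {β : Vec ℕ n} → StrictlyDecreasing u β → VecAll.All (_< u) β
  strictlyDecreasing-bound []        = []
  strictlyDecreasing-bound (b<u ∷ d) =
    b<u ∷ VecAll.map (λ a<b → ℕ.<-trans a<b b<u) (strictlyDecreasing-bound d)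

  -- Triangularity, by comparing first entries. If `b < k`, every entry of `β` is below `k` and the
  -- first column vanishes. If `k < b`, then `b` exceeds every exponent in `ε` and the first row
  -- vanishes. If they agree, the first row is supported in the first column and the tails differ.
  alternant-monomials-≢ : ∀ {n u v} {β ε : Vec ℕ n} → StrictlyDecreasing u β → StrictlyDecreasing v ε → β ≢ ε →
                          alternant β (toList (Vec.map x^_ ε)) ≈ 0#
  alternant-monomials-≢ {β = []} {[]} _ _ β≢ε = contradiction ≡.refl β≢ε
  alternant-monomials-≢ {β = b ∷ β} {k ∷ ε} (b<u ∷ β↓) (e<v ∷ ε↓) β≢ε with ℕ.<-cmp b k
  ... | tri< b<e _ _ = alternant-zeroColumn (b ∷ β)
          (here (VecAll.map (λ a<e → x^-off-diagonal (ℕ.<⇒≢ a<e))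
                  (b<e ∷ VecAll.map (λ a<b → ℕ.<-trans a<b b<e) (strictlyDecreasing-bound β↓))))
  ... | tri> _ _ e<b = expand-≈0 b (alternant β) (x^-beyond ℕ.≤-refl (e<b ∷ ε↓))
  ... | tri≈ _ ≡.refl _ = begin
    (x^ b) b * alternant β (toList (Vec.map x^_ ε)) - expand b (alternant β ∘ ((x^ b) ∷_)) (toList (Vec.map x^_ ε))
      ≈⟨ +-cong (*-congˡ (alternant-monomials-≢ β↓ ε↓ (β≢ε ∘ ≡.cong (b ∷_))))
                (-‿cong (expand-≈0 b _ (x^-beyond ℕ.≤-refl ε↓))) ⟩
    (x^ b) b * 0# - 0#
      ≈⟨ trans (x-0≈x _) (zeroʳ _) ⟩
    0# ∎

  -- Conditions on neighbouring entries only, imposed at every position through the tails; this is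
  -- what an insertion sort consumes. Vanishing on equal entries is demanded separately because
  -- antisymmetry gives it only up to a factor 2, which may be a zero divisor in `R`.
  Alternating : ∀ {n} → (Vec ℕ n → Carrier) → Set ℓ
  Alternating {zero}        F = Lift ℓ ⊤
  Alternating {suc zero}    F = Lift ℓ ⊤
  Alternating {suc (suc n)} F =
      (∀ b₁ b β → F (b₁ ∷ b ∷ β) ≈ - F (b ∷ b₁ ∷ β))
    × (∀ b₁ β → F (b₁ ∷ b₁ ∷ β) ≈ 0#)
    × (∀ b₁ → Alternating (F ∘ (b₁ ∷_)))

  alternating-0 : ∀ {n} → Alternating {n} (λ _ → 0#)
  alternating-0 {zero}        = lift tt
  alternating-0 {suc zero}    = lift tt
  alternating-0 {suc (suc n)} = (λ _ _ _ → sym -0#≈0#) , (λ _ _ → refl) , (λ _ → alternating-0)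

  alternating-+ : ∀ {n} {F G : Vec ℕ n → Carrier} → Alternating F → Alternating G → Alternating (λ β → F β + G β)
  alternating-+ {zero}        _ _ = lift tt
  alternating-+ {suc zero}    _ _ = lift tt
  alternating-+ {suc (suc n)} (F-swap , F-rep , F-tail) (G-swap , G-rep , G-tail) =
      (λ b₁ b β → trans (+-cong (F-swap b₁ b β) (G-swap b₁ b β)) (-‿+-comm _ _))
    , (λ b₁ β → trans (+-cong (F-rep b₁ β) (G-rep b₁ β)) (+-identityˡ 0#))
    , (λ b₁ → alternating-+ (F-tail b₁) (G-tail b₁))

  alternating-* : ∀ {n} w {F : Vec ℕ n → Carrier} → Alternating F → Alternating (λ β → w * F β)
  alternating-* {zero}        w _ = lift tt
  alternating-* {suc zero}    w _ = lift tt
  alternating-* {suc (suc n)} w (F-swap , F-rep , F-tail) =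
      (λ b₁ b β → trans (*-congˡ (F-swap b₁ b β)) (sym (-‿distribʳ-* w _)))
    , (λ b₁ β → trans (*-congˡ (F-rep b₁ β)) (zeroʳ w))
    , (λ b₁ → alternating-* w (F-tail b₁))

  alternating-neg : ∀ {n} {F : Vec ℕ n → Carrier} → Alternating F → Alternating (λ β → - F β)
  alternating-neg {zero}        _ = lift tt
  alternating-neg {suc zero}    _ = lift tt
  alternating-neg {suc (suc n)} (F-swap , F-rep , F-tail) =
      (λ b₁ b β → -‿cong (F-swap b₁ b β))
    , (λ b₁ β → trans (-‿cong (F-rep b₁ β)) -0#≈0#)
    , (λ b₁ → alternating-neg (F-tail b₁))

  alternant-alternating : ∀ {n} fs → Alternating {n} (λ β → alternant β fs)
  alternant-alternating {zero}        fs = lift tt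
  alternant-alternating {suc zero}    fs = lift tt
  alternant-alternating {suc (suc n)} fs =
      (λ b₁ b β → expand-expand-swap b₁ b (alternant β) fs)
    , (λ b₁ β → expand-expand-≈0 b₁ (alternant β) fs)
    , (λ b₁ → expand-alternating b₁ (λ fs β → alternant β fs) alternant-alternating fs)
    where
    expand-alternating : ∀ {n} b₁ (F : List R⟦x⟧ → Vec ℕ n → Carrier) → (∀ ds → Alternating (F ds)) →
                         ∀ fs → Alternating (λ β → expand b₁ (λ ds → F ds β) fs)
    expand-alternating b₁ F alt []       = alternating-0
    expand-alternating b₁ F alt (f ∷ fs) =
      alternating-+ (alternating-* (f b₁) (alt fs))
                    (alternating-neg (expand-alternating b₁ (F ∘ (f ∷_)) (alt ∘ (f ∷_)) fs))

  -- Sorting β by insertion multiplies F β and G β by the same sign.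
  alternating-unique : ∀ {n} {F G : Vec ℕ n → Carrier} {P : ℕ → Set} → Alternating F → Alternating G →
    (∀ {u} β → StrictlyDecreasing u β → P (Vec.sum β) → F β ≈ G β) → ∀ β → P (Vec.sum β) → F β ≈ G β
  alternating-unique F-alt G-alt F≈G [] p = F≈G {0} [] [] p
  alternating-unique {suc zero} F-alt G-alt F≈G (b ∷ []) p = F≈G {suc b} (b ∷ []) (ℕ.≤-refl ∷ []) p
  alternating-unique {suc (suc n)} {F} {G} {P} F-alt@(_ , _ , F-tail) G-alt@(_ , _ , G-tail) F≈G (b ∷ β) p =
    alternating-unique {P = λ s → P (b ℕ.+ s)} (F-tail b) (G-tail b)
      (λ {u} γ γ↓ → insert {P = P} F-alt G-alt (λ δ δ↓ → F≈G δ δ↓) (ℕ.m≤m⊔n (suc b) u) γ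
                      (strictlyDecreasing-weaken (ℕ.m≤n⊔m (suc b) u) γ↓))
      β p
    where
    -- The bound `u` dominates both `b` and `γ`. When `b` passes a larger entry `c`, the sign
    -- changes on both sides and `c` becomes the new bound. The predicate `P` restricts the sum of
    -- the entries, which sorting preserves; it is what confines the comparison to one degree.
    insert : ∀ {n u b} {F G : Vec ℕ (suc n) → Carrier} {P : ℕ → Set} → Alternating F → Alternating G →
             (∀ β → StrictlyDecreasing u β → P (Vec.sum β) → F β ≈ G β) →
             b < u → ∀ γ → StrictlyDecreasing u γ → P (b ℕ.+ Vec.sum γ) → F (b ∷ γ) ≈ G (b ∷ γ)
    insert {b = b} F-alt G-alt F≈G b<u [] [] p = F≈G (b ∷ []) (b<u ∷ []) p
    insert {suc n} {b = b} {F} {G} {P} (F-swap , F-rep , F-tail) (G-swap , G-rep , G-tail) F≈G b<u (c ∷ γ) (c<u ∷ γ↓) p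
      with ℕ.<-cmp b c
    ... | tri> _ _ c<b    = F≈G (b ∷ c ∷ γ) (b<u ∷ c<b ∷ γ↓) p
    ... | tri≈ _ ≡.refl _ = trans (F-rep b γ) (sym (G-rep b γ))
    ... | tri< b<c _ _    = begin
      F (b ∷ c ∷ γ)    ≈⟨ F-swap b c γ ⟩
      - F (c ∷ b ∷ γ)  ≈⟨ -‿cong (insert {P = λ s → P (c ℕ.+ s)} (F-tail c) (G-tail c)
                            (λ β β↓ → F≈G (c ∷ β) (c<u ∷ β↓)) b<c γ γ↓
                            (≡.subst P (CommutativeSemigroupProperties.x∙yz≈y∙xz ℕ.+-commutativeSemigroup b c (Vec.sum γ)) p)) ⟩
      - G (c ∷ b ∷ γ)  ≈⟨ G-swap b c γ ⟨
      G (b ∷ c ∷ γ)    ∎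

-- Determinants of power series and division by Δ

module SeriesAlternant {c ℓ : Level} (R : CommutativeRing c ℓ) where
  open CommutativeRing R hiding (zero)
  open Algebra.Definitions.RawSemiring (RawRing.rawSemiring rawRing) using (_^_)
  open Algebra.Properties.Ring ring
  open Algebra.Properties.CommutativeMonoid.Sum +-commutativeMonoid
    using (sum; sum⁺-syntax; sum-cong-≋; ∑-distrib-+; sum-replicate-zero)
  open PowerSeries R
  open Alternant R
  open Relation.Binary.Reasoning.Setoid setoid

  sum-≈0 : ∀ {m} {t : Fin m → Carrier} → (∀ i → t i ≈ 0#) → sum t ≈ 0#
  sum-≈0 {m} t≈0 = trans (sum-cong-≋ t≈0) (sum-replicate-zero m)

  *-distribˡ-sum : ∀ {m} w (t : Fin m → Carrier) → w * sum t ≈ sum (λ i → w * t i)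
  *-distribˡ-sum {zero}  w t = zeroʳ w
  *-distribˡ-sum {suc m} w t = trans (distribˡ w _ _) (+-congˡ (*-distribˡ-sum w (t ∘ suc)))

  sum-last : ∀ k (t : ℕ → Carrier) → (∀ {i} → i < k → t i ≈ 0#) → ∑[ i ≤ k ] t (toℕ i) ≈ t k
  sum-last zero    t t≈0 = +-identityʳ _
  sum-last (suc k) t t≈0 =
    trans (+-congʳ (t≈0 (s≤s z≤n))) (trans (+-identityˡ _) (sum-last k (t ∘ suc) (λ i<k → t≈0 (s≤s i<k))))

  *ₛ-cong : ∀ {n} {f f′ g g′ : R⟦x₁⋯ n ⟧} → f ≈ₛ f′ → g ≈ₛ g′ → f *ₛ g ≈ₛ f′ *ₛ g′
  *ₛ-cong {zero}  p q []      = *-cong (p []) (q [])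
  *ₛ-cong {suc n} p q (k ∷ α) =
    sum-cong-≋ {suc k} λ i → *ₛ-cong (λ β → p (toℕ i ∷ β)) (λ β → q (k ∸ toℕ i ∷ β)) α

  *ₛ-zeroˡ : ∀ {n} (g : R⟦x₁⋯ n ⟧) → 0ₛ *ₛ g ≈ₛ 0ₛ
  *ₛ-zeroˡ {zero}  g []      = zeroˡ _
  *ₛ-zeroˡ {suc n} g (k ∷ α) = sum-≈0 {suc k} λ i → *ₛ-zeroˡ (λ β → g (k ∸ toℕ i ∷ β)) α

  *ₛ-zeroʳ : ∀ {n} (f : R⟦x₁⋯ n ⟧) → f *ₛ 0ₛ ≈ₛ 0ₛ
  *ₛ-zeroʳ {zero}  f []      = zeroʳ _
  *ₛ-zeroʳ {suc n} f (k ∷ α) = sum-≈0 {suc k} λ i → *ₛ-zeroʳ (λ β → f (toℕ i ∷ β)) α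

  *ₛ-identityˡ : ∀ {n} (g : R⟦x₁⋯ n ⟧) → 1ₛ *ₛ g ≈ₛ g
  *ₛ-identityˡ {zero}  g []      = *-identityˡ _
  *ₛ-identityˡ {suc n} g (k ∷ α) = trans
    (+-cong (*ₛ-identityˡ (λ β → g (k ∷ β)) α)
            (sum-≈0 {k} λ i → *ₛ-zeroˡ (λ β → g (k ∸ suc (toℕ i) ∷ β)) α))
    (+-identityʳ _)

  *ₛ-scaleˡ : ∀ {n} w (f g : R⟦x₁⋯ n ⟧) → (λ α → w * f α) *ₛ g ≈ₛ λ α → w * (f *ₛ g) α
  *ₛ-scaleˡ {zero}  w f g []      = *-assoc _ _ _
  *ₛ-scaleˡ {suc n} w f g (k ∷ α) = trans
    (sum-cong-≋ {suc k} λ i → *ₛ-scaleˡ w (λ β → f (toℕ i ∷ β)) (λ β → g (k ∸ toℕ i ∷ β)) α)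
    (sym (*-distribˡ-sum {suc k} w (λ i → ((λ β → f (toℕ i ∷ β)) *ₛ (λ β → g (k ∸ toℕ i ∷ β))) α)))

  *ₛ-scalar : ∀ {n} w (g : R⟦x₁⋯ n ⟧) → (λ α → w * 1ₛ α) *ₛ g ≈ₛ λ α → w * g α
  *ₛ-scalar w g α = trans (*ₛ-scaleˡ w 1ₛ g α) (*-congˡ (*ₛ-identityˡ g α))

  module _ {n : ℕ} where
    open Algebra.Definitions.RawSemiring (RawRing.rawSemiring (seriesRawRing n)) public
      using () renaming (_^_ to _^ₛ_; sum to sumₛ)
    open Determinant (seriesRawRing n) public using () renaming (det to detₛ)

  sumₛ-coefficient : ∀ {n m} (F : Fin m → R⟦x₁⋯ n ⟧) α → sumₛ F α ≡ sum (λ j → F j α)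
  sumₛ-coefficient {m = zero}  F α = ≡.refl
  sumₛ-coefficient {m = suc m} F α = ≡.cong (λ x → F zero α + x) (sumₛ-coefficient (F ∘ suc) α)

  -1ₛ^-coefficient : ∀ {n} j → (-ₛ 1ₛ {n}) ^ₛ j ≈ₛ λ α → (- 1#) ^ j * 1ₛ α
  -1ₛ^-coefficient zero    α = sym (*-identityˡ _)
  -1ₛ^-coefficient (suc j) α = begin
    (-ₛ 1ₛ *ₛ (-ₛ 1ₛ) ^ₛ j) α                     ≈⟨ *ₛ-cong (λ β → sym (-1*x≈-x _)) (-1ₛ^-coefficient j) α ⟩
    ((λ β → - 1# * 1ₛ β) *ₛ (λ β → (- 1#) ^ j * 1ₛ β)) α  ≈⟨ *ₛ-scalar (- 1#) (λ β → (- 1#) ^ j * 1ₛ β) α ⟩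
    - 1# * ((- 1#) ^ j * 1ₛ α)                    ≈⟨ *-assoc _ _ _ ⟨
    - 1# * (- 1#) ^ j * 1ₛ α                      ∎

  detₛ-coefficient : ∀ {n m} (M : Fin (suc m) → Fin (suc m) → R⟦x₁⋯ n ⟧) α →
    detₛ M α ≈ sum λ j → (- 1#) ^ toℕ j * (M zero j *ₛ detₛ (λ i k → M (suc i) (punchIn j k))) α
  detₛ-coefficient {n} {m} M α = trans
    (reflexive (sumₛ-coefficient (λ j → (-ₛ 1ₛ) ^ₛ toℕ j *ₛ M zero j *ₛ minor j) α))
    (sum-cong-≋ λ j → begin
      ((-ₛ 1ₛ) ^ₛ toℕ j *ₛ M zero j *ₛ minor j) α
        ≈⟨ *ₛ-cong (*ₛ-cong (-1ₛ^-coefficient (toℕ j)) (λ _ → refl)) (λ _ → refl) α ⟩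
      ((λ β → (- 1#) ^ toℕ j * 1ₛ β) *ₛ M zero j *ₛ minor j) α
        ≈⟨ *ₛ-cong (*ₛ-scalar ((- 1#) ^ toℕ j) (M zero j)) (λ _ → refl) α ⟩
      ((λ β → (- 1#) ^ toℕ j * M zero j β) *ₛ minor j) α
        ≈⟨ *ₛ-scaleˡ ((- 1#) ^ toℕ j) (M zero j) (minor j) α ⟩
      (- 1#) ^ toℕ j * (M zero j *ₛ minor j) α ∎)
    where
    minor : Fin (suc m) → R⟦x₁⋯ n ⟧
    minor j = detₛ (λ i k → M (suc i) (punchIn j k))

  detₛ-cong : ∀ {n m} {M N : Fin m → Fin m → R⟦x₁⋯ n ⟧} → (∀ i j → M i j ≈ₛ N i j) → detₛ M ≈ₛ detₛ N
  detₛ-cong {m = zero}  M≈N α = refl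
  detₛ-cong {m = suc m} {M} {N} M≈N α = begin
    detₛ M α  ≈⟨ detₛ-coefficient M α ⟩
    _         ≈⟨ sum-cong-≋ {suc m} (λ j → *-congˡ {(- 1#) ^ toℕ j} (*ₛ-cong (M≈N zero j) (detₛ-cong (λ i k → M≈N (suc i) (punchIn j k))) α)) ⟩
    _         ≈⟨ detₛ-coefficient N α ⟨
    detₛ N α  ∎

  -- A series regarded as free of a new first variable. The minors complementary to the first row of
  -- det[cⱼ(xᵢ)] are of this kind.
  embed : ∀ {n} → R⟦x₁⋯ n ⟧ → R⟦x₁⋯ suc n ⟧
  embed f (zero  ∷ α) = f α
  embed f (suc _ ∷ α) = 0#

  embed-* : ∀ {n} (f g : R⟦x₁⋯ n ⟧) → embed f *ₛ embed g ≈ₛ embed (f *ₛ g)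
  embed-* f g (zero  ∷ α) = +-identityʳ _
  embed-* f g (suc k ∷ α) = trans
    (+-cong (*ₛ-zeroʳ f α) (sum-≈0 {suc k} λ i → *ₛ-zeroˡ (λ β → embed g (k ∸ toℕ i ∷ β)) α))
    (+-identityˡ 0#)

  embed-det : ∀ {n m} (M : Fin m → Fin m → R⟦x₁⋯ n ⟧) → detₛ (λ i j → embed (M i j)) ≈ₛ embed (detₛ M)
  embed-det {m = zero}  M (zero  ∷ α) = refl
  embed-det {m = zero}  M (suc k ∷ α) = refl
  embed-det {n} {suc m} M α = begin
    detₛ (λ i j → embed (M i j)) α
      ≈⟨ detₛ-coefficient (λ i j → embed (M i j)) α ⟩
    _ ≈⟨ sum-cong-≋ {suc m} (λ j → *-congˡ {(- 1#) ^ toℕ j} (trans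
           (*ₛ-cong {f = embed (M zero j)} (λ _ → refl) (embed-det (λ i k → M (suc i) (punchIn j k))) α)
           (embed-* (M zero j) (minor j) α))) ⟩
    sum (λ j → (- 1#) ^ toℕ j * embed (M zero j *ₛ minor j) α)
      ≈⟨ embed-sum α ⟩
    embed (detₛ M) α ∎
    where
    minor : Fin (suc m) → R⟦x₁⋯ n ⟧
    minor j = detₛ (λ i k → M (suc i) (punchIn j k))

    embed-sum : ∀ α → sum (λ j → (- 1#) ^ toℕ j * embed (M zero j *ₛ minor j) α) ≈ embed (detₛ M) α
    embed-sum (zero  ∷ α) = sym (detₛ-coefficient M α)
    embed-sum (suc k ∷ α) = sum-≈0 {suc m} λ j → zeroʳ ((- 1#) ^ toℕ j)

  ⟨x⟩-suc : ∀ {n} (f : R⟦x⟧) (i : Fin n) → f ⟨x suc i ⟩ ≈ₛ embed (f ⟨x i ⟩)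
  ⟨x⟩-suc f i (zero  ∷ α) = refl
  ⟨x⟩-suc f i (suc k ∷ α) = refl

  ⟨x⟩-zero : ∀ {n} (f : R⟦x⟧) k (α : Vec ℕ n) → (f ⟨x zero ⟩) (k ∷ α) ≈ f k * 1ₛ α
  ⟨x⟩-zero f k α rewrite dec-true (k ℕ.≟ k) ≡.refl with does (Vec.≡-dec ℕ._≟_ α (Vec.replicate _ 0))
  ... | true  = sym (*-identityʳ _)
  ... | false = sym (zeroʳ _)

  ⟨x⟩-zero-* : ∀ {n} (f : R⟦x⟧) (g : R⟦x₁⋯ n ⟧) k α → ((f ⟨x zero ⟩) *ₛ embed g) (k ∷ α) ≈ f k * g α
  ⟨x⟩-zero-* f g k α = begin
    ((f ⟨x zero ⟩) *ₛ embed g) (k ∷ α)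
      ≈⟨ sum-last k (λ i → ((λ β → (f ⟨x zero ⟩) (i ∷ β)) *ₛ (λ γ → embed g (k ∸ i ∷ γ))) α)
           (λ {i} i<k → trans
             (*ₛ-cong {f = λ β → (f ⟨x zero ⟩) (i ∷ β)} (λ _ → refl) (λ γ → embed-≈0 γ (ℕ.m<n⇒0<n∸m i<k)) α)
             (*ₛ-zeroʳ (λ β → (f ⟨x zero ⟩) (i ∷ β)) α)) ⟩
    ((λ β → (f ⟨x zero ⟩) (k ∷ β)) *ₛ (λ γ → embed g (k ∸ k ∷ γ))) α
      ≈⟨ *ₛ-cong (⟨x⟩-zero f k) (λ γ → reflexive (≡.cong (λ p → embed g (p ∷ γ)) (ℕ.n∸n≡0 k))) α ⟩
    ((λ β → f k * 1ₛ β) *ₛ g) α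
      ≈⟨ *ₛ-scalar (f k) g α ⟩
    f k * g α ∎
    where
    embed-≈0 : ∀ {p} γ → 0 < p → embed g (p ∷ γ) ≈ 0#
    embed-≈0 {suc p} γ _ = refl

  expand-tabulate : ∀ {n} b g (c : Fin (suc n) → R⟦x⟧) →
    sum (λ j → (- 1#) ^ toℕ j * (c j b * g (tabulate (c ∘ punchIn j)))) ≈ expand b g (tabulate c)
  expand-tabulate {n} b g c = +-cong (*-identityˡ _) (begin
    sum (λ j → (- 1#) ^ suc (toℕ j) * (c (suc j) b * g (tabulate (c ∘ punchIn (suc j)))))
      ≈⟨ sum-cong-≋ {n} (λ j → *-assoc _ _ _) ⟩
    sum (λ j → - 1# * ((- 1#) ^ toℕ j * (c (suc j) b * g (tabulate (c ∘ punchIn (suc j))))))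
      ≈⟨ *-distribˡ-sum {n} (- 1#) _ ⟨
    - 1# * sum (λ j → (- 1#) ^ toℕ j * (c (suc j) b * g (tabulate (c ∘ punchIn (suc j)))))
      ≈⟨ trans (-1*x≈-x _) (-‿cong (tail c)) ⟩
    - expand b (g ∘ (c zero ∷_)) (tabulate (c ∘ suc)) ∎)
    where
    tail : ∀ {n} (c : Fin (suc n) → R⟦x⟧) →
      sum (λ j → (- 1#) ^ toℕ j * (c (suc j) b * g (tabulate (c ∘ punchIn (suc j))))) ≈
      expand b (g ∘ (c zero ∷_)) (tabulate (c ∘ suc))
    tail {zero}  c = refl
    tail {suc n} c = expand-tabulate b (g ∘ (c zero ∷_)) (c ∘ suc)

  -- The first row involves only the first variable and its minors only the others. Hence the power
  -- of the first variable selects one coefficient from the entry of the first row, and the rest of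
  -- the exponent is left to the minor.
  det-alternant : ∀ {n} (c : Fin n → R⟦x⟧) → detₛ (λ i j → c j ⟨x i ⟩) ≈ₛ λ α → alternant α (tabulate c)
  det-alternant {zero}  c []      = refl
  det-alternant {suc n} c (k ∷ α) = begin
    detₛ (λ i j → c j ⟨x i ⟩) (k ∷ α)
      ≈⟨ detₛ-coefficient (λ i j → c j ⟨x i ⟩) (k ∷ α) ⟩
    sum (λ j → (- 1#) ^ toℕ j * ((c j ⟨x zero ⟩) *ₛ detₛ (λ i l → c (punchIn j l) ⟨x suc i ⟩)) (k ∷ α))
      ≈⟨ sum-cong-≋ {suc n} (λ j → *-congˡ {(- 1#) ^ toℕ j} (begin
           ((c j ⟨x zero ⟩) *ₛ detₛ (λ i l → c (punchIn j l) ⟨x suc i ⟩)) (k ∷ α)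
             ≈⟨ *ₛ-cong {f = c j ⟨x zero ⟩} (λ _ → refl) (λ β → trans
                  (detₛ-cong (λ i l → ⟨x⟩-suc (c (punchIn j l)) i) β)
                  (embed-det (λ i l → c (punchIn j l) ⟨x i ⟩) β)) (k ∷ α) ⟩
           ((c j ⟨x zero ⟩) *ₛ embed (detₛ (λ i l → c (punchIn j l) ⟨x i ⟩))) (k ∷ α)
             ≈⟨ ⟨x⟩-zero-* (c j) (detₛ (λ i l → c (punchIn j l) ⟨x i ⟩)) k α ⟩
           c j k * detₛ (λ i l → c (punchIn j l) ⟨x i ⟩) α
             ≈⟨ *-congˡ (det-alternant (c ∘ punchIn j) α) ⟩
           c j k * alternant α (tabulate (c ∘ punchIn j)) ∎)) ⟩
    sum (λ j → (- 1#) ^ toℕ j * (c j k * alternant α (tabulate (c ∘ punchIn j))))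
      ≈⟨ expand-tabulate k (alternant α) c ⟩
    alternant (k ∷ α) (tabulate c) ∎

  divide : ∀ {n} → R⟦x₁⋯ n ⟧ → List (Fin n × Fin n) → R⟦x₁⋯ n ⟧
  divide f = foldr (λ (i , j) g → g /[x i -x j ]) f

  divide-linear : ∀ {n} w (f g : R⟦x₁⋯ n ⟧) ps →
                  divide (λ β → w * f β + g β) ps ≈ₛ λ α → w * divide f ps α + divide g ps α
  divide-linear w f g []             α = refl
  divide-linear w f g ((i , j) ∷ ps) α = begin
    divide (λ β → w * f β + g β) ((i , j) ∷ ps) α
      ≈⟨ sum-cong-≋ {suc (lookup α j)} (λ k → divide-linear w f g ps (α′ k)) ⟩
    sum (λ k → w * divide f ps (α′ k) + divide g ps (α′ k))
      ≈⟨ ∑-distrib-+ {suc (lookup α j)} (λ k → w * divide f ps (α′ k)) (λ k → divide g ps (α′ k)) ⟩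
    sum (λ k → w * divide f ps (α′ k)) + divide g ((i , j) ∷ ps) α
      ≈⟨ +-congʳ (*-distribˡ-sum {suc (lookup α j)} w (λ k → divide f ps (α′ k))) ⟨
    w * divide f ((i , j) ∷ ps) α + divide g ((i , j) ∷ ps) α ∎
    where
    α′ : Fin (suc (lookup α j)) → Vec ℕ _
    α′ k = updateAt (updateAt α i (suc (toℕ k) ℕ.+_)) j (_∸ toℕ k)

  divide-0 : ∀ {n} ps → divide {n} 0ₛ ps ≈ₛ 0ₛ
  divide-0 []             α = refl
  divide-0 ((i , j) ∷ ps) α = sum-≈0 {suc (lookup α j)} λ k →
    divide-0 ps (updateAt (updateAt α i (suc (toℕ k) ℕ.+_)) j (_∸ toℕ k))

  sum-updateAt-+ : ∀ {n} (α : Vec ℕ n) i k → Vec.sum (updateAt α i (k ℕ.+_)) ≡ k ℕ.+ Vec.sum α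
  sum-updateAt-+ (a ∷ α) zero    k = ℕ.+-assoc k a (Vec.sum α)
  sum-updateAt-+ (a ∷ α) (suc i) k = ≡.trans (≡.cong (a ℕ.+_) (sum-updateAt-+ α i k))
    (CommutativeSemigroupProperties.x∙yz≈y∙xz ℕ.+-commutativeSemigroup a k (Vec.sum α))

  sum-updateAt-∸ : ∀ {n} (α : Vec ℕ n) i k → k ≤ lookup α i → k ℕ.+ Vec.sum (updateAt α i (_∸ k)) ≡ Vec.sum α
  sum-updateAt-∸ α i k k≤ = ≡.trans (≡.sym (sum-updateAt-+ (updateAt α i (_∸ k)) i k))
    (≡.cong Vec.sum (≡.trans (Vec.updateAt-updateAt-local i α (ℕ.m+[n∸m]≡n k≤)) (Vec.updateAt-id i α)))

  -- A coefficient of f / (xᵢ - xⱼ) is a sum of coefficients of f in degree one higher, so dividing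
  -- by all factors raises the degree by the number of pairs. The indices must differ for this
  -- count: the truncated subtraction at `j` then never cuts off.
  divide-cong : ∀ {n} {f g : R⟦x₁⋯ n ⟧} ps → All (λ (i , j) → i ≢ j) ps → ∀ α →
                (∀ β → Vec.sum β ≡ length ps ℕ.+ Vec.sum α → f β ≈ g β) → divide f ps α ≈ divide g ps α
  divide-cong []             []           α f≈g = f≈g α ≡.refl
  divide-cong ((i , j) ∷ ps) (i≢j ∷ i≢js) α f≈g = sum-cong-≋ {suc (lookup α j)} λ k →
    divide-cong ps i≢js (updateAt (updateAt α i (suc (toℕ k) ℕ.+_)) j (_∸ toℕ k))
      λ β sum-β → f≈g β (≡.trans sum-β (≡.trans (≡.cong (length ps ℕ.+_) (step k)) (ℕ.+-suc (length ps) _)))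
    where
    step : ∀ k → Vec.sum (updateAt (updateAt α i (suc (toℕ k) ℕ.+_)) j (_∸ toℕ k)) ≡ suc (Vec.sum α)
    step k = ℕ.+-cancelˡ-≡ (toℕ k) _ _ (≡.trans
      (sum-updateAt-∸ (updateAt α i (suc (toℕ k) ℕ.+_)) j (toℕ k)
        (ℕ.≤-trans (Fin.toℕ≤pred[n] k) (ℕ.≤-reflexive (≡.sym (Vec.lookup∘updateAt′ j i (i≢j ∘ ≡.sym) α)))))
      (≡.trans (sum-updateAt-+ α i (suc (toℕ k))) (≡.sym (ℕ.+-suc (toℕ k) _))))

  /Δ-cong : ∀ {n} {f g : R⟦x₁⋯ n ⟧} α →
            (∀ β → Vec.sum β ≡ length (pairs n) ℕ.+ Vec.sum α → f β ≈ g β) → (f /Δ) α ≈ (g /Δ) α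
  /Δ-cong {n} = divide-cong (pairs n) (All.map Fin.<⇒≢ (all-filter _ (cartesianProduct (allFin n) (allFin n))))

-- The columns of the dual Schur determinant

module ColumnSeries {c ℓ : Level} (R : CommutativeRing c ℓ) where
  open CommutativeRing R hiding (zero)
  open Algebra.Definitions.RawSemiring (RawRing.rawSemiring rawRing) using (_^_)
  open Algebra.Properties.CommutativeMonoid.Sum +-commutativeMonoid
    using (sum; sum⁺-syntax; sum-cong-≋; sum-replicate-zero)
  open PowerSeries R
  open Alternant R
  open SeriesAlternant R
  open Relation.Binary.Reasoning.Setoid setoid

  shift : ℕ → R⟦x⟧ → R⟦x⟧
  shift zero    f m       = f m
  shift (suc s) f zero    = 0#
  shift (suc s) f (suc m) = shift s f m

  -- The complete symmetric polynomial of degree `m` in `u 0`, ..., `u (k - 1)`. The recursion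
  -- removes the last variable, which is the one to be peeled off.
  complete : (ℕ → Carrier) → ℕ → R⟦x⟧
  complete u zero    m       = (x^ 0) m
  complete u (suc k) zero    = complete u k zero
  complete u (suc k) (suc m) = complete u k (suc m) + u k * complete u (suc k) m

  -- The elementary symmetric polynomial of degree `m` with sign (-1)^m. In contrast to `complete`,
  -- the multiple of `u k` no longer involves `u k`. This difference is the algebraic source of
  -- weakly increasing rows in the upper part of a tableau and strictly decreasing rows in the lower
  -- part.
  signedElementary : (ℕ → Carrier) → ℕ → R⟦x⟧
  signedElementary u zero    m       = (x^ 0) m
  signedElementary u (suc k) zero    = signedElementary u k zero
  signedElementary u (suc k) (suc m) = signedElementary u k (suc m) + - u k * signedElementary u k m

  shift-cong : ∀ s {f g} → f ≈₁ g → shift s f ≈₁ shift s g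
  shift-cong zero    f≈g m       = f≈g m
  shift-cong (suc s) f≈g zero    = refl
  shift-cong (suc s) f≈g (suc m) = shift-cong s f≈g m

  shift-below : ∀ s f {m} → m < s → shift s f m ≈ 0#
  shift-below (suc s) f {zero}  _         = refl
  shift-below (suc s) f {suc m} (s≤s m<e) = shift-below s f m<e

  shift-1 : ∀ s → shift s (x^ 0) ≈₁ x^ s
  shift-1 zero    m       = refl
  shift-1 (suc s) zero    = refl
  shift-1 (suc s) (suc m) = shift-1 s m

  shift-⊛ : ∀ s f → x^ s ⊛ f ≈₁ shift s f
  shift-⊛ zero    f m       = begin
    1# * f m + sum {m} (λ i → 0# * f (m ∸ suc (toℕ i)))
      ≈⟨ +-cong (*-identityˡ _) (sum-≈0 {m} λ i → zeroˡ (f (m ∸ suc (toℕ i)))) ⟩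
    f m + 0#
      ≈⟨ +-identityʳ _ ⟩
    f m ∎
  shift-⊛ (suc s) f zero    = trans (+-identityʳ _) (zeroˡ _)
  shift-⊛ (suc s) f (suc m) = trans (trans (+-congʳ (zeroˡ _)) (+-identityˡ _)) (shift-⊛ s f m)

  shift-complete : ∀ u k s m →
    shift s (complete u (suc k)) m ≈ shift s (complete u k) m + u k * shift (suc s) (complete u (suc k)) m
  shift-complete u k zero    zero    = sym (trans (+-congˡ (zeroʳ _)) (+-identityʳ _))
  shift-complete u k zero    (suc m) = refl
  shift-complete u k (suc s) zero    = sym (trans (+-congˡ (zeroʳ _)) (+-identityʳ _))
  shift-complete u k (suc s) (suc m) = shift-complete u k s m

  shift-signedElementary : ∀ u k s m →
    shift s (signedElementary u (suc k)) m ≈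
    shift s (signedElementary u k) m + - u k * shift (suc s) (signedElementary u k) m
  shift-signedElementary u k zero    zero    = sym (trans (+-congˡ (zeroʳ _)) (+-identityʳ _))
  shift-signedElementary u k zero    (suc m) = refl
  shift-signedElementary u k (suc s) zero    = sym (trans (+-congˡ (zeroʳ _)) (+-identityʳ _))
  shift-signedElementary u k (suc s) (suc m) = shift-signedElementary u k s m

  -- Splitting off the first variable commutes with splitting off the last; this is the common
  -- induction step of `complete-first` and `signedElementary-first`.
  exchange : ∀ A p q {x y z} → (A + p * x) + q * (y + p * z) ≈ (A + q * y) + p * (x + q * z)
  exchange A p q {x} {y} {z} = begin
    (A + p * x) + q * (y + p * z)          ≈⟨ +-congˡ (distribˡ q _ _) ⟩
    (A + p * x) + (q * y + q * (p * z))    ≈⟨ interchange _ _ _ _ ⟩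
    (A + q * y) + (p * x + q * (p * z))    ≈⟨ +-congˡ (+-congˡ (*-swap q p z)) ⟩
    (A + q * y) + (p * x + p * (q * z))    ≈⟨ +-congˡ (distribˡ p _ _) ⟨
    (A + q * y) + p * (x + q * z)          ∎

  complete-0 : ∀ u k → complete u k 0 ≈ 1#
  complete-0 u zero    = refl
  complete-0 u (suc k) = complete-0 u k

  -- The product `∏` is a right fold and exposes the first factor, while `complete` is defined by
  -- its last variable; this recursion reconciles the two.
  complete-first : ∀ u k m →
    complete u (suc k) (suc m) ≈ complete (u ∘ suc) k (suc m) + u 0 * complete u (suc k) m
  complete-first u zero    m    = refl
  complete-first u (suc k) zero = begin
    complete u (suc k) 1 + q * complete u k 0
      ≈⟨ +-cong (complete-first u k 0) (*-congˡ (complete-0 u k)) ⟩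
    (A + u 0 * complete u k 0) + q * 1#
      ≈⟨ xy∙z≈xz∙y _ _ _ ⟩
    (A + q * 1#) + u 0 * complete u k 0
      ≈⟨ +-congʳ (+-congˡ (*-congˡ (sym (complete-0 (u ∘ suc) k)))) ⟩
    (A + q * complete (u ∘ suc) k 0) + u 0 * complete u k 0 ∎
    where
    q = u (suc k)
    A = complete (u ∘ suc) k 1
  complete-first u (suc k) (suc m) = begin
    complete u (suc k) (suc (suc m)) + q * complete u (suc (suc k)) (suc m)
      ≈⟨ +-cong (complete-first u k (suc m)) (*-congˡ (complete-first u (suc k) m)) ⟩
    (A + u 0 * complete u (suc k) (suc m)) + q * (complete (u ∘ suc) (suc k) (suc m) + u 0 * complete u (suc (suc k)) m)
      ≈⟨ exchange A (u 0) q ⟩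
    (A + q * complete (u ∘ suc) (suc k) (suc m)) + u 0 * (complete u (suc k) (suc m) + q * complete u (suc (suc k)) m) ∎
    where
    q = u (suc k)
    A = complete (u ∘ suc) k (suc (suc m))

  signedElementary-0 : ∀ u k → signedElementary u k 0 ≈ 1#
  signedElementary-0 u zero    = refl
  signedElementary-0 u (suc k) = signedElementary-0 u k

  signedElementary-first : ∀ u k m →
    signedElementary u (suc k) (suc m) ≈
    signedElementary (u ∘ suc) k (suc m) + - u 0 * signedElementary (u ∘ suc) k m
  signedElementary-first u zero    m    = refl
  signedElementary-first u (suc k) zero = begin
    signedElementary u (suc k) 1 + q * signedElementary u k 0
      ≈⟨ +-cong (signedElementary-first u k 0) (*-congˡ (trans (signedElementary-0 u k) (sym (signedElementary-0 (u ∘ suc) k)))) ⟩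
    (A + - u 0 * signedElementary (u ∘ suc) k 0) + q * signedElementary (u ∘ suc) k 0
      ≈⟨ xy∙z≈xz∙y _ _ _ ⟩
    (A + q * signedElementary (u ∘ suc) k 0) + - u 0 * signedElementary (u ∘ suc) k 0 ∎
    where
    q = - u (suc k)
    A = signedElementary (u ∘ suc) k 1
  signedElementary-first u (suc k) (suc m) = begin
    signedElementary u (suc k) (suc (suc m)) + q * signedElementary u (suc k) (suc m)
      ≈⟨ +-cong (signedElementary-first u k (suc m)) (*-congˡ (signedElementary-first u k m)) ⟩
    (A + - u 0 * s (suc m)) + q * (s (suc m) + - u 0 * s m)
      ≈⟨ exchange A (- u 0) q ⟩
    (A + q * s (suc m)) + - u 0 * (s (suc m) + q * s m) ∎
    where
    q = - u (suc k)
    s = signedElementary (u ∘ suc) k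
    A = s (suc (suc m))

  geometric-⊛ : ∀ w f m → (1/[1- w x] ⊛ f) (suc m) ≈ f (suc m) + w * (1/[1- w x] ⊛ f) m
  geometric-⊛ w f m = +-cong (*-identityˡ _) (begin
    sum {suc m} (λ i → w * w ^ toℕ i * f (m ∸ toℕ i))    ≈⟨ sum-cong-≋ {suc m} (λ i → *-assoc w (w ^ toℕ i) (f (m ∸ toℕ i))) ⟩
    sum {suc m} (λ i → w * (w ^ toℕ i * f (m ∸ toℕ i)))  ≈⟨ *-distribˡ-sum {suc m} w (λ i → w ^ toℕ i * f (m ∸ toℕ i)) ⟨
    w * (1/[1- w x] ⊛ f) m                               ∎)

  linear-⊛ : ∀ w f m → ((1- w x) ⊛ f) (suc m) ≈ f (suc m) + - w * f m
  linear-⊛ w f m = +-cong (*-identityˡ _) (begin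
    - w * f m + sum {m} (λ i → 0# * f (m ∸ suc (toℕ i)))
      ≈⟨ +-congˡ (sum-≈0 {m} λ i → zeroˡ (f (m ∸ suc (toℕ i)))) ⟩
    - w * f m + 0#
      ≈⟨ +-identityʳ _ ⟩
    - w * f m ∎)

  ⊛-congʳ : ∀ f {g h} → g ≈₁ h → f ⊛ g ≈₁ f ⊛ h
  ⊛-congʳ f g≈h m = sum-cong-≋ {suc m} λ i → *-congˡ {f (toℕ i)} (g≈h (m ∸ toℕ i))

  ∏-geometric : ∀ u k → ∏ {k} (λ i → 1/[1- u (toℕ i) x]) ≈₁ complete u k
  ∏-geometric u zero    m = refl
  ∏-geometric u (suc k) m = trans (⊛-congʳ 1/[1- u 0 x] (∏-geometric (u ∘ suc) k) m) (go m)
    where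
    go : 1/[1- u 0 x] ⊛ complete (u ∘ suc) k ≈₁ complete u (suc k)
    go zero    = trans (+-identityʳ _) (trans (*-identityˡ _)
                   (trans (complete-0 (u ∘ suc) k) (sym (complete-0 u k))))
    go (suc m) = trans (geometric-⊛ (u 0) (complete (u ∘ suc) k) m)
                   (trans (+-congˡ (*-congˡ (go m))) (sym (complete-first u k m)))

  ∏-linear : ∀ u k → ∏ {k} (λ i → 1- u (toℕ i) x) ≈₁ signedElementary u k
  ∏-linear u zero    m = refl
  ∏-linear u (suc k) m = trans (⊛-congʳ (1- u 0 x) (∏-linear (u ∘ suc) k) m) (go m)
    where
    go : (1- u 0 x) ⊛ signedElementary (u ∘ suc) k ≈₁ signedElementary u (suc k)
    go zero    = trans (+-identityʳ _) (trans (*-identityˡ _)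
                   (trans (signedElementary-0 (u ∘ suc) k) (sym (signedElementary-0 u k))))
    go (suc m) = trans (linear-⊛ (u 0) (signedElementary (u ∘ suc) k) m)
                   (sym (signedElementary-first u k m))

-- The degree of the Vandermonde product

filter-map : ∀ {A B : Set} {P : Pred B 0ℓ} (P? : Decidable P) (f : A → B) xs →
             filter P? (map f xs) ≡ map f (filter (P? ∘ f) xs)
filter-map P? f []       = ≡.refl
filter-map P? f (x ∷ xs) with P? (f x)
... | yes _ = ≡.cong (f x ∷_) (filter-map P? f xs)
... | no _  = filter-map P? f xs

length-filter-cartesianProduct : ∀ {A B : Set} {P : Pred (A × B) 0ℓ} (P? : Decidable P) xs ys →
  length (filter P? (cartesianProduct xs ys)) ≡ size (map (λ x → length (filter (λ y → P? (x , y)) ys)) xs)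
length-filter-cartesianProduct P? []       ys = ≡.refl
length-filter-cartesianProduct P? (x ∷ xs) ys = begin
  length (filter P? (map (x ,_) ys ++ cartesianProduct xs ys))
    ≡⟨ ≡.cong length (filter-++ P? (map (x ,_) ys) _) ⟩
  length (filter P? (map (x ,_) ys) ++ filter P? (cartesianProduct xs ys))
    ≡⟨ length-++ (filter P? (map (x ,_) ys)) ⟩
  length (filter P? (map (x ,_) ys)) ℕ.+ length (filter P? (cartesianProduct xs ys))
    ≡⟨ ≡.cong₂ ℕ._+_ (≡.trans (≡.cong length (filter-map P? (x ,_) ys)) (length-map (x ,_) (filter (P? ∘ (x ,_)) ys))) (length-filter-cartesianProduct P? xs ys) ⟩
  size (map (λ x → length (filter (λ y → P? (x , y)) ys)) (x ∷ xs)) ∎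
  where open ≡.≡-Reasoning

-- The offset `s` of the window of values of `g` is there for the induction: passing to the tail
-- moves the window up by one.
count-above : ∀ {n k} c s (g : Fin n → Fin k) → (∀ j → toℕ (g j) ≡ s ℕ.+ toℕ j) →
              length (filter (λ j → c ℕ.<? toℕ j) (tabulate g)) ≡ n ∸ (suc c ∸ s)
count-above {zero}  c s g g≡ = ≡.sym (ℕ.0∸n≡0 (suc c ∸ s))
count-above {suc n} c s g g≡ with c ℕ.<? toℕ (g zero) | ≡.trans (g≡ zero) (ℕ.+-identityʳ s)
... | yes c<g0 | g0≡s = ≡.trans (≡.trans (≡.cong length (filter-accept (λ j → c ℕ.<? toℕ j) c<g0))
  (≡.cong suc (≡.trans (count-above c (suc s) (g ∘ suc) (λ j → ≡.trans (g≡ (suc j)) (ℕ.+-suc s (toℕ j))))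
                       (≡.cong (n ∸_) (ℕ.m≤n⇒m∸n≡0 (ℕ.<⇒≤ c<s))))))
  (≡.sym (≡.cong (suc n ∸_) (ℕ.m≤n⇒m∸n≡0 c<s)))
  where c<s = ≡.subst (c <_) g0≡s c<g0
... | no c≮g0 | g0≡s = ≡.trans (≡.trans (≡.cong length (filter-reject (λ j → c ℕ.<? toℕ j) c≮g0))
  (count-above c (suc s) (g ∘ suc) (λ j → ≡.trans (g≡ (suc j)) (ℕ.+-suc s (toℕ j)))))
  (≡.sym (≡.cong (suc n ∸_) (ℕ.+-∸-assoc 1 (≡.subst (_≤ c) g0≡s (ℕ.≮⇒≥ c≮g0)))))

-- The sum of n - 1, ..., 1, 0. It is at once the degree of Δ and the difference between the sum of
-- the exponents νᵢ + n - i and the size of ν, so the two shifts of degree cancel in the end.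
staircase : ℕ → ℕ
staircase n = size (tabulate {n = n} λ i → n ∸ suc (toℕ i))

length-pairs : ∀ {c ℓ} (R : CommutativeRing c ℓ) n → length (PowerSeries.pairs R n) ≡ staircase n
length-pairs R n = begin
  length (filter (λ (i , j) → i Fin.<? j) (cartesianProduct (allFin n) (allFin n)))
    ≡⟨ length-filter-cartesianProduct (λ (i , j) → i Fin.<? j) (allFin n) (allFin n) ⟩
  size (map (λ i → length (filter (i Fin.<?_) (allFin n))) (allFin n))
    ≡⟨ ≡.cong size (map-tabulate {n = n} id _) ⟩
  size (tabulate {n = n} (λ i → length (filter (i Fin.<?_) (allFin n))))
    ≡⟨ ≡.cong size (tabulate-cong {n = n} λ i → count-above {n} (toℕ i) 0 id (λ _ → ≡.refl)) ⟩
  staircase n ∎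
  where open ≡.≡-Reasoning

open import Defs

-- Sums over fillings

filter-comm : ∀ {A : Set} {P Q : Pred A 0ℓ} (P? : Decidable P) (Q? : Decidable Q) xs →
              filter P? (filter Q? xs) ≡ filter Q? (filter P? xs)
filter-comm P? Q? [] = ≡.refl
filter-comm P? Q? (x ∷ xs) with P? x in p | Q? x in q
... | yes _ | yes _ rewrite p | q = ≡.cong (x ∷_) (filter-comm P? Q? xs)
... | yes _ | no  _ rewrite q = filter-comm P? Q? xs
... | no  _ | yes _ rewrite p = filter-comm P? Q? xs
... | no  _ | no  _ = filter-comm P? Q? xs

filter-filter : ∀ {A : Set} {P Q S : Pred A 0ℓ} (P? : Decidable P) (Q? : Decidable Q) (S? : Decidable S) →
                (∀ {x} → S x → P x × Q x) → (∀ {x} → P x × Q x → S x) →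
                ∀ xs → filter S? xs ≡ filter P? (filter Q? xs)
filter-filter P? Q? S? to from [] = ≡.refl
filter-filter P? Q? S? to from (x ∷ xs) with Q? x
... | no ¬Qx = ≡.trans (filter-reject S? (¬Qx ∘ proj₂ ∘ to)) (filter-filter P? Q? S? to from xs)
... | yes Qx with P? x
... | yes Px = ≡.trans (filter-accept S? (from (Px , Qx))) (≡.cong (x ∷_) (filter-filter P? Q? S? to from xs))
... | no ¬Px = ≡.trans (filter-reject S? (¬Px ∘ proj₁ ∘ to)) (filter-filter P? Q? S? to from xs)

filter-absorb : ∀ {A : Set} {P Q : Pred A 0ℓ} (P? : Decidable P) (Q? : Decidable Q) xs →
                (∀ {x} → x ∈ xs → P x → Q x) → filter P? (filter Q? xs) ≡ filter P? xs
filter-absorb P? Q? []       P⇒Q = ≡.refl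
filter-absorb P? Q? (x ∷ xs) P⇒Q with Q? x | P? x in p
... | yes _  | yes _  rewrite p = ≡.cong (x ∷_) (filter-absorb P? Q? xs (P⇒Q ∘ there))
... | yes _  | no  _  rewrite p = filter-absorb P? Q? xs (P⇒Q ∘ there)
... | no ¬Qx | yes Px = contradiction (P⇒Q (here ≡.refl) Px) ¬Qx
... | no _   | no  _  = filter-absorb P? Q? xs (P⇒Q ∘ there)

choices-filter : ∀ {A : Set} {P : Pred A 0ℓ} (P? : Decidable P) xss →
                 filter (All.all? P?) (choices xss) ≡ choices (map (filter P?) xss)
choices-filter {A} P? []         = ≡.refl
choices-filter {A} P? (xs ∷ xss) = ≡.trans (go xs)
  (≡.cong (cartesianProductWith _∷_ (filter P? xs)) (choices-filter P? xss))
  where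
  ys = choices xss

  none : ∀ {x} → ¬ _ → ∀ ys → filter (All.all? P?) (map (x ∷_) ys) ≡ []
  none ¬Px []       = ≡.refl
  none {x} ¬Px (y ∷ ys) = ≡.trans (filter-reject (All.all? P?) {x ∷ y} (λ where (Px ∷ _) → ¬Px Px)) (none ¬Px ys)

  some : ∀ {x} → _ → ∀ ys → filter (All.all? P?) (map (x ∷_) ys) ≡ map (x ∷_) (filter (All.all? P?) ys)
  some {x} Px ys = ≡.trans (filter-map (All.all? P?) (x ∷_) ys)
    (≡.cong (map (x ∷_)) (filter-≐ (All.all? P? ∘ (x ∷_)) (All.all? P?) ((λ where (_ ∷ p) → p) , (Px ∷_)) ys))

  go : ∀ xs → filter (All.all? P?) (cartesianProductWith _∷_ xs ys) ≡
              cartesianProductWith _∷_ (filter P? xs) (filter (All.all? P?) ys)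
  go []       = ≡.refl
  go (x ∷ xs) with P? x
  ... | yes Px = ≡.trans (filter-++ (All.all? P?) (map (x ∷_) ys) _) (≡.cong₂ _++_ (some Px ys) (go xs))
  ... | no ¬Px = ≡.trans (filter-++ (All.all? P?) (map (x ∷_) ys) _) (≡.cong₂ _++_ (none ¬Px ys) (go xs))

private
  module R = CommutativeRing ℚ[a]-commutativeRing
open Alternant ℚ[a]-commutativeRing
open ColumnSeries ℚ[a]-commutativeRing
open SeriesAlternant ℚ[a]-commutativeRing
open Algebra.Properties.Ring R.ring using (-0#≈0#; -1*x≈-x; -‿distribˡ-*; -‿distribʳ-*)

private variable
  A B : Set

sumOver-cong-∈ : ∀ (xs : List A) {f g} → (∀ {x} → x ∈ xs → f x ≋ g x) → sumOver xs f ≋ sumOver xs g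
sumOver-cong-∈ []       f≋g = ≋-refl
sumOver-cong-∈ (x ∷ xs) f≋g = ⊕-cong (f≋g (here ≡.refl)) (sumOver-cong-∈ xs (f≋g ∘ there))

sumOver-cong : ∀ (xs : List A) {f g} → (∀ x → f x ≋ g x) → sumOver xs f ≋ sumOver xs g
sumOver-cong xs f≋g = sumOver-cong-∈ xs λ {x} _ → f≋g x

sumOver-0 : ∀ (xs : List A) {f} → (∀ {x} → x ∈ xs → f x ≋ 0#) → sumOver xs f ≋ 0#
sumOver-0 []       f≋0 = ≋-refl
sumOver-0 (x ∷ xs) f≋0 =
  ≋-trans (⊕-cong (f≋0 (here ≡.refl)) (sumOver-0 xs (f≋0 ∘ there))) (⊕-identityˡ 0#)

sumOver-++ : ∀ (xs ys : List A) f → sumOver (xs ++ ys) f ≋ sumOver xs f + sumOver ys f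
sumOver-++ []       ys f = ≋-sym (⊕-identityˡ _)
sumOver-++ (x ∷ xs) ys f = ≋-trans (⊕-cong ≋-refl (sumOver-++ xs ys f)) (≋-sym (⊕-assoc _ _ _))

sumOver-+ : ∀ (xs : List A) f g → sumOver xs (λ x → f x + g x) ≋ sumOver xs f + sumOver xs g
sumOver-+ []       f g = ≋-sym (⊕-identityˡ _)
sumOver-+ (x ∷ xs) f g = ≋-trans (⊕-cong ≋-refl (sumOver-+ xs f g)) (interchange _ _ _ _)

sumOver-* : ∀ w (xs : List A) f → w * sumOver xs f ≋ sumOver xs (λ x → w * f x)
sumOver-* w []       f = R.zeroʳ w
sumOver-* w (x ∷ xs) f = ≋-trans (⊗-distribˡ _ _ _) (⊕-cong ≋-refl (sumOver-* w xs f))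

sumOver-filter : ∀ {P : Pred A 0ℓ} (P? : Decidable P) xs f →
                 sumOver (filter P? xs) f ≋ sumOver xs (λ x → if does (P? x) then f x else 0#)
sumOver-filter P? []       f = ≋-refl
sumOver-filter P? (x ∷ xs) f with P? x
... | yes _ = ⊕-cong ≋-refl (sumOver-filter P? xs f)
... | no  _ = ≋-trans (sumOver-filter P? xs f) (≋-sym (⊕-identityˡ _))

sumOver-map : ∀ (h : B → A) xs f → sumOver (map h xs) f ≡ sumOver xs (f ∘ h)
sumOver-map h []       f = ≡.refl
sumOver-map h (x ∷ xs) f = ≡.cong (λ y → f (h x) + y) (sumOver-map h xs f)

sumOver-swap : ∀ (xs : List A) (ys : List B) (f : A → B → ℚ[a]) →
               sumOver xs (λ x → sumOver ys (f x)) ≋ sumOver ys (λ y → sumOver xs (λ x → f x y))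
sumOver-swap []       ys f = ≋-sym (sumOver-0 ys λ _ → ≋-refl)
sumOver-swap (x ∷ xs) ys f = ≋-trans (⊕-cong ≋-refl (sumOver-swap xs ys f)) (≋-sym (sumOver-+ ys (f x) _))

sumOver-filter-cartesianProductWith : ∀ {P : Pred (List A) 0ℓ} (P? : Decidable P) xs yss W →
  sumOver (filter P? (cartesianProductWith _∷_ xs yss)) W ≋
  sumOver xs (λ x → sumOver (filter (P? ∘ (x ∷_)) yss) (W ∘ (x ∷_)))
sumOver-filter-cartesianProductWith P? []       yss W = ≋-refl
sumOver-filter-cartesianProductWith P? (x ∷ xs) yss W = begin
  sumOver (filter P? (map (x ∷_) yss ++ cartesianProductWith _∷_ xs yss)) W
    ≡⟨ ≡.cong (λ l → sumOver l W) (filter-++ P? (map (x ∷_) yss) _) ⟩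
  sumOver (filter P? (map (x ∷_) yss) ++ filter P? (cartesianProductWith _∷_ xs yss)) W
    ≈⟨ sumOver-++ (filter P? (map (x ∷_) yss)) _ W ⟩
  sumOver (filter P? (map (x ∷_) yss)) W + sumOver (filter P? (cartesianProductWith _∷_ xs yss)) W
    ≈⟨ ⊕-cong (R.reflexive (≡.trans (≡.cong (λ l → sumOver l W) (filter-map P? (x ∷_) yss)) (sumOver-map (x ∷_) (filter (P? ∘ (x ∷_)) yss) W)))
              (sumOver-filter-cartesianProductWith P? xs yss W) ⟩
  sumOver (x ∷ xs) (λ x → sumOver (filter (P? ∘ (x ∷_)) yss) (W ∘ (x ∷_))) ∎
  where open Relation.Binary.Reasoning.Setoid R.setoid

exchange-if : ∀ {P Q : Set} (P? : Dec P) (Q? : Dec Q) → (P → Q) → (Q → P) → ∀ {x y z z′} → z ≋ z′ →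
              x * (if does P? then y * z else 0#) ≋ y * (if does Q? then x * z′ else 0#)
exchange-if (yes _) (yes _) _   _   z≋z′ = ≋-trans (*-swap _ _ _) (⊗-cong ≋-refl (⊗-cong ≋-refl z≋z′))
exchange-if (no _)  (no _)  _   _   _    = ≋-trans (R.zeroʳ _) (≋-sym (R.zeroʳ _))
exchange-if (yes p) (no ¬q) p⇒q _   _    = contradiction (p⇒q p) ¬q
exchange-if (no ¬p) (yes q) _   q⇒p _    = contradiction (q⇒p q) ¬p

-- The conditions on a filling concern pairs of boxes.  Once the entry of the
-- first box is chosen, those involving it restrict the entries of the others.
module FillingSum {O : Rel (Box × ℤ) 0ℓ} (O? : Decidable₂ O) (O-refl : ∀ p → O p p) where

  open Relation.Binary.Reasoning.Setoid R.setoid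

  Compatible : Rel (Box × ℤ) 0ℓ
  Compatible p q = O p q × O q p

  compatible? : Decidable₂ Compatible
  compatible? p q = O? p q ×-dec O? q p

  Valid : Filling → Set
  Valid T = All (λ p → All (O p) T) T

  valid? : Decidable Valid
  valid? T = All.all? (λ p → All.all? (O? p) T) T

  restrict : Box × ℤ → (Box → List ℤ) → Box → List ℤ
  restrict p E b = filter (λ t → compatible? p (b , t)) (E b)

  fillingSum : List Box → (Box → List ℤ) → ℚ[a]
  fillingSum []      E = 1#
  fillingSum (b ∷ L) E = sumOver (E b) λ t → a t * fillingSum L (restrict (b , t) E)

  fillingSum-cong : ∀ L {E E′} → (∀ {b} → b ∈ L → E b ≡ E′ b) → fillingSum L E ≋ fillingSum L E′
  fillingSum-cong []      E≡E′ = ≋-refl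
  fillingSum-cong (b ∷ L) {E} {E′} E≡E′ rewrite E≡E′ (here ≡.refl) =
    sumOver-cong (E′ b) λ t → ⊗-cong ≋-refl
      (fillingSum-cong L λ {b′} b′∈L → ≡.cong (filter (λ t′ → compatible? (b , t) (b′ , t′))) (E≡E′ (there b′∈L)))

  -- `Compatible` is symmetric, so both orders put the same test on the pair, and the restrictions
  -- imposed on the other boxes commute. This allows the first box of any row to be moved to the
  -- front and its entry to be chosen first.
  fillingSum-swap : ∀ b b′ L E → fillingSum (b ∷ b′ ∷ L) E ≋ fillingSum (b′ ∷ b ∷ L) E
  fillingSum-swap b b′ L E = begin
    fillingSum (b ∷ b′ ∷ L) E
      ≈⟨ unfold b b′ ⟩
    sumOver (E b) (λ t → sumOver (E b′) (term b b′ t))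
      ≈⟨ sumOver-swap (E b) (E b′) (term b b′) ⟩
    sumOver (E b′) (λ t′ → sumOver (E b) (λ t → term b b′ t t′))
      ≈⟨ sumOver-cong (E b′) (λ t′ → sumOver-cong (E b) (λ t → term-sym t t′)) ⟩
    sumOver (E b′) (λ t′ → sumOver (E b) (term b′ b t′))
      ≈⟨ unfold b′ b ⟨
    fillingSum (b′ ∷ b ∷ L) E ∎
    where
    term : Box → Box → ℤ → ℤ → ℚ[a]
    term b b′ t t′ = a t * (if does (compatible? (b , t) (b′ , t′))
                            then a t′ * fillingSum L (restrict (b′ , t′) (restrict (b , t) E)) else 0#)

    unfold : ∀ b b′ → fillingSum (b ∷ b′ ∷ L) E ≋ sumOver (E b) (λ t → sumOver (E b′) (term b b′ t))
    unfold b b′ = sumOver-cong (E b) λ t → ≋-trans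
      (⊗-cong ≋-refl (sumOver-filter (λ t′ → compatible? (b , t) (b′ , t′)) (E b′) _))
      (sumOver-* (a t) (E b′) _)

    term-sym : ∀ t t′ → term b b′ t t′ ≋ term b′ b t′ t
    term-sym t t′ = exchange-if (compatible? (b , t) (b′ , t′)) (compatible? (b′ , t′) (b , t)) swap swap
      (fillingSum-cong L λ {c} _ →
        filter-comm (λ u → compatible? (b′ , t′) (c , u)) (λ u → compatible? (b , t) (c , u)) (E c))

  fillingSum-front : ∀ L₁ b L₂ E → fillingSum (L₁ ++ b ∷ L₂) E ≋ fillingSum (b ∷ L₁ ++ L₂) E
  fillingSum-front []       b L₂ E = ≋-refl
  fillingSum-front (c ∷ L₁) b L₂ E = ≋-trans
    (sumOver-cong (E c) λ t → ⊗-cong ≋-refl (fillingSum-front L₁ b L₂ (restrict (c , t) E)))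
    (fillingSum-swap c b (L₁ ++ L₂) E)

  fillingSum-empty : ∀ {b} L {E} → b ∈ L → E b ≡ [] → fillingSum L E ≋ 0#
  fillingSum-empty (b ∷ L) (here ≡.refl) Eb≡[] rewrite Eb≡[] = ≋-refl
  fillingSum-empty {b} (c ∷ L) {E} (there b∈L) Eb≡[] = sumOver-0 (E c) λ {t} _ → ≋-trans
    (⊗-cong ≋-refl (fillingSum-empty L b∈L (≡.cong (filter (λ t′ → compatible? (c , t) (b , t′))) Eb≡[])))
    (R.zeroʳ _)

  -- Separates the fillings with entry `v` in `b`. Boxes of `L` may lose their own last option `v′`
  -- at the same time, as long as `v′` clashes with every remaining option of `b`. In this way
  -- lowering the flag of a whole row changes nothing beyond its first box.
  fillingSum-peel : ∀ b L {E E′} v → E b ≡ E′ b ++ [ v ] →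
    (∀ {b′} → b′ ∈ L → E b′ ≡ E′ b′ ⊎
      ∃ λ v′ → E b′ ≡ E′ b′ ++ [ v′ ] × (∀ {t} → t ∈ E′ b → ¬ Compatible (b , t) (b′ , v′))) →
    fillingSum (b ∷ L) E ≋ fillingSum (b ∷ L) E′ + a v * fillingSum L (restrict (b , v) E)
  fillingSum-peel b L {E} {E′} v Eb≡ E≡ rewrite Eb≡ = begin
    sumOver (E′ b ++ [ v ]) (λ t → a t * fillingSum L (restrict (b , t) E))
      ≈⟨ sumOver-++ (E′ b) [ v ] _ ⟩
    sumOver (E′ b) (λ t → a t * fillingSum L (restrict (b , t) E)) + (a v * fillingSum L (restrict (b , v) E) + 0#)
      ≈⟨ ⊕-cong (sumOver-cong-∈ (E′ b) λ t∈ → ⊗-cong ≋-refl (fillingSum-cong L (same t∈))) (R.+-identityʳ _) ⟩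
    fillingSum (b ∷ L) E′ + a v * fillingSum L (restrict (b , v) E) ∎
    where
    same : ∀ {t b′} → t ∈ E′ b → b′ ∈ L → restrict (b , t) E b′ ≡ restrict (b , t) E′ b′
    same {t} {b′} t∈ b′∈L with E≡ b′∈L
    ... | inj₁ eq = ≡.cong (filter (λ t′ → compatible? (b , t) (b′ , t′))) eq
    ... | inj₂ (v′ , eq , ¬c) = ≡.trans (≡.cong (filter C?) eq) (≡.trans (filter-++ C? (E′ b′) [ v′ ])
            (≡.trans (≡.cong (filter C? (E′ b′) ++_) (filter-reject C? (¬c t∈))) (++-identityʳ _)))
      where
      C? = λ t′ → compatible? (b , t) (b′ , t′)

  allFillings : List Box → (Box → List ℤ) → List Filling
  allFillings L E = choices (map (λ b → map (b ,_) (E b)) L)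

  allFillings-filter : ∀ {P : Pred (Box × ℤ) 0ℓ} (P? : Decidable P) L E →
    filter (All.all? P?) (allFillings L E) ≡ allFillings L (λ b → filter (P? ∘ (b ,_)) (E b))
  allFillings-filter P? L E = ≡.trans (choices-filter P? (map (λ b → map (b ,_) (E b)) L)) (≡.cong choices (≡.trans (≡.sym (map-∘ L))
    (map-cong (λ b → filter-map P? (b ,_) (E b)) L)))

  sumOver-valid : ∀ L E → sumOver (filter valid? (allFillings L E)) (λ T → prodOver T λ (_ , t) → a t) ≋ fillingSum L E
  sumOver-valid []      E = R.+-identityʳ _
  sumOver-valid (b ∷ L) E = begin
    sumOver (filter valid? (cartesianProductWith _∷_ (map (b ,_) (E b)) (allFillings L E))) W
      ≈⟨ sumOver-filter-cartesianProductWith valid? (map (b ,_) (E b)) (allFillings L E) W ⟩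
    sumOver (map (b ,_) (E b)) (λ p → sumOver (filter (valid? ∘ (p ∷_)) (allFillings L E)) (W ∘ (p ∷_)))
      ≡⟨ sumOver-map (b ,_) (E b) _ ⟩
    sumOver (E b) (λ t → sumOver (filter (valid? ∘ ((b , t) ∷_)) (allFillings L E)) (W ∘ ((b , t) ∷_)))
      ≈⟨ sumOver-cong (E b) (λ t → begin
           sumOver (filter (valid? ∘ ((b , t) ∷_)) (allFillings L E)) (W ∘ ((b , t) ∷_))
             ≡⟨ ≡.cong (λ l → sumOver l (W ∘ ((b , t) ∷_))) (≡.trans
                  (filter-filter valid? (All.all? (compatible? (b , t))) (valid? ∘ ((b , t) ∷_)) to from (allFillings L E))
                  (≡.cong (filter valid?) (allFillings-filter (compatible? (b , t)) L E))) ⟩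
           sumOver (filter valid? (allFillings L (restrict (b , t) E))) (λ T → a t * W T)
             ≈⟨ sumOver-* (a t) (filter valid? (allFillings L (restrict (b , t) E))) W ⟨
           a t * sumOver (filter valid? (allFillings L (restrict (b , t) E))) W
             ≈⟨ ⊗-cong ≋-refl (sumOver-valid L (restrict (b , t) E)) ⟩
           a t * fillingSum L (restrict (b , t) E) ∎) ⟩
    fillingSum (b ∷ L) E ∎
    where
    W : Filling → ℚ[a]
    W T = prodOver T λ (_ , t) → a t

    to : ∀ {p T} → Valid (p ∷ T) → Valid T × All (Compatible p) T
    to ((_ ∷ pT) ∷ T-valid) = All.map (λ where (_ ∷ o) → o) T-valid , All.zip (pT , All.map (λ where (o ∷ _) → o) T-valid)

    from : ∀ {p T} → Valid T × All (Compatible p) T → Valid (p ∷ T)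
    from {p} (T-valid , compatible) =
      (O-refl p ∷ All.map proj₁ compatible) ∷ All.zipWith (uncurry λ o os → proj₂ o ∷ os) (compatible , T-valid)

  ∈-allFillings-entry : ∀ L {E T b t} → T ∈ allFillings L E → (b , t) ∈ T → b ∈ L × t ∈ E b
  ∈-allFillings-entry []      (here ≡.refl) ()
  ∈-allFillings-entry (c ∷ L) {E} T∈ bt∈T
    with (p , T′ , p∈ , T′∈ , ≡.refl) ← ∈-cartesianProductWith⁻ _∷_ (map (c ,_) (E c)) (allFillings L E) T∈
    with (t , t∈ , ≡.refl) ← ∈-map⁻ (c ,_) p∈
    with bt∈T
  ... | here ≡.refl  = here ≡.refl , t∈
  ... | there bt∈T′ = let b∈L , t∈E = ∈-allFillings-entry L T′∈ bt∈T′ in there b∈L , t∈E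

  ∈-allFillings-box : ∀ L {E T b} → T ∈ allFillings L E → b ∈ L → ∃ λ t → (b , t) ∈ T
  ∈-allFillings-box (c ∷ L) {E} T∈ b∈L
    with (p , T′ , p∈ , T′∈ , ≡.refl) ← ∈-cartesianProductWith⁻ _∷_ (map (c ,_) (E c)) (allFillings L E) T∈
    with (t , t∈ , ≡.refl) ← ∈-map⁻ (c ,_) p∈
    with b∈L
  ... | here ≡.refl = t , here ≡.refl
  ... | there b∈L′ = let t , bt∈ = ∈-allFillings-box L T′∈ b∈L′ in t , there bt∈

  -- Serves to trade the row bounds on lower entries for the column bounds in `φ`: the latter hold
  -- in every valid filling, so they may be imposed on the options beforehand.
  fillingSum-filter : ∀ {P : Pred (Box × ℤ) 0ℓ} (P? : Decidable P) L E →
    (∀ {T} → T ∈ allFillings L E → Valid T → All P T) →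
    fillingSum L (λ b → filter (P? ∘ (b ,_)) (E b)) ≋ fillingSum L E
  fillingSum-filter P? L E valid⇒P = begin
    fillingSum L (λ b → filter (P? ∘ (b ,_)) (E b))
      ≈⟨ sumOver-valid L _ ⟨
    sumOver (filter valid? (allFillings L (λ b → filter (P? ∘ (b ,_)) (E b)))) (λ T → prodOver T λ (_ , t) → a t)
      ≡⟨ ≡.cong (λ l → sumOver l (λ T → prodOver T λ (_ , t) → a t)) (≡.trans
           (≡.cong (filter valid?) (≡.sym (allFillings-filter P? L E)))
           (filter-absorb valid? (All.all? P?) (allFillings L E) valid⇒P)) ⟩
    sumOver (filter valid? (allFillings L E)) (λ T → prodOver T λ (_ , t) → a t)
      ≈⟨ sumOver-valid L E ⟩
    fillingSum L E ∎

-- Rows of an inner shape and their exponents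

ordered-refl : ∀ d p → Ordered d p p
ordered-refl d ((i , j) , s) =
    (λ (_ , _ , j<j) → contradiction j<j (ℕ.<-irrefl ≡.refl))
  , (λ (_ , _ , i<i) → contradiction i<i (ℕ.<-irrefl ≡.refl))
  , (λ (_ , _ , i<i) → contradiction i<i (ℕ.<-irrefl ≡.refl))
  , (λ (_ , _ , j<j) → contradiction j<j (ℕ.<-irrefl ≡.refl))

update : (ℕ → ℕ) → ℕ → ℕ → ℕ → ℕ
update f r v i = if does (i ℕ.≟ r) then v else f i

module _ (f : ℕ → ℕ) (r : ℕ) {v : ℕ} where

  update-at : update f r v r ≡ v
  update-at rewrite dec-true (r ℕ.≟ r) ≡.refl = ≡.refl

  update-off : ∀ {i} → i ≢ r → update f r v i ≡ f i
  update-off {i} i≢r rewrite dec-false (i ℕ.≟ r) i≢r = ≡.refl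

  update-≤ : v ≤ f r → ∀ i → update f r v i ≤ f i
  update-≤ v≤ i with i ℕ.≟ r
  ... | yes ≡.refl = ℕ.≤-trans (ℕ.≤-reflexive update-at) v≤
  ... | no i≢r     = ℕ.≤-reflexive (update-off i≢r)

  update-≥ : f r ≤ v → ∀ i → f i ≤ update f r v i
  update-≥ ≤v i with i ℕ.≟ r
  ... | yes ≡.refl = ℕ.≤-trans ≤v (ℕ.≤-reflexive (≡.sym update-at))
  ... | no i≢r     = ℕ.≤-reflexive (≡.sym (update-off i≢r))

-- A lower step moves one unit from `k` to `m`, so `lower-m+k` and `lower-gap`, which only see their
-- sum, carry over unchanged.
update-exchange : ∀ {m k : ℕ → ℕ} {r K} → k r ≡ suc K → ∀ i →
                  update m r (suc (m r)) i ℕ.+ update k r K i ≡ m i ℕ.+ k i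
update-exchange {m} {k} {r} {K} kr≡ i with i ℕ.≟ r
... | yes ≡.refl = ≡.trans (≡.cong₂ ℕ._+_ (update-at m r) (update-at k r))
                    (≡.trans (≡.sym (ℕ.+-suc (m r) K)) (≡.cong (m r ℕ.+_) (≡.sym kr≡)))
... | no i≢r     = ≡.cong₂ ℕ._+_ (update-off m r i≢r) (update-off k r i≢r)

antitone : ∀ {f : ℕ → ℕ} {lo hi} → (∀ {i} → lo ≤ i → i < hi → f (suc i) ≤ f i) →
           ∀ {i j} → lo ≤ i → i ≤ j → j ≤ hi → f j ≤ f i
antitone {f} step {i} {j} lo≤i i≤j j≤hi with ℕ.≤⇒≤′ i≤j
... | ℕ.≤′-refl         = ℕ.≤-refl
... | ℕ.≤′-step {j′} i≤′j′ = ℕ.≤-trans (step (ℕ.≤-trans lo≤i i≤j′) j≤hi) (antitone step lo≤i i≤j′ (ℕ.<⇒≤ j≤hi))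
  where i≤j′ = ℕ.≤′⇒≤ i≤′j′

monotone : ∀ {f : ℕ → ℕ} {lo hi} → (∀ {i} → lo ≤ i → i < hi → f i ≤ f (suc i)) →
           ∀ {i j} → lo ≤ i → i ≤ j → j ≤ hi → f i ≤ f j
monotone {f} step {i} {j} lo≤i i≤j j≤hi with ℕ.≤⇒≤′ i≤j
... | ℕ.≤′-refl         = ℕ.≤-refl
... | ℕ.≤′-step {j′} i≤′j′ = ℕ.≤-trans (monotone step lo≤i i≤j′ (ℕ.<⇒≤ j≤hi)) (step (ℕ.≤-trans lo≤i i≤j′) j≤hi)
  where i≤j′ = ℕ.≤′⇒≤ i≤′j′

last-satisfying : ∀ {P : ℕ → Set} → (∀ i → Dec (P i)) → ∀ {lo hi} → lo ≤ hi → P lo →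
                  ∃ λ r → lo ≤ r × r ≤ hi × P r × (∀ {i} → r < i → i ≤ hi → ¬ P i)
last-satisfying P? {lo} {hi} lo≤hi Plo with P? hi
... | yes Phi = hi , lo≤hi , ℕ.≤-refl , Phi , λ hi<i i≤hi → contradiction i≤hi (ℕ.<⇒≱ hi<i)
... | no ¬Phi with ℕ.≤⇒≤′ lo≤hi
... | ℕ.≤′-refl = contradiction Plo ¬Phi
... | ℕ.≤′-step {hi′} lo≤′hi′ with r , lo≤r , r≤hi′ , Pr , none ← last-satisfying P? (ℕ.≤′⇒≤ lo≤′hi′) Plo =
  r , lo≤r , ℕ.m≤n⇒m≤1+n r≤hi′ , Pr , λ {i} r<i i≤hi → beyond r<i (ℕ.m≤n⇒m<n∨m≡n i≤hi)
  where
  beyond : ∀ {i} → r < i → i < suc hi′ ⊎ i ≡ suc hi′ → ¬ _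
  beyond r<i (inj₁ (s≤s i≤hi′)) = none r<i i≤hi′
  beyond r<i (inj₂ ≡.refl)      = ¬Phi

find-failure : ∀ {P : ℕ → Set} → (∀ i → Dec (P i)) → ∀ n →
               (∀ {i} → 0 < i → i ≤ n → P i) ⊎ ∃ λ i → 0 < i × i ≤ n × ¬ P i
find-failure P? zero = inj₁ λ 0<i i≤0 → contradiction i≤0 (ℕ.<⇒≱ 0<i)
find-failure {P} P? (suc n) with find-failure P? n | P? (suc n)
... | inj₂ (i , 0<i , i≤n , ¬Pi) | _       = inj₂ (i , 0<i , ℕ.m≤n⇒m≤1+n i≤n , ¬Pi)
... | inj₁ _                     | no ¬Pn  = inj₂ (suc n , s≤s z≤n , ℕ.≤-refl , ¬Pn)
... | inj₁ Ps                    | yes Pn  = inj₁ λ 0<i i≤ → go 0<i (ℕ.m≤n⇒m<n∨m≡n i≤)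
  where
  go : ∀ {i} → 0 < i → i < suc n ⊎ i ≡ suc n → P i
  go 0<i (inj₁ (s≤s i≤n)) = Ps 0<i i≤n
  go _   (inj₂ ≡.refl)    = Pn

sumBelow : ℕ → (ℕ → ℕ) → ℕ
sumBelow zero    f = 0
sumBelow (suc n) f = f n ℕ.+ sumBelow n f

sumBelow-≤ : ∀ n {f g : ℕ → ℕ} → (∀ i → f i ≤ g i) → sumBelow n f ≤ sumBelow n g
sumBelow-≤ zero    f≤g = z≤n
sumBelow-≤ (suc n) f≤g = ℕ.+-mono-≤ (f≤g n) (sumBelow-≤ n f≤g)

sumBelow-< : ∀ {n} {f g : ℕ → ℕ} {r} → r < n → (∀ i → f i ≤ g i) → f r < g r → sumBelow n f < sumBelow n g
sumBelow-< {suc n} {r = r} r≤n f≤g fr<gr with ℕ.m≤n⇒m<n∨m≡n r≤n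
... | inj₂ ≡.refl    = ℕ.+-mono-<-≤ fr<gr (sumBelow-≤ n f≤g)
... | inj₁ (s≤s r<n) = ℕ.+-mono-≤-< (f≤g n) (sumBelow-< r<n f≤g fr<gr)

strictlyDecreasing-tabulate : ∀ {n} {g : ℕ → ℕ} {u} → (∀ {i} → suc i < n → g (suc i) < g i) → g 0 < u →
                              StrictlyDecreasing u (Vec.tabulate {n = n} (g ∘ toℕ))
strictlyDecreasing-tabulate {zero}        dec g0<u = []
strictlyDecreasing-tabulate {suc zero}    dec g0<u = g0<u ∷ []
strictlyDecreasing-tabulate {suc (suc n)} dec g0<u =
  g0<u ∷ strictlyDecreasing-tabulate (λ i<n → dec (s≤s i<n)) (dec (s≤s (s≤s z≤n)))

toList-map-tabulate : ∀ {A B : Set} n (f : A → B) (g : ℕ → A) →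
                      toList (Vec.map f (Vec.tabulate {n = n} (g ∘ toℕ))) ≡ applyUpTo (f ∘ g) n
toList-map-tabulate zero    f g = ≡.refl
toList-map-tabulate (suc n) f g = ≡.cong (f (g 0) ∷_) (toList-map-tabulate n f (g ∘ suc))

pointwise-applyUpTo : ∀ n {f g : ℕ → R⟦x⟧} → (∀ {i} → i < n → f i ≈₁ g i) → Pointwise _≈₁_ (applyUpTo f n) (applyUpTo g n)
pointwise-applyUpTo zero    f≈g = []
pointwise-applyUpTo (suc n) f≈g = f≈g (s≤s z≤n) ∷ pointwise-applyUpTo n (λ i<n → f≈g (s≤s i<n))

exponents : ∀ n → (ℕ → ℕ) → Vec ℕ n
exponents n p = Vec.tabulate λ i → p (suc (toℕ i)) ℕ.+ (n ∸ suc (toℕ i))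

exponents-decreasing : ∀ n {p} → (∀ {i} → 0 < i → i < n → p (suc i) ≤ p i) →
                       StrictlyDecreasing (suc (p 1 ℕ.+ n)) (exponents n p)
exponents-decreasing n {p} p↓ = strictlyDecreasing-tabulate {g = λ i → p (suc i) ℕ.+ (n ∸ suc i)}
  (λ {i} i+1<n → ℕ.+-mono-≤-< (p↓ (s≤s z≤n) i+1<n) (ℕ.∸-monoʳ-< ℕ.≤-refl i+1<n))
  (s≤s (ℕ.+-monoʳ-≤ (p 1) (ℕ.m∸n≤m n 1)))

exponents-injective : ∀ n {p q} → exponents n p ≡ exponents n q → ∀ {i} → 0 < i → i ≤ n → p i ≡ q i
exponents-injective n {p} {q} eq {suc i} _ i<n = ℕ.+-cancelʳ-≡ (n ∸ suc i) (p (suc i)) (q (suc i)) (begin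
  p (suc i) ℕ.+ (n ∸ suc i)                                  ≡⟨ at p ⟨
  Vec.lookup (exponents n p) (Fin.fromℕ< i<n)      ≡⟨ ≡.cong (λ v → Vec.lookup v (Fin.fromℕ< i<n)) eq ⟩
  Vec.lookup (exponents n q) (Fin.fromℕ< i<n)      ≡⟨ at q ⟩
  q (suc i) ℕ.+ (n ∸ suc i)                                  ∎)
  where
  open ≡.≡-Reasoning
  at : ∀ p → Vec.lookup (exponents n p) (Fin.fromℕ< i<n) ≡ p (suc i) ℕ.+ (n ∸ suc i)
  at p = ≡.trans (Vec.lookup∘tabulate _ (Fin.fromℕ< i<n))
                 (≡.cong (λ j → p (suc j) ℕ.+ (n ∸ suc j)) (Fin.toℕ-fromℕ< i<n))

exponents-cong : ∀ n {p q} → (∀ {i} → 0 < i → i ≤ n → p i ≡ q i) → exponents n p ≡ exponents n q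
exponents-cong n p≡q = Vec.tabulate-cong λ i → ≡.cong (ℕ._+ (n ∸ suc (toℕ i))) (p≡q (s≤s z≤n) (Fin.toℕ<n i))

-- Evaluation of the dual alternant

concatMap-applyUpTo-cong : ∀ {A : Set} {g h : ℕ → List A} {f : ℕ → ℕ} n → (∀ i → g (f i) ≡ h (f i)) →
                           concatMap g (applyUpTo f n) ≡ concatMap h (applyUpTo f n)
concatMap-applyUpTo-cong zero    g≡h = ≡.refl
concatMap-applyUpTo-cong (suc n) g≡h = ≡.cong₂ _++_ (g≡h 0) (concatMap-applyUpTo-cong n (g≡h ∘ suc))

concatMap-applyUpTo-split : ∀ {A : Set} {g h : ℕ → List A} {f : ℕ → ℕ} {n r x} → r < n → g (f r) ≡ x ∷ h (f r) →
  (∀ {i} → i ≢ r → g (f i) ≡ h (f i)) →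
  ∃ λ ys → ∃ λ zs → concatMap g (applyUpTo f n) ≡ ys ++ x ∷ zs × concatMap h (applyUpTo f n) ≡ ys ++ zs
concatMap-applyUpTo-split {h = h} {f} {suc n} {zero} {x} _ gr≡ g≡h =
  [] , concatMap h (applyUpTo f (suc n)) ,
  ≡.cong₂ _++_ gr≡ (concatMap-applyUpTo-cong n λ i → g≡h λ ()) , ≡.refl
concatMap-applyUpTo-split {g = g} {h} {f} {suc n} {suc r} {x} (s≤s r<n) gr≡ g≡h
  with ys , zs , eq₁ , eq₂ ← concatMap-applyUpTo-split {g = g} {h} {f ∘ suc} r<n gr≡ (λ i≢r → g≡h (i≢r ∘ ℕ.suc-injective)) =
  h (f 0) ++ ys , zs ,
  ≡.trans (≡.cong₂ _++_ (g≡h {0} λ ()) eq₁) (≡.sym (++-assoc (h (f 0)) ys (x ∷ zs))) ,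
  ≡.trans (≡.cong (h (f 0) ++_) eq₂) (≡.sym (++-assoc (h (f 0)) ys zs))

length-filter-accept : ∀ {A : Set} {P : Pred A 0ℓ} (P? : Decidable P) xs {x ys} → P x →
                       length (filter P? (xs ++ x ∷ ys)) ≡ suc (length (filter P? (xs ++ ys)))
length-filter-accept P? []        Px = ≡.cong length (filter-accept P? Px)
length-filter-accept P? (x′ ∷ xs) Px with P? x′
... | yes _ = ≡.cong suc (length-filter-accept P? xs Px)
... | no _  = length-filter-accept P? xs Px

length-filter-reject : ∀ {A : Set} {P : Pred A 0ℓ} (P? : Decidable P) xs {x ys} → ¬ P x →
                       length (filter P? (xs ++ x ∷ ys)) ≡ length (filter P? (xs ++ ys))
length-filter-reject P? []        ¬Px = ≡.cong length (filter-reject P? ¬Px)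
length-filter-reject P? (x′ ∷ xs) ¬Px with P? x′
... | yes _ = ≡.cong suc (length-filter-reject P? xs ¬Px)
... | no _  = length-filter-reject P? xs ¬Px

upperVariable lowerVariable : ℕ → ℚ[a]
upperVariable κ = a (ℤ.- (+ κ))
lowerVariable κ = a (+ suc κ)

-- The outer shape ν has ℓ rows.  A state (m , k) consists of an inner shape m
-- and of the number k i of values available to the entries in row i.
module HookDeterminant (n d ℓ : ℕ) (ν : ℕ → ℕ) (d≤n : d ≤ n) (ℓ≤n : ℓ ≤ n)
  (ν-beyond : ∀ {i} → ℓ < i → ν i ≡ 0) (ν↓ : ∀ {i} → 0 < i → ν (suc i) ≤ ν i) where

  open FillingSum (ordered? d) (ordered-refl d)
  open Relation.Binary.Reasoning.Setoid R.setoid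

  column : (m k : ℕ → ℕ) → ℕ → R⟦x⟧
  column m k i = shift (m (suc i) ℕ.+ (n ∸ suc i))
    (if does (suc i ℕ.≤? d) then complete upperVariable (k (suc i)) else signedElementary lowerVariable (k (suc i)))

  determinant : (m k : ℕ → ℕ) → ℚ[a]
  determinant m k = alternant (exponents n ν) (applyUpTo (column m k) n)

  rowEntries : (ℕ → ℕ) → Box → List ℤ
  rowEntries k (i , _) =
    if does (i ℕ.≤? d) then applyUpTo (λ κ → ℤ.- (+ κ)) (k i) else applyUpTo (λ κ → + suc κ) (k i)

  rowBoxes : (ℕ → ℕ) → ℕ → List Box
  rowBoxes m i = applyUpTo (λ κ → i , m i ℕ.+ suc κ) (ν i ∸ m i)

  skewBoxes : (ℕ → ℕ) → List Box
  skewBoxes m = concatMap (rowBoxes m) (applyUpTo suc ℓ)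

  lowerCount : (ℕ → ℕ) → ℕ
  lowerCount m = length (filter (λ b → d ℕ.<? proj₁ b) (skewBoxes m))

  tableauSum : (m k : ℕ → ℕ) → ℚ[a]
  tableauSum m k = fillingSum (skewBoxes m) (rowEntries k)

  -- `upper-m` keeps the upper boxes of ν/m to the right of column `d`. Lower rows start with
  -- `m i + k i + 1 = i`, which weakens to two inequalities. `lower-m+k` makes row `d + 1` too short
  -- to be blocked by row `d` while it has values left, and bounds it by `d` at the end. `lower-gap`
  -- forces a blocked row and the row above it to have matching flags, so that their columns really
  -- coincide.
  record Invariant (m k : ℕ → ℕ) : Set where
    field
      m↓        : ∀ {i} → 0 < i → i < n → m (suc i) ≤ m i
      upper-m   : ∀ {i} → 0 < i → i ≤ d → d ≤ m i
      upper-k↓  : ∀ {i} → 0 < i → i < d → k (suc i) ≤ k i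
      lower-m+k : ∀ {i} → d < i → i ≤ n → m i ℕ.+ k i < i
      lower-k↑  : ∀ {i} → d < i → i < n → k i ≤ k (suc i)
      lower-gap : ∀ {i} → d < i → i < n → m (suc i) ℕ.+ k (suc i) ≤ suc (m i ℕ.+ k i)

  -- For an inner shape m with `d` diagonal boxes, `Good` says that m is contained in `ν` and that
  -- `ν` has no further diagonal box. `Bad` spells out the opposite as a usable witness: a row in
  -- which m sticks out, or a box of `ν` at position (d + 1, d + 1).
  Good Bad : (ℕ → ℕ) → Set
  Good m = (∀ {i} → 0 < i → i ≤ n → m i ≤ ν i) × (∀ {i} → d < i → i ≤ n → ν i ≤ d)
  Bad m  = (∃ λ i → 0 < i × i ≤ n × ν i < m i) ⊎ (suc d ≤ n × d < ν (suc d))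

  -- The two halves depend on each other: lengthening a row that already fills its row of `ν` leads
  -- from a good shape to a bad one.
  Claim : (m k : ℕ → ℕ) → Set
  Claim m k = (Good m → determinant m k ≋ (- 1#) ^ lowerCount m * tableauSum m k)
            × (Bad m → determinant m k ≋ 0#)

  ν-antitone : ∀ {i j} → 0 < i → i ≤ j → ν j ≤ ν i
  ν-antitone 0<i i≤j = antitone {hi = _} (λ 0<i _ → ν↓ 0<i) 0<i i≤j ℕ.≤-refl

  column-upper : ∀ m k {i s t} → suc i ≤ d → m (suc i) ≡ s → k (suc i) ≡ t →
                 column m k i ≡ shift (s ℕ.+ (n ∸ suc i)) (complete upperVariable t)
  column-upper m k {i} i<d ≡.refl ≡.refl rewrite dec-true (suc i ℕ.≤? d) i<d = ≡.refl

  column-lower : ∀ m k {i s t} → d ≤ i → m (suc i) ≡ s → k (suc i) ≡ t →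
                 column m k i ≡ shift (s ℕ.+ (n ∸ suc i)) (signedElementary lowerVariable t)
  column-lower m k {i} d≤i ≡.refl ≡.refl rewrite dec-false (suc i ℕ.≤? d) (ℕ.<⇒≱ (s≤s d≤i)) = ≡.refl

  column-cong : ∀ {m k m′ k′} {i} → m (suc i) ≡ m′ (suc i) → k (suc i) ≡ k′ (suc i) → column m k i ≡ column m′ k′ i
  column-cong m≡ k≡ rewrite m≡ | k≡ = ≡.refl

  rowEntries-upper : ∀ k {i j t} → i ≤ d → k i ≡ t → rowEntries k (i , j) ≡ applyUpTo (λ κ → ℤ.- (+ κ)) t
  rowEntries-upper k {i} i≤d ≡.refl rewrite dec-true (i ℕ.≤? d) i≤d = ≡.refl

  rowEntries-lower : ∀ k {i j t} → d < i → k i ≡ t → rowEntries k (i , j) ≡ applyUpTo (λ κ → + suc κ) t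
  rowEntries-lower k {i} d<i ≡.refl rewrite dec-false (i ℕ.≤? d) (ℕ.<⇒≱ d<i) = ≡.refl

  rowEntries-cong : ∀ {k k′ i j} → k i ≡ k′ i → rowEntries k (i , j) ≡ rowEntries k′ (i , j)
  rowEntries-cong k≡ rewrite k≡ = ≡.refl

  ∈-rowEntries-upper : ∀ k {i j t} → i ≤ d → t ∈ rowEntries k (i , j) → ∃ λ κ → κ < k i × t ≡ ℤ.- (+ κ)
  ∈-rowEntries-upper k {j = j} i≤d t∈ =
    ∈-applyUpTo⁻ (λ κ → ℤ.- (+ κ)) (≡.subst (_ ∈_) (rowEntries-upper k {j = j} i≤d ≡.refl) t∈)

  ∈-rowEntries-lower : ∀ k {i j t} → d < i → t ∈ rowEntries k (i , j) → ∃ λ κ → κ < k i × t ≡ + suc κ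
  ∈-rowEntries-lower k {j = j} d<i t∈ =
    ∈-applyUpTo⁻ (λ κ → + suc κ) (≡.subst (_ ∈_) (rowEntries-lower k {j = j} d<i ≡.refl) t∈)

  ∈-skewBoxes⁻ : ∀ m {i j} → (i , j) ∈ skewBoxes m → 0 < i × i ≤ ℓ × m i < j × j ≤ ν i
  ∈-skewBoxes⁻ m ij∈
    with _ , i∈ , ij∈row ← find (∈-concatMap⁻ (rowBoxes m) {xs = applyUpTo suc ℓ} ij∈)
    with i , i<ℓ , ≡.refl ← ∈-applyUpTo⁻ suc i∈
    with κ , κ< , ≡.refl ← ∈-applyUpTo⁻ (λ κ → suc i , m (suc i) ℕ.+ suc κ) ij∈row =
    s≤s z≤n , i<ℓ , ℕ.m<m+n (m (suc i)) (s≤s z≤n) ,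
    ℕ.≤-trans (ℕ.+-monoʳ-≤ (m (suc i)) κ<) (ℕ.≤-reflexive (ℕ.m+[n∸m]≡n (ℕ.<⇒≤ (ℕ.m∸n≢0⇒n<m {m = ν (suc i)} {n = m (suc i)} (ℕ.>⇒≢ (ℕ.≤-<-trans z≤n κ<))))))

  ∈-skewBoxes⁺ : ∀ m {i j} → 0 < i → m i < j → j ≤ ν i → (i , j) ∈ skewBoxes m
  ∈-skewBoxes⁺ m {suc i} {j} _ m<j j≤ν with ℓ ℕ.<? suc i
  ... | yes ℓ<i = contradiction (≡.subst (j ≤_) (ν-beyond ℓ<i) j≤ν) (ℕ.<⇒≱ (ℕ.≤-<-trans z≤n m<j))
  ... | no ℓ≮i  = ∈-concatMap⁺ (rowBoxes m) (lose (∈-applyUpTo⁺ suc (ℕ.≮⇒≥ ℓ≮i))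
    (≡.subst (λ j → (suc i , j) ∈ rowBoxes m (suc i)) m+κ≡j
      (∈-applyUpTo⁺ (λ κ → suc i , m (suc i) ℕ.+ suc κ) (ℕ.≤-trans (ℕ.≤-reflexive (≡.sym sκ≡)) (ℕ.∸-monoˡ-≤ (m (suc i)) j≤ν)))))
    where
    κ = j ∸ suc (m (suc i))
    sκ≡ : j ∸ m (suc i) ≡ suc κ
    sκ≡ = ℕ.+-∸-assoc 1 m<j
    m+κ≡j : m (suc i) ℕ.+ suc κ ≡ j
    m+κ≡j = ≡.trans (≡.cong (m (suc i) ℕ.+_) (≡.sym sκ≡)) (ℕ.m+[n∸m]≡n (ℕ.<⇒≤ m<j))

  skewBoxes-split : ∀ m {r} → 0 < r → m r < ν r → ∃ λ L₁ → ∃ λ L₂ →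
    skewBoxes m ≡ L₁ ++ (r , suc (m r)) ∷ L₂ × skewBoxes (update m r (suc (m r))) ≡ L₁ ++ L₂
  skewBoxes-split m {suc r} 0<r m<ν = concatMap-applyUpTo-split r<ℓ first others
    where
    m′ = update m (suc r) (suc (m (suc r)))

    r<ℓ : r < ℓ
    r<ℓ = let _ , r<ℓ , _ = ∈-skewBoxes⁻ m (∈-skewBoxes⁺ m {suc r} 0<r ℕ.≤-refl m<ν) in r<ℓ

    first : rowBoxes m (suc r) ≡ (suc r , suc (m (suc r))) ∷ rowBoxes m′ (suc r)
    first = ≡.trans (≡.cong (applyUpTo (λ κ → suc r , m (suc r) ℕ.+ suc κ)) (ℕ.+-∸-assoc 1 m<ν))
      (≡.cong₂ _∷_ (≡.cong (suc r ,_) (ℕ.+-comm (m (suc r)) 1))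
        (≡.trans (applyUpTo-cong (λ κ → ≡.cong (suc r ,_) (ℕ.+-suc (m (suc r)) (suc κ))) (ν (suc r) ∸ suc (m (suc r))))
          (≡.cong (λ p → applyUpTo (λ κ → suc r , p ℕ.+ suc κ) (ν (suc r) ∸ p)) (≡.sym (update-at m (suc r))))))

    others : ∀ {i} → i ≢ r → rowBoxes m (suc i) ≡ rowBoxes m′ (suc i)
    others {i} i≢r = ≡.cong (λ p → applyUpTo (λ κ → suc i , p ℕ.+ suc κ) (ν (suc i) ∸ p))
      (≡.sym (update-off m (suc r) (i≢r ∘ ℕ.suc-injective)))

  lowerCount-upper : ∀ m {r} → 0 < r → m r < ν r → r ≤ d → lowerCount m ≡ lowerCount (update m r (suc (m r)))
  lowerCount-upper m {r} 0<r m<ν r≤d with L₁ , L₂ , eq₁ , eq₂ ← skewBoxes-split m 0<r m<ν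
    rewrite eq₁ | eq₂ = length-filter-reject (λ b → d ℕ.<? proj₁ b) L₁ (ℕ.≤⇒≯ r≤d)

  lowerCount-lower : ∀ m {r} → 0 < r → m r < ν r → d < r → lowerCount m ≡ suc (lowerCount (update m r (suc (m r))))
  lowerCount-lower m {r} 0<r m<ν d<r with L₁ , L₂ , eq₁ , eq₂ ← skewBoxes-split m 0<r m<ν
    rewrite eq₁ | eq₂ = length-filter-accept (λ b → d ℕ.<? proj₁ b) L₁ d<r

  module _ {m k : ℕ → ℕ} {r K : ℕ} (0<r : 0 < r) (m<ν : m r < ν r) where
    private
      m′ = update m r (suc (m r))
      k′ = update k r K
      b : Box
      b = r , suc (m r)

    tableauSum-peel : ∀ v → (∀ j → rowEntries k (r , j) ≡ rowEntries k′ (r , j) ++ [ v ]) →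
      (∀ {t j} → t ∈ rowEntries k′ b → suc (m r) < j → j ≤ ν r → ¬ Compatible (b , t) ((r , j) , v)) →
      tableauSum m k ≋ tableauSum m k′ + a v * fillingSum (skewBoxes m′) (restrict (b , v) (rowEntries k))
    tableauSum-peel v last incompatible with L₁ , L₂ , eq₁ , eq₂ ← skewBoxes-split m 0<r m<ν
      rewrite eq₁ | eq₂ = begin
        fillingSum (L₁ ++ b ∷ L₂) (rowEntries k)
          ≈⟨ fillingSum-front L₁ b L₂ (rowEntries k) ⟩
        fillingSum (b ∷ L₁ ++ L₂) (rowEntries k)
          ≈⟨ fillingSum-peel b (L₁ ++ L₂) v (last (suc (m r))) (λ {b′} b′∈ → other b′ (≡.subst (b′ ∈_) (≡.sym eq₂) b′∈)) ⟩
        fillingSum (b ∷ L₁ ++ L₂) (rowEntries k′) + a v * fillingSum (L₁ ++ L₂) (restrict (b , v) (rowEntries k))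
          ≈⟨ R.+-congʳ (fillingSum-front L₁ b L₂ (rowEntries k′)) ⟨
        fillingSum (L₁ ++ b ∷ L₂) (rowEntries k′) + a v * fillingSum (L₁ ++ L₂) (restrict (b , v) (rowEntries k)) ∎
      where
      other : ∀ b′ → b′ ∈ skewBoxes m′ → rowEntries k b′ ≡ rowEntries k′ b′ ⊎
        ∃ λ v′ → rowEntries k b′ ≡ rowEntries k′ b′ ++ [ v′ ] × (∀ {t} → t ∈ rowEntries k′ b → ¬ Compatible (b , t) (b′ , v′))
      other (i , j) ij∈ with i ℕ.≟ r
      ... | no i≢r     = inj₁ (rowEntries-cong {k} {k′} {i} {j} (≡.sym (update-off k r i≢r)))
      ... | yes ≡.refl = inj₂ (v , last j , let _ , _ , m′<j , j≤ν = ∈-skewBoxes⁻ m′ ij∈ in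
              λ t∈ → incompatible t∈ (≡.subst (_< j) (update-at m r) m′<j) j≤ν)

  sign : (ℕ → ℕ) → ℚ[a]
  sign m = (- 1#) ^ lowerCount m

  good-update : ∀ {m r} → Good m → m r < ν r → Good (update m r (suc (m r)))
  good-update {m} {r} (m≤ν , ν≤d) m<ν = (λ {i} 0<i i≤n → go i 0<i i≤n) , ν≤d
    where
    go : ∀ i → 0 < i → i ≤ n → update m r (suc (m r)) i ≤ ν i
    go i 0<i i≤n with i ℕ.≟ r
    ... | yes ≡.refl = ≡.subst (_≤ ν r) (≡.sym (update-at m r)) m<ν
    ... | no i≢r     = ≡.subst (_≤ ν i) (≡.sym (update-off m r i≢r)) (m≤ν 0<i i≤n)

  bad-update : ∀ {m r} → Bad m → Bad (update m r (suc (m r)))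
  bad-update {m} {r} (inj₁ (i , 0<i , i≤n , ν<m)) =
    inj₁ (i , 0<i , i≤n , ℕ.<-≤-trans ν<m (update-≥ m r (ℕ.n≤1+n (m r)) i))
  bad-update (inj₂ bad) = inj₂ bad

  determinant-linear : ∀ {m k m₁ k₁ m₂ k₂ w r} → r < n →
    (∀ {i} → i ≢ r → column m k i ≡ column m₁ k₁ i) → (∀ {i} → i ≢ r → column m k i ≡ column m₂ k₂ i) →
    (∀ x → column m k r x ≋ column m₁ k₁ r x + w * column m₂ k₂ r x) →
    determinant m k ≋ determinant m₁ k₁ + w * determinant m₂ k₂
  determinant-linear {m} {k} {m₁} {k₁} {m₂} {k₂} r<n eq₁ eq₂ eq =
    alternant-linear (exponents n ν)
      (linear-applyUpTo {f = column m k} {column m₁ k₁} {column m₂ k₂} r<n eq₁ eq₂ eq)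

  -- The frame shared by both kinds of step. `D₂` is the determinant with a lengthened row, negated
  -- in a lower step, where the box removed from ν/m changes the sign; `y` is the sum over the
  -- tableaux with entry `v` in that box.
  step-claim : ∀ {m k r K v D₂} → 0 < r → r ≤ n →
    (let m′ = update m r (suc (m r)); k′ = update k r K) →
    determinant m k ≋ determinant m k′ + a v * D₂ →
    (Bad m′ → D₂ ≋ 0#) →
    (Good m → m r < ν r → ∃ λ y → D₂ ≋ sign m * y × tableauSum m k ≋ tableauSum m k′ + a v * y) →
    Claim m k′ → Claim m k
  step-claim {m} {k} {r} {K} {v} {D₂} 0<r r≤n lin bad₂ good₂ (good₁ , bad₁) = good , bad
    where
    m′ = update m r (suc (m r))
    k′ = update k r K

    extract : ∀ {y} → determinant m k′ ≋ sign m * tableauSum m k′ → D₂ ≋ sign m * y →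
              tableauSum m k ≋ tableauSum m k′ + a v * y → determinant m k ≋ sign m * tableauSum m k
    extract {y} D₁≋ D₂≋ Z≋ = begin
      determinant m k                                      ≈⟨ lin ⟩
      determinant m k′ + a v * D₂                          ≈⟨ ⊕-cong D₁≋ (≋-trans (⊗-cong ≋-refl D₂≋) (*-swap _ _ _)) ⟩
      sign m * tableauSum m k′ + sign m * (a v * y)        ≈⟨ ⊗-distribˡ _ _ _ ⟨
      sign m * (tableauSum m k′ + a v * y)                 ≈⟨ ⊗-cong ≋-refl Z≋ ⟨
      sign m * tableauSum m k                              ∎

    good : Good m → determinant m k ≋ sign m * tableauSum m k
    good g with m r ℕ.<? ν r
    ... | yes m<ν = let y , D₂≋ , Z≋ = good₂ g m<ν in extract (good₁ g) D₂≋ Z≋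
    -- Row `r` of ν/m is empty: lengthening it leaves `ν`, so `D₂` vanishes, and no box consults the
    -- flag that was lowered.
    ... | no m≮ν  = extract {0#} (good₁ g)
      (≋-trans (bad₂ (inj₁ (r , 0<r , r≤n , ≡.subst (ν r <_) (≡.sym (update-at m r)) (s≤s (ℕ.≮⇒≥ m≮ν)))))
               (≋-sym (R.zeroʳ _)))
      (≋-trans (fillingSum-cong (skewBoxes m) λ {b} b∈ → same b b∈)
               (≋-sym (≋-trans (⊕-cong ≋-refl (R.zeroʳ _)) (R.+-identityʳ _))))
      where
      same : ∀ b → b ∈ skewBoxes m → rowEntries k b ≡ rowEntries k′ b
      same (i , j) ij∈ = rowEntries-cong {k} {k′} {i} {j} (≡.sym (update-off k r λ where
        ≡.refl → let _ , _ , m<j , j≤ν = ∈-skewBoxes⁻ m ij∈ in m≮ν (ℕ.<-≤-trans m<j j≤ν)))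

    bad : Bad m → determinant m k ≋ 0#
    bad b = ≋-trans lin (≋-trans
      (⊕-cong (bad₁ b) (≋-trans (⊗-cong ≋-refl (bad₂ (bad-update b))) (R.zeroʳ _))) (⊕-identityˡ 0#))

  -- Whether row `r` can be lengthened without destroying the decrease of `m`. If not, the preceding
  -- row has the same length, and its first box outside `m` lies directly above that of row `r`.
  Free : (ℕ → ℕ) → ℕ → Set
  Free m r = ∀ {i} → 0 < i → i < r → m r < m i

  Blocked : (ℕ → ℕ) → ℕ → Set
  Blocked m r = ∃ λ q → r ≡ suc q × 0 < q × m q ≡ m r

  free-or-blocked : ∀ {m k} → Invariant m k → ∀ {r} → 0 < r → r ≤ n → Free m r ⊎ Blocked m r
  free-or-blocked inv {suc zero}    _ _ = inj₁ λ 0<i i<1 → contradiction i<1 (ℕ.≤⇒≯ 0<i)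
  free-or-blocked {m} inv {suc (suc q)} _ r≤n with m (suc q) ℕ.≟ m (suc (suc q))
  ... | yes eq = inj₂ (suc q , ≡.refl , s≤s z≤n , eq)
  ... | no neq = inj₁ λ 0<i i<r → ℕ.<-≤-trans
    (ℕ.≤∧≢⇒< (Invariant.m↓ inv (s≤s z≤n) r≤n) (neq ∘ ≡.sym))
    (antitone {m} {1} {n} (Invariant.m↓ inv) 0<i (ℕ.≤-pred i<r) (ℕ.<⇒≤ r≤n))

  m↓-update : ∀ {m k r} → Invariant m k → Free m r → ∀ {i} → 0 < i → i < n →
              update m r (suc (m r)) (suc i) ≤ update m r (suc (m r)) i
  m↓-update {m} {r = r} inv free {i} 0<i i<n with suc i ℕ.≟ r
  ... | yes ≡.refl = ℕ.≤-trans (ℕ.≤-reflexive (update-at m (suc i)))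
                       (ℕ.≤-trans (free 0<i ℕ.≤-refl) (update-≥ m (suc i) (ℕ.n≤1+n _) i))
  ... | no i+1≢r   = ℕ.≤-trans (ℕ.≤-reflexive (update-off m r i+1≢r))
                       (ℕ.≤-trans (Invariant.m↓ inv 0<i i<n) (update-≥ m r (ℕ.n≤1+n _) i))

  -- Lengthening a row by one compensates for the drop of one in the staircase from row to row.
  -- Hence a lengthened blocked row has the same power of x in its column as the row above.
  exponent-suc : ∀ p {i} → suc i < n → p ℕ.+ (n ∸ suc i) ≡ suc p ℕ.+ (n ∸ suc (suc i))
  exponent-suc p {i} i+1<n = ≡.trans (≡.cong (p ℕ.+_) (ℕ.+-∸-assoc 1 i+1<n)) (ℕ.+-suc p (n ∸ suc (suc i)))

  determinant-repeated : ∀ {m k q} → suc q < n → column m k q ≡ column m k (suc q) → determinant m k ≋ 0#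
  determinant-repeated {m} {k} q<n eq = alternant-repeated (exponents n ν) (repeated-applyUpTo {f = column m k} q<n eq)

  -- Row suc r is the last upper row whose flag is maximal.  An entry -K in its
  -- first box restricts no other entry unless there is a box above it; then no
  -- tableau has this entry, and two columns of the determinant coincide.
  module UpperStep {m k : ℕ → ℕ} {r K : ℕ} (inv : Invariant m k) (r<d : r < d) (kr≡ : k (suc r) ≡ suc K)
    (above : ∀ {i} → 0 < i → i ≤ suc r → k i ≡ suc K) (below : ∀ {i} → suc r < i → i ≤ d → k i ≤ K) where
    open Invariant inv

    m′ = update m (suc r) (suc (m (suc r)))
    k′ = update k (suc r) K
    b : Box
    b = suc r , suc (m (suc r))
    v  = ℤ.- (+ K)

    r<n : r < n
    r<n = ℕ.<-≤-trans r<d d≤n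

    K≤k : K ≤ k (suc r)
    K≤k = ≡.subst (K ≤_) (≡.sym kr≡) (ℕ.n≤1+n K)

    below-row : ∀ {i} → d < i → i ≢ suc r
    below-row d<i ≡.refl = ℕ.≤⇒≯ r<d d<i

    invariant-k′ : Invariant m k′
    invariant-k′ = record
      { m↓        = m↓
      ; upper-m   = upper-m
      ; upper-k↓  = decreasing
      ; lower-m+k = λ {i} d<i i≤n → ≡.subst (λ t → m i ℕ.+ t < i) (≡.sym (update-off k (suc r) (below-row d<i))) (lower-m+k d<i i≤n)
      ; lower-k↑  = λ {i} d<i i<n → ≡.subst₂ _≤_ (≡.sym (off d<i)) (≡.sym (off (ℕ.m<n⇒m<1+n d<i))) (lower-k↑ d<i i<n)
      ; lower-gap = λ {i} d<i i<n → ≡.subst₂ (λ s t → m (suc i) ℕ.+ t ≤ suc (m i ℕ.+ s))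
                      (≡.sym (off d<i)) (≡.sym (off (ℕ.m<n⇒m<1+n d<i))) (lower-gap d<i i<n)
      }
      where
      off : ∀ {i} → d < i → k′ i ≡ k i
      off d<i = update-off k (suc r) (below-row d<i)

      decreasing : ∀ {i} → 0 < i → i < d → k′ (suc i) ≤ k′ i
      decreasing {i} 0<i i<d with i ℕ.≟ suc r
      ... | yes ≡.refl = ℕ.≤-trans (update-≤ k (suc r) K≤k (suc i))
                           (ℕ.≤-trans (below ℕ.≤-refl i<d) (ℕ.≤-reflexive (≡.sym (update-at k (suc r)))))
      ... | no i≢      = ℕ.≤-trans (update-≤ k (suc r) K≤k (suc i))
                           (ℕ.≤-trans (upper-k↓ 0<i i<d) (ℕ.≤-reflexive (≡.sym (update-off k (suc r) i≢))))

    invariant-m′ : Free m (suc r) → Invariant m′ k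
    invariant-m′ free = record
      { m↓        = m↓-update inv free
      ; upper-m   = λ {i} 0<i i≤d → ℕ.≤-trans (upper-m 0<i i≤d) (update-≥ m (suc r) (ℕ.n≤1+n _) i)
      ; upper-k↓  = upper-k↓
      ; lower-m+k = λ {i} d<i i≤n → ≡.subst (λ s → s ℕ.+ k i < i) (≡.sym (off d<i)) (lower-m+k d<i i≤n)
      ; lower-k↑  = lower-k↑
      ; lower-gap = λ {i} d<i i<n → ≡.subst₂ (λ s t → t ℕ.+ k (suc i) ≤ suc (s ℕ.+ k i))
                      (≡.sym (off d<i)) (≡.sym (off (ℕ.m<n⇒m<1+n d<i))) (lower-gap d<i i<n)
      }
      where
      off : ∀ {i} → d < i → m′ i ≡ m i
      off d<i = update-off m (suc r) (below-row d<i)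

    determinant-step : determinant m k ≋ determinant m k′ + a v * determinant m′ k
    determinant-step = determinant-linear {m} {k} {m} {k′} {m′} {k} r<n
      (λ {i} i≢r → column-cong {m} {k} {m} {k′} ≡.refl (≡.sym (update-off k (suc r) (i≢r ∘ ℕ.suc-injective))))
      (λ {i} i≢r → column-cong {m} {k} {m′} {k} (≡.sym (update-off m (suc r) (i≢r ∘ ℕ.suc-injective))) ≡.refl)
      (λ x → begin
        column m k r x
          ≡⟨ ≡.cong (λ f → f x) (column-upper m k r<d ≡.refl kr≡) ⟩
        shift (m (suc r) ℕ.+ (n ∸ suc r)) (complete upperVariable (suc K)) x
          ≈⟨ shift-complete upperVariable K (m (suc r) ℕ.+ (n ∸ suc r)) x ⟩
        shift (m (suc r) ℕ.+ (n ∸ suc r)) (complete upperVariable K) x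
          + a v * shift (suc (m (suc r)) ℕ.+ (n ∸ suc r)) (complete upperVariable (suc K)) x
          ≡⟨ ≡.cong₂ (λ f g → f x + a v * g x) (column-upper m k′ r<d ≡.refl (update-at k (suc r)))
               (column-upper m′ k r<d (update-at m (suc r)) kr≡) ⟨
        column m k′ r x + a v * column m′ k r x ∎)

    -- All rows up to `suc r` share the maximal flag, so the columns of the two rows agree in their
    -- series as well as in their power of x.
    determinant-blocked : Blocked m (suc r) → determinant m′ k ≋ 0#
    determinant-blocked (suc q , ≡.refl , 0<q , mq≡) = determinant-repeated {m′} {k} {q} r<n
      (≡.trans (column-upper m′ k (ℕ.<⇒≤ r<d) (≡.trans (update-off m (suc r) (ℕ.<⇒≢ ℕ.≤-refl)) mq≡) (above 0<q (ℕ.n≤1+n _)))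
        (≡.trans (≡.cong (λ s → shift s (complete upperVariable (suc K))) (exponent-suc (m (suc r)) r<n))
                 (≡.sym (column-upper m′ k r<d (update-at m (suc r)) kr≡))))

    entries-last : ∀ j → rowEntries k (suc r , j) ≡ rowEntries k′ (suc r , j) ++ [ v ]
    entries-last j = ≡.trans (rowEntries-upper k {j = j} r<d kr≡)
      (≡.trans (≡.sym (applyUpTo-∷ʳ (λ κ → ℤ.- (+ κ)) K))
               (≡.cong (_++ [ v ]) (≡.sym (rowEntries-upper k′ {j = j} r<d (update-at k (suc r))))))

    incompatible : ∀ {t j} → t ∈ rowEntries k′ b → suc (m (suc r)) < j → j ≤ ν (suc r) → ¬ Compatible (b , t) ((suc r , j) , v)
    incompatible t∈ c<j _ (ordered , _) with κ , κ<k′ , ≡.refl ← ∈-rowEntries-upper k′ {j = suc (m (suc r))} r<d t∈ =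
      ℕ.<⇒≱ (≡.subst (κ <_) (update-at k (suc r)) κ<k′)
            (ℤ.drop‿+≤+ (ℤ.neg-cancel-≤ (proj₁ ordered (r<d , ≡.refl , c<j))))

    -- The box `b` lies to the right of the first `d` columns. This makes the last two conditions of
    -- `Ordered` vacuous for pairs containing `b`.
    d<c : ¬ suc (m (suc r)) ≤ d
    d<c = ℕ.<⇒≱ (s≤s (upper-m (s≤s z≤n) r<d))

    compatible : Free m (suc r) → ∀ {i j t} → (i , j) ∈ skewBoxes m′ → t ∈ rowEntries k (i , j) → Compatible (b , v) ((i , j) , t)
    compatible free {i} {j} ij∈ t∈ with 0<i , _ , m′<j , _ ← ∈-skewBoxes⁻ m′ ij∈ =
      ( (λ where (_ , ≡.refl , _) → let κ , κ<k , t≡ = ∈-rowEntries-upper k {j = j} r<d t∈ in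
                   ≡.subst (v ℤ.≤_) (≡.sym t≡) (ℤ.neg-mono-≤ (ℤ.+≤+ (ℕ.≤-pred (≡.subst (κ <_) kr≡ κ<k)))))
      -- Flags below row `suc r` are at most `K`, so entries there exceed -K strictly. This is why
      -- the last row of maximal flag is peeled.
      , (λ (i≤d , _ , r<i) → let κ , κ<k , t≡ = ∈-rowEntries-upper k {j = j} i≤d t∈ in
                   ≡.subst (v ℤ.<_) (≡.sym t≡) (ℤ.neg-mono-< (ℤ.+<+ (ℕ.<-≤-trans κ<k (below r<i i≤d)))))
      , (λ (c≤d , _) → contradiction c≤d d<c)
      , (λ (j≤d , _ , c<j) → contradiction (ℕ.≤-trans (ℕ.<⇒≤ c<j) j≤d) d<c) )
      , ( (λ where (_ , ≡.refl , j<c) → contradiction (≡.subst (_< j) (update-at m (suc r)) m′<j) (ℕ.<⇒≯ j<c))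
        , (λ where (_ , ≡.refl , i<r) → contradiction (≡.subst (_< j) (update-off m (suc r) (ℕ.<⇒≢ i<r)) m′<j)
                                                      (ℕ.<⇒≱ (s≤s (free 0<i i<r))))
        , (λ where (j≤d , ≡.refl , _) → contradiction j≤d d<c)
        , (λ (c≤d , _) → contradiction c≤d d<c) )

    sum-free : Free m (suc r) → fillingSum (skewBoxes m′) (restrict (b , v) (rowEntries k)) ≋ tableauSum m′ k
    sum-free free = fillingSum-cong (skewBoxes m′) λ {b′} b′∈ →
      filter-all (λ t → compatible? (b , v) (b′ , t)) (All.tabulate (compatible free b′∈))

    sum-blocked : Blocked m (suc r) → m (suc r) < ν (suc r) →
                  fillingSum (skewBoxes m′) (restrict (b , v) (rowEntries k)) ≋ 0#
    sum-blocked (q , ≡.refl , 0<q , mq≡) m<ν = fillingSum-empty (skewBoxes m′) b′∈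
      (filter-none (λ t → compatible? (b , v) (b′ , t)) {xs = rowEntries k b′} (All.tabulate conflict))
      where
      b′ : Box
      b′ = q , suc (m (suc q))

      b′∈ : b′ ∈ skewBoxes m′
      b′∈ = ∈-skewBoxes⁺ m′ 0<q
        (s≤s (ℕ.≤-reflexive (≡.trans (update-off m (suc q) (ℕ.<⇒≢ ℕ.≤-refl)) mq≡)))
        (ℕ.≤-trans m<ν (ν↓ 0<q))

      conflict : ∀ {t} → t ∈ rowEntries k b′ → ¬ Compatible (b , v) (b′ , t)
      conflict t∈ (_ , _ , ordered , _) with κ , κ<k , ≡.refl ← ∈-rowEntries-upper k {j = suc (m (suc q))} (ℕ.<⇒≤ r<d) t∈ =
        ℕ.<⇒≱ (ℤ.drop‿+<+ (ℤ.neg-cancel-< (ordered (r<d , ≡.refl , ℕ.≤-refl))))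
              (ℕ.≤-pred (≡.subst (κ <_) (above 0<q (ℕ.n≤1+n q)) κ<k))

    claim : (Free m (suc r) → Claim m′ k) → Claim m k′ → Claim m k
    claim claim-m′ = step-claim {m} {k} {suc r} {K} {v} (s≤s z≤n) r<n determinant-step bad₂ good₂
      where
      bad₂ : Bad m′ → determinant m′ k ≋ 0#
      bad₂ bad with free-or-blocked inv (s≤s z≤n) r<n
      ... | inj₁ free    = proj₂ (claim-m′ free) bad
      ... | inj₂ blocked = determinant-blocked blocked

      good₂ : Good m → m (suc r) < ν (suc r) →
              ∃ λ y → determinant m′ k ≋ sign m * y × tableauSum m k ≋ tableauSum m k′ + a v * y
      good₂ good m<ν with free-or-blocked inv (s≤s z≤n) r<n
      ... | inj₁ free = tableauSum m′ k ,
        ≋-trans (proj₁ (claim-m′ free) (good-update good m<ν))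
          (R.reflexive (≡.cong (λ c → (- 1#) ^ c * tableauSum m′ k) (≡.sym (lowerCount-upper m (s≤s z≤n) m<ν r<d)))) ,
        ≋-trans (tableauSum-peel (s≤s z≤n) m<ν v entries-last incompatible) (⊕-cong ≋-refl (⊗-cong ≋-refl (sum-free free)))
      ... | inj₂ blocked = 0# ,
        ≋-trans (determinant-blocked blocked) (≋-sym (R.zeroʳ _)) ,
        ≋-trans (tableauSum-peel (s≤s z≤n) m<ν v entries-last incompatible) (⊕-cong ≋-refl (⊗-cong ≋-refl (sum-blocked blocked m<ν)))

  -- Row suc r is the first lower row whose flag is maximal.  An entry suc K in
  -- its first box only lowers the flag of this row, unless there is a box above
  -- it, in which case two columns coincide as before.
  module LowerStep {m k : ℕ → ℕ} {r K : ℕ} (inv : Invariant m k) (d≤r : d ≤ r) (r<n : r < n) (kr≡ : k (suc r) ≡ suc K)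
    (above : ∀ {i} → d < i → i ≤ r → k i ≤ K) (below : ∀ {i} → suc r < i → i ≤ n → k i ≤ suc K) where
    open Invariant inv

    m′ k′ : ℕ → ℕ
    m′ = update m (suc r) (suc (m (suc r)))
    k′ = update k (suc r) K

    b : Box
    b = suc r , suc (m (suc r))

    v : ℤ
    v = + suc K

    d<r+1 : d < suc r
    d<r+1 = s≤s d≤r

    K≤k : K ≤ k (suc r)
    K≤k = ≡.subst (K ≤_) (≡.sym kr≡) (ℕ.n≤1+n K)

    above-row : ∀ {i} → i ≤ d → i ≢ suc r
    above-row i≤d ≡.refl = ℕ.<⇒≱ d<r+1 i≤d

    k-off : ∀ {i} → i ≢ suc r → k i ≡ k′ i
    k-off i≢ = ≡.sym (update-off k (suc r) i≢)

    upper-k′↓ : ∀ {i} → 0 < i → i < d → k′ (suc i) ≤ k′ i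
    upper-k′↓ 0<i i<d = ≡.subst₂ _≤_ (k-off (above-row i<d)) (k-off (above-row (ℕ.<⇒≤ i<d))) (upper-k↓ 0<i i<d)

    lower-k′↑ : ∀ {i} → d < i → i < n → k′ i ≤ k′ (suc i)
    lower-k′↑ {i} d<i i<n with suc i ℕ.≟ suc r
    ... | yes ≡.refl = ℕ.≤-trans (ℕ.≤-reflexive (update-off k (suc r) (ℕ.<⇒≢ ℕ.≤-refl)))
                         (ℕ.≤-trans (above d<i ℕ.≤-refl) (ℕ.≤-reflexive (≡.sym (update-at k (suc r)))))
    ... | no i+1≢    = ℕ.≤-trans (update-≤ k (suc r) K≤k i)
                         (ℕ.≤-trans (lower-k↑ d<i i<n) (ℕ.≤-reflexive (k-off i+1≢)))

    invariant-k′ : Invariant m k′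
    invariant-k′ = record
      { m↓        = m↓
      ; upper-m   = upper-m
      ; upper-k↓  = upper-k′↓
      ; lower-m+k = λ {i} d<i i≤n → ℕ.≤-<-trans (ℕ.+-monoʳ-≤ (m i) (update-≤ k (suc r) K≤k i)) (lower-m+k d<i i≤n)
      ; lower-k↑  = lower-k′↑
      ; lower-gap = gap
      }
      where
      gap : ∀ {i} → d < i → i < n → m (suc i) ℕ.+ k′ (suc i) ≤ suc (m i ℕ.+ k′ i)
      gap {i} d<i i<n with i ℕ.≟ suc r
      ... | no i≢      = ℕ.≤-trans (ℕ.+-monoʳ-≤ (m (suc i)) (update-≤ k (suc r) K≤k (suc i)))
                           (ℕ.≤-trans (lower-gap d<i i<n) (ℕ.≤-reflexive (≡.cong (λ t → suc (m i ℕ.+ t)) (k-off i≢))))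
      -- The flag of row `i` has just dropped, so `lower-gap` itself is too weak here. The bound
      -- comes from the decrease of `m` and from the flag `suc K` being maximal among the rows
      -- below.
      ... | yes ≡.refl = ℕ.≤-trans
        (ℕ.+-mono-≤ (m↓ (s≤s z≤n) i<n) (ℕ.≤-trans (update-≤ k (suc r) K≤k (suc i)) (below ℕ.≤-refl i<n)))
        (ℕ.≤-reflexive (≡.trans (ℕ.+-suc (m i) K) (≡.cong (λ t → suc (m i ℕ.+ t)) (≡.sym (update-at k (suc r))))))

    invariant-m′ : Free m (suc r) → Invariant m′ k′
    invariant-m′ free = record
      { m↓        = m↓-update inv free
      ; upper-m   = λ {i} 0<i i≤d → ℕ.≤-trans (upper-m 0<i i≤d) (update-≥ m (suc r) (ℕ.n≤1+n _) i)
      ; upper-k↓  = upper-k′↓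
      ; lower-m+k = λ {i} d<i i≤n → ≡.subst (_< i) (≡.sym (update-exchange {m} {k} kr≡ i)) (lower-m+k d<i i≤n)
      ; lower-k↑  = lower-k′↑
      ; lower-gap = λ {i} d<i i<n → ≡.subst₂ (λ s t → s ≤ suc t) (≡.sym (update-exchange {m} {k} kr≡ (suc i)))
                      (≡.sym (update-exchange {m} {k} kr≡ i)) (lower-gap d<i i<n)
      }

    determinant-step : determinant m k ≋ determinant m k′ + a v * - determinant m′ k′
    determinant-step = ≋-trans
      (determinant-linear {m} {k} {m} {k′} {m′} {k′} r<n
        (λ {i} i≢r → column-cong {m} {k} {m} {k′} ≡.refl (k-off (i≢r ∘ ℕ.suc-injective)))
        (λ {i} i≢r → column-cong {m} {k} {m′} {k′} (≡.sym (update-off m (suc r) (i≢r ∘ ℕ.suc-injective))) (k-off (i≢r ∘ ℕ.suc-injective)))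
        (λ x → begin
          column m k r x
            ≡⟨ ≡.cong (λ f → f x) (column-lower m k d≤r ≡.refl kr≡) ⟩
          shift (m (suc r) ℕ.+ (n ∸ suc r)) (signedElementary lowerVariable (suc K)) x
            ≈⟨ shift-signedElementary lowerVariable K (m (suc r) ℕ.+ (n ∸ suc r)) x ⟩
          shift (m (suc r) ℕ.+ (n ∸ suc r)) (signedElementary lowerVariable K) x
            + - a v * shift (suc (m (suc r)) ℕ.+ (n ∸ suc r)) (signedElementary lowerVariable K) x
            ≡⟨ ≡.cong₂ (λ f g → f x + - a v * g x) (column-lower m k′ d≤r ≡.refl (update-at k (suc r)))
                 (column-lower m′ k′ d≤r (update-at m (suc r)) (update-at k (suc r))) ⟨
          column m k′ r x + - a v * column m′ k′ r x ∎))
      (⊕-cong ≋-refl (≋-trans (≋-sym (-‿distribˡ-* (a v) (determinant m′ k′))) (-‿distribʳ-* (a v) (determinant m′ k′))))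

    -- The row above must itself be a lower row. For `r = d` it is an upper row of length at least
    -- `d`, whereas `lower-m+k` together with the positive flag makes row `d + 1` shorter than `d`.
    Blocked′ : Set
    Blocked′ = d < r × m r ≡ m (suc r)

    free-or-blocked′ : Free m (suc r) ⊎ Blocked′
    free-or-blocked′ with ℕ.m≤n⇒m<n∨m≡n d≤r
    ... | inj₂ ≡.refl = inj₁ λ 0<i i<r → ℕ.<-≤-trans mr<d (upper-m 0<i (ℕ.≤-pred i<r))
      where
      mr<d : m (suc r) < d
      mr<d = ℕ.≤-pred (ℕ.≤-trans (s≤s (ℕ.≤-trans (s≤s (ℕ.m≤m+n (m (suc r)) K))
               (ℕ.≤-reflexive (≡.trans (≡.sym (ℕ.+-suc _ K)) (≡.cong (m (suc r) ℕ.+_) (≡.sym kr≡)))))) (lower-m+k d<r+1 r<n))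
    ... | inj₁ d<r with free-or-blocked inv (s≤s z≤n) r<n
    ...   | inj₁ free                      = inj₁ free
    ...   | inj₂ (_ , ≡.refl , _ , mr≡) = inj₂ (d<r , mr≡)

    determinant-blocked : Blocked′ → determinant m′ k′ ≋ 0#
    determinant-blocked (d<r , mr≡) = go ≡.refl
      where
      -- Rows `r` and `suc r` of `m` have equal length, so `lower-gap` turns into a lower bound for
      -- the flag above; the choice of the first row of maximal flag provides the upper bound.
      kr≡K : k r ≡ K
      kr≡K = ℕ.≤-antisym (above d<r ℕ.≤-refl) (ℕ.≤-pred (ℕ.+-cancelˡ-≤ (m (suc r)) (suc K) (suc (k r))
        (ℕ.≤-trans (≡.subst (λ t → m (suc r) ℕ.+ t ≤ suc (m r ℕ.+ k r)) kr≡ (lower-gap d<r r<n))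
                   (ℕ.≤-reflexive (≡.trans (≡.cong (λ t → suc (t ℕ.+ k r)) mr≡) (≡.sym (ℕ.+-suc _ (k r))))))))

      go : ∀ {q} → r ≡ q → determinant m′ k′ ≋ 0#
      go {zero}  ≡.refl = contradiction d<r λ ()
      go {suc q} ≡.refl = determinant-repeated {m′} {k′} {q} r<n
        (≡.trans (column-lower m′ k′ (ℕ.≤-pred d<r) (≡.trans (update-off m (suc r) (ℕ.<⇒≢ ℕ.≤-refl)) mr≡)
                                                    (≡.trans (update-off k (suc r) (ℕ.<⇒≢ ℕ.≤-refl)) kr≡K))
          (≡.trans (≡.cong (λ s → shift s (signedElementary lowerVariable K)) (exponent-suc (m (suc r)) r<n))
                   (≡.sym (column-lower m′ k′ d≤r (update-at m (suc r)) (update-at k (suc r))))))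

    entries-last : ∀ j → rowEntries k (suc r , j) ≡ rowEntries k′ (suc r , j) ++ [ v ]
    entries-last j = ≡.trans (rowEntries-lower k {j = j} d<r+1 kr≡)
      (≡.trans (≡.sym (applyUpTo-∷ʳ (λ κ → + suc κ) K))
               (≡.cong (_++ [ v ]) (≡.sym (rowEntries-lower k′ {j = j} d<r+1 (update-at k (suc r))))))

    module _ (good : Good m) (m<ν : m (suc r) < ν (suc r)) where

      j≤d : ∀ {j} → j ≤ ν (suc r) → j ≤ d
      j≤d j≤ν = ℕ.≤-trans j≤ν (proj₂ good d<r+1 r<n)

      incompatible : ∀ {t j} → t ∈ rowEntries k′ b → suc (m (suc r)) < j → j ≤ ν (suc r) → ¬ Compatible (b , t) ((suc r , j) , v)
      incompatible t∈ c<j j≤ν ((_ , _ , _ , ordered) , _)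
        with κ , κ<k′ , ≡.refl ← ∈-rowEntries-lower k′ {j = suc (m (suc r))} d<r+1 t∈ =
        ℕ.<⇒≯ (ℕ.≤-pred (ℤ.drop‿+<+ (ordered (j≤d j≤ν , ≡.refl , c<j))))
              (≡.subst (κ <_) (update-at k (suc r)) κ<k′)

      compatible : Free m (suc r) → ∀ {i j t} → (i , j) ∈ skewBoxes m′ → t ∈ rowEntries k′ (i , j) → Compatible (b , v) ((i , j) , t)
      compatible free {i} {j} ij∈ t∈ with 0<i , i≤ℓ , m′<j , _ ← ∈-skewBoxes⁻ m′ ij∈ =
        ( (λ (r<d , _) → contradiction r<d (ℕ.<⇒≱ d<r+1))
        , (λ (i≤d , _ , r<i) → contradiction i≤d (ℕ.<⇒≱ (ℕ.<-trans d<r+1 r<i)))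
        -- Rows below may still contain `suc K`, which is allowed because columns decrease weakly;
        -- maximality of the flag rules out anything larger.
        , (λ (_ , _ , r<i) → let κ , κ<k , t≡ = ∈-rowEntries-lower k′ {j = j} (ℕ.<-trans d<r+1 r<i) t∈ in
             ≡.subst (ℤ._≤ v) (≡.sym t≡) (ℤ.+≤+ (ℕ.≤-trans κ<k
               (ℕ.≤-trans (update-≤ k (suc r) K≤k i) (below r<i (ℕ.≤-trans i≤ℓ ℓ≤n))))))
        , (λ where (_ , ≡.refl , _) → let κ , κ<k , t≡ = ∈-rowEntries-lower k′ {j = j} d<r+1 t∈ in
                     ≡.subst (ℤ._< v) (≡.sym t≡) (ℤ.+<+ (s≤s (≡.subst (κ <_) (update-at k (suc r)) κ<k)))) )
        , ( (λ where (r<d , ≡.refl , _) → contradiction r<d (ℕ.<⇒≱ d<r+1))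
          , (λ (r<d , _) → contradiction r<d (ℕ.<⇒≱ d<r+1))
          , (λ where (_ , ≡.refl , i<r) → contradiction (≡.subst (_< j) (update-off m (suc r) (ℕ.<⇒≢ i<r)) m′<j)
                                                        (ℕ.<⇒≱ (s≤s (free 0<i i<r))))
          , (λ where (_ , ≡.refl , j<c) → contradiction (≡.subst (_< j) (update-at m (suc r)) m′<j) (ℕ.<⇒≯ j<c)) )

      -- Strict decrease along row `suc r` removes exactly the value `v` from its remaining boxes,
      -- which is the passage from `k` to `k′`; no other box loses an option.
      sum-free : Free m (suc r) → fillingSum (skewBoxes m′) (restrict (b , v) (rowEntries k)) ≋ tableauSum m′ k′
      sum-free free = fillingSum-cong (skewBoxes m′) λ {b′} b′∈ → restricted b′ b′∈
        where
        restricted : ∀ b′ → b′ ∈ skewBoxes m′ → restrict (b , v) (rowEntries k) b′ ≡ rowEntries k′ b′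
        restricted (i , j) ij∈ = by-row (i ℕ.≟ suc r)
          where
          C? = λ t → compatible? (b , v) ((i , j) , t)

          all : filter C? (rowEntries k′ (i , j)) ≡ rowEntries k′ (i , j)
          all = filter-all C? (All.tabulate (compatible free ij∈))

          by-row : Dec (i ≡ suc r) → filter C? (rowEntries k (i , j)) ≡ rowEntries k′ (i , j)
          by-row (no i≢)      = ≡.trans (≡.cong (filter C?) (rowEntries-cong {k} {k′} {i} {j} (k-off i≢))) all
          by-row (yes ≡.refl) = ≡.trans (≡.cong (filter C?) (entries-last j)) (≡.trans (filter-++ C? (rowEntries k′ (i , j)) [ v ])
            (≡.trans (≡.cong₂ _++_ all (filter-reject C? self)) (++-identityʳ _)))
            where
            self : ¬ Compatible (b , v) ((i , j) , v)
            self ((_ , _ , _ , ordered) , _) =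
              let _ , _ , m′<j , j≤ν = ∈-skewBoxes⁻ m′ ij∈ in
              ℤ.<-irrefl ≡.refl (ordered (j≤d j≤ν , ≡.refl , ≡.subst (_< j) (update-at m (suc r)) m′<j))

      sum-blocked : Blocked′ → fillingSum (skewBoxes m′) (restrict (b , v) (rowEntries k)) ≋ 0#
      sum-blocked (d<r , mr≡) = fillingSum-empty (skewBoxes m′) b′∈
        (filter-none (λ t → compatible? (b , v) (b′ , t)) {xs = rowEntries k b′} (All.tabulate conflict))
        where
        b′ : Box
        b′ = r , suc (m (suc r))

        0<r : 0 < r
        0<r = ℕ.≤-<-trans z≤n d<r

        b′∈ : b′ ∈ skewBoxes m′
        b′∈ = ∈-skewBoxes⁺ m′ 0<r
          (s≤s (ℕ.≤-reflexive (≡.trans (update-off m (suc r) (ℕ.<⇒≢ ℕ.≤-refl)) mr≡)))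
          (ℕ.≤-trans m<ν (ν↓ 0<r))

        conflict : ∀ {t} → t ∈ rowEntries k b′ → ¬ Compatible (b , v) (b′ , t)
        conflict t∈ (_ , _ , _ , ordered , _) with κ , κ<k , ≡.refl ← ∈-rowEntries-lower k {j = suc (m (suc r))} d<r t∈ =
          ℕ.<⇒≱ (ℕ.<-≤-trans κ<k (above d<r ℕ.≤-refl))
                (ℕ.≤-pred (ℤ.drop‿+≤+ (ordered (j≤d m<ν , ≡.refl , ℕ.≤-refl))))

    claim : (Free m (suc r) → Claim m′ k′) → Claim m k′ → Claim m k
    claim claim-m′ = step-claim {m} {k} {suc r} {K} {v} (s≤s z≤n) r<n determinant-step bad₂ good₂
      where
      neg-0 : ∀ {p} → p ≋ 0# → - p ≋ 0#
      neg-0 p≋0 = ≋-trans (⊝-cong p≋0) -0#≈0#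

      bad₂ : Bad m′ → - determinant m′ k′ ≋ 0#
      bad₂ bad with free-or-blocked′
      ... | inj₁ free    = neg-0 (proj₂ (claim-m′ free) bad)
      ... | inj₂ blocked = neg-0 (determinant-blocked blocked)

      good₂ : Good m → m (suc r) < ν (suc r) →
              ∃ λ y → - determinant m′ k′ ≋ sign m * y × tableauSum m k ≋ tableauSum m k′ + a v * y
      good₂ good m<ν with free-or-blocked′
      ... | inj₁ free = tableauSum m′ k′ , (begin
          - determinant m′ k′                  ≈⟨ ⊝-cong (proj₁ (claim-m′ free) (good-update good m<ν)) ⟩
          - (sign m′ * tableauSum m′ k′)       ≈⟨ -1*x≈-x _ ⟨
          - 1# * (sign m′ * tableauSum m′ k′)  ≈⟨ ⊗-assoc _ _ _ ⟨
          - 1# * sign m′ * tableauSum m′ k′    ≡⟨ ≡.cong (λ c → (- 1#) ^ c * tableauSum m′ k′) (lowerCount-lower m (s≤s z≤n) m<ν d<r+1) ⟨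
          sign m * tableauSum m′ k′            ∎) ,
        ≋-trans (tableauSum-peel (s≤s z≤n) m<ν v entries-last (incompatible good m<ν)) (⊕-cong ≋-refl (⊗-cong ≋-refl (sum-free good m<ν free)))
      ... | inj₂ blocked = 0# ,
        ≋-trans (neg-0 (determinant-blocked blocked)) (≋-sym (R.zeroʳ _)) ,
        ≋-trans (tableauSum-peel (s≤s z≤n) m<ν v entries-last (incompatible good m<ν)) (⊕-cong ≋-refl (⊗-cong ≋-refl (sum-blocked good m<ν blocked)))

  column-monomial : ∀ m k {i} → k (suc i) ≡ 0 → column m k i ≈₁ x^ (m (suc i) ℕ.+ (n ∸ suc i))
  column-monomial m k {i} k≡0 x = by-row (suc i ℕ.≤? d)
    where
    s = m (suc i) ℕ.+ (n ∸ suc i)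

    by-row : Dec (suc i ≤ d) → column m k i x ≋ (x^ s) x
    by-row (yes i<d) = ≋-trans (R.reflexive (≡.cong (λ f → f x) (column-upper m k i<d ≡.refl k≡0)))
      (≋-trans (shift-cong s {complete upperVariable 0} {x^ 0} (λ _ → ≋-refl) x) (shift-1 s x))
    by-row (no i≮d)  = ≋-trans (R.reflexive (≡.cong (λ f → f x) (column-lower m k (ℕ.≤-pred (ℕ.≰⇒> i≮d)) ≡.refl k≡0)))
      (≋-trans (shift-cong s {signedElementary lowerVariable 0} {x^ 0} (λ _ → ≋-refl) x) (shift-1 s x))

  -- Without flags the columns are monomials, so the determinant detects whether `m` equals `ν`. The
  -- tableau sum does the same: any box of ν/m has no entry to choose from, and if there is no box
  -- the empty filling contributes 1.
  claim-monomial : ∀ {m k} → Invariant m k → (∀ {i} → 0 < i → i ≤ n → k i ≡ 0) → Claim m k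
  claim-monomial {m} {k} inv k≡0 = good , bad
    where
    open Invariant inv

    monomials : determinant m k ≋ alternant (exponents n ν) (toList (Vec.map x^_ (exponents n m)))
    monomials = ≋-trans
      (alternant-cong (exponents n ν) (pointwise-applyUpTo n λ {i} i<n → column-monomial m k {i} (k≡0 (s≤s z≤n) i<n)))
      (R.reflexive (≡.cong (alternant (exponents n ν)) (≡.sym (toList-map-tabulate n x^_ λ i → m (suc i) ℕ.+ (n ∸ suc i)))))

    different : ∀ {i} → 0 < i → i ≤ n → m i ≢ ν i → determinant m k ≋ 0#
    different 0<i i≤n mi≢νi = ≋-trans monomials
      (alternant-monomials-≢ (exponents-decreasing n λ 0<i _ → ν↓ 0<i) (exponents-decreasing n m↓)
        (λ eq → mi≢νi (≡.sym (exponents-injective n {ν} {m} eq 0<i i≤n))))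

    good : Good m → determinant m k ≋ sign m * tableauSum m k
    good (m≤ν , _) with find-failure (λ i → m i ℕ.≟ ν i) n
    ... | inj₂ (i , 0<i , i≤n , mi≢νi) = ≋-trans (different 0<i i≤n mi≢νi) (≋-sym (≋-trans
            (⊗-cong ≋-refl (fillingSum-empty (skewBoxes m)
              (∈-skewBoxes⁺ m 0<i ℕ.≤-refl (ℕ.≤∧≢⇒< (m≤ν 0<i i≤n) mi≢νi)) (no-entries i (k≡0 0<i i≤n))))
            (R.zeroʳ _)))
      where
      no-entries : ∀ i → k i ≡ 0 → rowEntries k (i , suc (m i)) ≡ []
      no-entries i ki≡0 with i ℕ.≤? d
      ... | yes i≤d = rowEntries-upper k {j = suc (m i)} i≤d ki≡0
      ... | no i≰d  = rowEntries-lower k {j = suc (m i)} (ℕ.≰⇒> i≰d) ki≡0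
    ... | inj₁ m≡ν with skewBoxes m in eq
    ...   | b ∷ _ = let 0<i , i≤ℓ , m<j , j≤ν = ∈-skewBoxes⁻ m {proj₁ b} {proj₂ b} (≡.subst (b ∈_) (≡.sym eq) (here ≡.refl)) in
                    contradiction (≡.subst (proj₂ b ≤_) (≡.sym (m≡ν 0<i (ℕ.≤-trans i≤ℓ ℓ≤n))) j≤ν) (ℕ.<⇒≱ m<j)
    ...   | [] = begin
      determinant m k                                                      ≈⟨ monomials ⟩
      alternant (exponents n ν) (toList (Vec.map x^_ (exponents n m)))     ≡⟨ ≡.cong (λ ε → alternant (exponents n ν) (toList (Vec.map x^_ ε))) (exponents-cong n m≡ν) ⟩
      alternant (exponents n ν) (toList (Vec.map x^_ (exponents n ν)))     ≈⟨ alternant-monomials-≡ (exponents-decreasing n λ 0<i _ → ν↓ 0<i) ⟩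
      1#                                                                   ≈⟨ ⊗-identityˡ 1# ⟨
      1# * 1#                                                              ∎

    bad : Bad m → determinant m k ≋ 0#
    bad (inj₁ (i , 0<i , i≤n , ν<m)) = different 0<i i≤n (ℕ.>⇒≢ ν<m)
    bad (inj₂ (d<n , d<ν))           = different (s≤s z≤n) d<n
      (ℕ.<⇒≢ (ℕ.≤-<-trans (ℕ.m≤m+n _ _) (ℕ.<-≤-trans (lower-m+k ℕ.≤-refl d<n) d<ν)))

  -- Larger than every exponent νᵢ + n - i. A column starting at this power of x vanishes in all
  -- rows of the alternant.
  bound : ℕ
  bound = suc (ν 1 ℕ.+ n)

  determinant-beyond : ∀ {m k r} → r < n → bound ≤ m (suc r) → determinant m k ≋ 0#
  determinant-beyond {m} {k} {r} r<n bound≤m = alternant-zeroColumn (exponents n ν) (Any.applyUpTo⁺ (column m k)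
    (VecAll.tabulate⁺ λ i → shift-below (m (suc r) ℕ.+ (n ∸ suc r)) _ (small (toℕ i))) r<n)
    where
    small : ∀ i → ν (suc i) ℕ.+ (n ∸ suc i) < m (suc r) ℕ.+ (n ∸ suc r)
    small i = ℕ.≤-trans (s≤s (ℕ.+-mono-≤ (ν-antitone (s≤s z≤n) (s≤s z≤n)) (ℕ.m∸n≤m n (suc i))))
                        (ℕ.≤-trans bound≤m (ℕ.m≤m+n _ _))

  -- An upper step with a lengthened row keeps all flags, so the flags alone do not decrease; the
  -- room left below `bound` is counted as well.
  measure : (m k : ℕ → ℕ) → ℕ
  measure m k = sumBelow n λ i → (bound ∸ m (suc i)) ℕ.+ k (suc i)

  measure-k : ∀ {m k r K} → r < n → k (suc r) ≡ suc K → measure m (update k (suc r) K) < measure m k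
  measure-k {m} {k} {r} {K} r<n kr≡ = sumBelow-< r<n
    (λ i → ℕ.+-monoʳ-≤ (bound ∸ m (suc i)) (update-≤ k (suc r) (≡.subst (K ≤_) (≡.sym kr≡) (ℕ.n≤1+n K)) (suc i)))
    (ℕ.+-monoʳ-< (bound ∸ m (suc r)) (ℕ.≤-reflexive (≡.trans (≡.cong suc (update-at k (suc r))) (≡.sym kr≡))))

  measure-m-≤ : ∀ {m k r} → measure (update m (suc r) (suc (m (suc r)))) k ≤ measure m k
  measure-m-≤ {m} {k} {r} = sumBelow-≤ n λ i →
    ℕ.+-monoˡ-≤ (k (suc i)) (ℕ.∸-monoʳ-≤ bound (update-≥ m (suc r) (ℕ.n≤1+n _) (suc i)))

  measure-m : ∀ {m k r} → r < n → m (suc r) < bound → measure (update m (suc r) (suc (m (suc r)))) k < measure m k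
  measure-m {m} {k} {r} r<n m<bound = sumBelow-< r<n
    (λ i → ℕ.+-monoˡ-≤ (k (suc i)) (ℕ.∸-monoʳ-≤ bound (update-≥ m (suc r) (ℕ.n≤1+n _) (suc i))))
    (ℕ.+-monoˡ-< (k (suc r)) (≡.subst (λ t → bound ∸ t < bound ∸ m (suc r)) (≡.sym (update-at m (suc r)))
      (ℕ.∸-monoʳ-< ℕ.≤-refl m<bound)))

  UpperRow LowerRow : (ℕ → ℕ) → Set
  UpperRow k = ∃ λ r → ∃ λ K → r < d × k (suc r) ≡ suc K
    × (∀ {i} → 0 < i → i ≤ suc r → k i ≡ suc K) × (∀ {i} → suc r < i → i ≤ d → k i ≤ K)
  LowerRow k = ∃ λ r → ∃ λ K → d ≤ r × r < n × k (suc r) ≡ suc K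
    × (∀ {i} → d < i → i ≤ r → k i ≤ K) × (∀ {i} → suc r < i → i ≤ n → k i ≤ suc K)

  -- Upper flags decrease weakly, so `k 1` is the maximal one, and the rows attaining it form an
  -- initial segment whose last row is taken.
  upper-row : ∀ {m k} → Invariant m k → UpperRow k ⊎ (∀ {i} → 0 < i → i ≤ d → k i ≡ 0)
  upper-row {m} {k} inv with 0 ℕ.<? d | k 1 in k1≡
  ... | no d≡0  | _     = inj₂ λ 0<i i≤d → contradiction (ℕ.<-≤-trans 0<i i≤d) d≡0
  ... | yes 0<d | zero  = inj₂ λ {i} 0<i i≤d → ℕ.n≤0⇒n≡0 (≡.subst (k i ≤_) k1≡ (antitone {k} {1} {d} (Invariant.upper-k↓ inv) (s≤s z≤n) 0<i i≤d))
  ... | yes 0<d | suc K with last-satisfying (λ i → k i ℕ.≟ suc K) {1} {d} 0<d k1≡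
  ...   | suc r , _ , r<d , kr≡ , none = inj₁ (r , K , r<d , kr≡
    , (λ {i} 0<i i≤r → ℕ.≤-antisym (≤k1 0<i (ℕ.≤-trans i≤r r<d))
                     (≡.subst (_≤ k i) kr≡ (antitone {k} {1} {d} (Invariant.upper-k↓ inv) 0<i i≤r r<d)))
    , (λ r<i i≤d → ℕ.≤-pred (ℕ.≤∧≢⇒< (≤k1 (ℕ.≤-<-trans z≤n r<i) i≤d) (none r<i i≤d))))
    where
    ≤k1 : ∀ {i} → 0 < i → i ≤ d → k i ≤ suc K
    ≤k1 {i} 0<i i≤d = ≡.subst (k i ≤_) k1≡ (antitone {k} {1} {d} (Invariant.upper-k↓ inv) (s≤s z≤n) 0<i i≤d)

  lower-row : ∀ {m k} → Invariant m k → LowerRow k ⊎ (∀ {i} → d < i → i ≤ n → k i ≡ 0)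
  lower-row {m} {k} inv with d ℕ.<? n | k n in kn≡
  ... | no d≮n  | _     = inj₂ λ d<i i≤n → contradiction (ℕ.<-≤-trans d<i i≤n) d≮n
  ... | yes d<n | zero  = inj₂ λ {i} d<i i≤n → ℕ.n≤0⇒n≡0 (≡.subst (k i ≤_) kn≡ (monotone {k} {suc d} {n} (Invariant.lower-k↑ inv) d<i i≤n ℕ.≤-refl))
  -- Lower flags increase weakly, so `k n` is maximal, and the row sought is the successor of the
  -- last row with a smaller flag. The alternative `i ≤ d` lets the search start at `d` when row
  -- `d + 1` already has the maximal flag.
  ... | yes d<n | suc K with last-satisfying (λ i → (i ℕ.≤? d) ⊎-dec (k i ℕ.<? k n)) {d} {n} (ℕ.<⇒≤ d<n) (inj₁ ℕ.≤-refl)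
  ...   | r , d≤r , r≤n , small , none = inj₁ (r , K , d≤r , r<n
    , ℕ.≤-antisym (≤kn (s≤s d≤r) r<n) (≡.subst (_≤ k (suc r)) kn≡ (ℕ.≮⇒≥ (none ℕ.≤-refl r<n ∘ inj₂)))
    , (λ {i} d<i i≤r → ℕ.≤-pred (≡.subst (k i <_) kn≡ (ℕ.≤-<-trans
        (monotone {k} {suc d} {n} (Invariant.lower-k↑ inv) d<i i≤r r≤n) (kr<kn (ℕ.<-≤-trans d<i i≤r) small))))
    , (λ r<i i≤n → ≤kn (ℕ.≤-<-trans d≤r (ℕ.<-trans (ℕ.n<1+n r) r<i)) i≤n))
    where
    ≤kn : ∀ {i} → d < i → i ≤ n → k i ≤ suc K
    ≤kn {i} d<i i≤n = ≡.subst (k i ≤_) kn≡ (monotone {k} {suc d} {n} (Invariant.lower-k↑ inv) d<i i≤n ℕ.≤-refl)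

    kr<kn : ∀ {i} → d < i → i ≤ d ⊎ k i < k n → k i < k n
    kr<kn d<i (inj₁ i≤d) = contradiction i≤d (ℕ.<⇒≱ d<i)
    kr<kn d<i (inj₂ lt)  = lt

    r<n : r < n
    r<n = ℕ.≤∧≢⇒< r≤n λ where
      ≡.refl → ℕ.<-irrefl ≡.refl (kr<kn d<n small)

  claim : ∀ {m k} → Invariant m k → Claim m k
  claim {m} {k} inv = go (suc (measure m k)) ℕ.≤-refl inv
    where
    go : ∀ fuel {m k} → measure m k < fuel → Invariant m k → Claim m k
    go (suc fuel) {m} {k} m<fuel inv with upper-row inv | lower-row inv
    ... | inj₂ upper≡0 | inj₂ lower≡0 = claim-monomial inv zero-flags
      where
      zero-flags : ∀ {i} → 0 < i → i ≤ n → k i ≡ 0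
      zero-flags {i} 0<i i≤n with i ℕ.≤? d
      ... | yes i≤d = upper≡0 0<i i≤d
      ... | no i≰d  = lower≡0 (ℕ.≰⇒> i≰d) i≤n
    ... | inj₂ _ | inj₁ (r , K , d≤r , r<n , kr≡ , above , below) = LowerStep.claim inv d≤r r<n kr≡ above below
      (λ free → go fuel (less (ℕ.≤-<-trans (measure-m-≤ {m} {update k (suc r) K} {r}) (measure-k {m} {k} r<n kr≡)))
                        (LowerStep.invariant-m′ inv d≤r r<n kr≡ above below free))
      (go fuel (less (measure-k {m} {k} r<n kr≡)) (LowerStep.invariant-k′ inv d≤r r<n kr≡ above below))
      where
      less : ∀ {x} → x < measure m k → x < fuel
      less x< = ℕ.<-≤-trans x< (ℕ.≤-pred m<fuel)
    ... | inj₁ (r , K , r<d , kr≡ , above , below) | _ with m (suc r) ℕ.<? bound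
    ...   | yes m<bound = UpperStep.claim inv r<d kr≡ above below
      (λ free → go fuel (less (measure-m {m} {k} r<n m<bound)) (UpperStep.invariant-m′ inv r<d kr≡ above below free))
      (go fuel (less (measure-k {m} {k} r<n kr≡)) (UpperStep.invariant-k′ inv r<d kr≡ above below))
      where
      r<n : r < n
      r<n = ℕ.<-≤-trans r<d d≤n
      less : ∀ {x} → x < measure m k → x < fuel
      less x< = ℕ.<-≤-trans x< (ℕ.≤-pred m<fuel)
    -- Here `m` sticks out of `ν`, so the first half of the claim is vacuous, and the second holds
    -- because of a vanishing column.
    ...   | no m≮bound =
        (λ (m≤ν , _) → contradiction (s≤s (ℕ.≤-trans (m≤ν (s≤s z≤n) r<n) (ℕ.≤-trans (ν-antitone (s≤s z≤n) (s≤s z≤n)) (ℕ.m≤m+n _ n)))) m≮bound)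
      , (λ _ → determinant-beyond {m} {k} r<n (ℕ.≮⇒≥ m≮bound))
      where
      r<n : r < n
      r<n = ℕ.<-≤-trans r<d d≤n

-- Partitions

part-beyond : ∀ μ {i} → length μ < i → part μ i ≡ 0
part-beyond []      _                     = ≡.refl
part-beyond (p ∷ μ) {suc (suc i)} (s≤s l) = part-beyond μ l

part-antitone : ∀ {μ} → Linked _≥_ μ → ∀ {i} → 0 < i → part μ (suc i) ≤ part μ i
part-antitone []        {suc i}       _ = z≤n
part-antitone [-]       {suc i}       _ = z≤n
part-antitone (p≥q ∷ _) {suc zero}    _ = p≥q
part-antitone (_ ∷ μ↓)  {suc (suc i)} _ = part-antitone μ↓ (s≤s z≤n)

applyUpTo-part : ∀ μ → applyUpTo (part μ ∘ suc) (length μ) ≡ μ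
applyUpTo-part []      = ≡.refl
applyUpTo-part (p ∷ μ) = ≡.cong (p ∷_) (applyUpTo-part μ)

part-injective : ∀ {μ ν n} → All (0 <_) μ → All (0 <_) ν → length μ ≤ n → length ν ≤ n →
                 (∀ {i} → 0 < i → i ≤ n → part μ i ≡ part ν i) → μ ≡ ν
part-injective []          []          _       _       eq = ≡.refl
part-injective []          (0<q ∷ _)   _       (s≤s _) eq = contradiction (eq {1} (s≤s z≤n) (s≤s z≤n)) (ℕ.<⇒≢ 0<q)
part-injective (0<p ∷ _)   []          (s≤s _) _       eq = contradiction (eq {1} (s≤s z≤n) (s≤s z≤n)) (ℕ.>⇒≢ 0<p)
part-injective (0<p ∷ 0<μ) (0<q ∷ 0<ν) (s≤s l) (s≤s l′) eq =
  ≡.cong₂ _∷_ (eq {1} (s≤s z≤n) (s≤s z≤n)) (part-injective 0<μ 0<ν l l′ λ {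
    {suc i} 0<i i≤n → eq {suc (suc i)} (s≤s z≤n) (s≤s i≤n) })

⊆⇒part-≤ : ∀ {μ ν} → μ ⊆ ν → ∀ i → part μ i ≤ part ν i
⊆⇒part-≤ []        i             = z≤n
⊆⇒part-≤ (p≤q ∷ _) zero          = z≤n
⊆⇒part-≤ (p≤q ∷ _) (suc zero)    = p≤q
⊆⇒part-≤ (_ ∷ μ⊆ν) (suc (suc i)) = ⊆⇒part-≤ μ⊆ν (suc i)

⊆⇒length-≤ : ∀ {μ ν} → μ ⊆ ν → length μ ≤ length ν
⊆⇒length-≤ []        = z≤n
⊆⇒length-≤ (_ ∷ μ⊆ν) = s≤s (⊆⇒length-≤ μ⊆ν)

part-≤⇒⊆ : ∀ {μ} ν → All (0 <_) μ → (∀ {i} → 0 < i → i ≤ length μ → part μ i ≤ part ν i) → μ ⊆ ν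
part-≤⇒⊆ ν       []          μ≤ν = []
part-≤⇒⊆ []      (0<p ∷ _)   μ≤ν = contradiction (μ≤ν {1} (s≤s z≤n) (s≤s z≤n)) (ℕ.<⇒≱ 0<p)
part-≤⇒⊆ (q ∷ ν) (0<p ∷ 0<μ) μ≤ν = μ≤ν {1} (s≤s z≤n) (s≤s z≤n) ∷ part-≤⇒⊆ ν 0<μ λ {
  {suc i} _ i≤ → μ≤ν {suc (suc i)} (s≤s z≤n) (s≤s i≤) }

module _ {A : Set} {P : Pred A 0ℓ} (P? : Decidable P) where

  private
    none-after : ∀ {f : ℕ → A} → (∀ i → P (f (suc i)) → P (f i)) → ¬ P (f 0) → ∀ i → ¬ P (f i)
    none-after down ¬P0 zero    = ¬P0
    none-after down ¬P0 (suc i) = none-after down ¬P0 i ∘ down i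

  -- A property inherited by predecessors holds on an initial segment, whose length is therefore its
  -- count. This turns `diagonal` and `conjugatePart`, which are defined by counting, into
  -- thresholds.
  count-initial : ∀ {f : ℕ → A} n → (∀ i → P (f (suc i)) → P (f i)) →
    let c = length (filter P? (applyUpTo f n)) in
    c ≤ n × (∀ {i} → i < c → P (f i)) × (∀ {i} → c ≤ i → i < n → ¬ P (f i))
  count-initial zero    down = z≤n , (λ ()) , (λ _ ())
  count-initial {f} (suc n) down with P? (f 0)
  ... | yes P0 = let c≤n , before , after = count-initial {f ∘ suc} n (down ∘ suc) in
    s≤s c≤n , (λ { {zero} _ → P0 ; {suc i} (s≤s i<c) → before i<c })
            , (λ { {suc i} (s≤s c≤i) (s≤s i<n) → after c≤i i<n })
  ... | no ¬P0 rewrite filter-none P? (All.applyUpTo⁺₂ (f ∘ suc) n (none-after down ¬P0 ∘ suc)) =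
    z≤n , (λ ()) , (λ {i} _ _ → none-after down ¬P0 i)

module _ {μ} (μ-partition : IsPartition μ) where

  private
    μ↓ = proj₁ μ-partition

    diagonal-count = count-initial (λ i → i ℕ.≤? part μ i) {suc} (length μ)
      (λ i i+2≤ → ℕ.≤-trans (ℕ.n≤1+n (suc i)) (ℕ.≤-trans i+2≤ (part-antitone μ↓ (s≤s z≤n))))

  diagonal≤length : diagonal μ ≤ length μ
  diagonal≤length = proj₁ diagonal-count

  ≤diagonal⇒≤part : ∀ {i} → 0 < i → i ≤ diagonal μ → i ≤ part μ i
  ≤diagonal⇒≤part {suc i} _ i≤d = proj₁ (proj₂ diagonal-count) i≤d

  diagonal<⇒part< : ∀ {i} → diagonal μ < i → part μ i < i
  diagonal<⇒part< {suc i} (s≤s d≤i) with i ℕ.<? length μ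
  ... | yes i<ℓ = ℕ.≰⇒> (proj₂ (proj₂ diagonal-count) d≤i i<ℓ)
  ... | no i≮ℓ  = ≡.subst (_< suc i) (≡.sym (part-beyond μ (s≤s (ℕ.≮⇒≥ i≮ℓ)))) (s≤s z≤n)

  ≤part⇒≤diagonal : ∀ {i} → i ≤ part μ i → i ≤ diagonal μ
  ≤part⇒≤diagonal {i} i≤part with i ℕ.≤? diagonal μ
  ... | yes i≤d = i≤d
  ... | no i≰d  = contradiction i≤part (ℕ.<⇒≱ (diagonal<⇒part< (ℕ.≰⇒> i≰d)))

  part-decreasing : ∀ {i j} → 0 < i → i ≤ j → part μ j ≤ part μ i
  part-decreasing 0<i i≤j = antitone {part μ} {1} (λ 0<i _ → part-antitone μ↓ 0<i) 0<i i≤j ℕ.≤-refl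

  conjugate<⇒part< : ∀ {i j} → 0 < j → conjugatePart μ j < i → part μ i < j
  conjugate<⇒part< {suc i} {j} 0<j (s≤s c≤i) with i ℕ.<? length μ
  ... | yes i<ℓ = ℕ.≰⇒> (proj₂ (proj₂ (count-initial (j ℕ.≤?_) {part μ ∘ suc} (length μ)
                    λ i j≤ → ℕ.≤-trans j≤ (part-antitone μ↓ (s≤s z≤n))))
                    (≡.subst (λ l → length (filter (j ℕ.≤?_) l) ≤ i) (≡.sym (applyUpTo-part μ)) c≤i) i<ℓ)
  ... | no i≮ℓ  = ≡.subst (_< j) (≡.sym (part-beyond μ (s≤s (ℕ.≮⇒≥ i≮ℓ)))) 0<j

  ≤conjugate⇒≤part : ∀ {i j} → 0 < i → i ≤ conjugatePart μ j → j ≤ part μ i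
  ≤conjugate⇒≤part {suc i} {j} _ i<c = proj₁ (proj₂ (count-initial (j ℕ.≤?_) {part μ ∘ suc} (length μ)
    λ i j≤ → ℕ.≤-trans j≤ (part-antitone μ↓ (s≤s z≤n))))
    (≡.subst (λ l → i < length (filter (j ℕ.≤?_) l)) (≡.sym (applyUpTo-part μ)) i<c)

choices-unique : ∀ {A : Set} {xss : List (List A)} → All Unique xss → Unique (choices xss)
choices-unique []                           = [] ∷ []
choices-unique (xs-unique ∷ xss-unique) =
  Unique.cartesianProductWith⁺ _∷_ (λ where ≡.refl → ≡.refl , ≡.refl) xs-unique (choices-unique xss-unique)

choices-length : ∀ {A : Set} (xss : List (List A)) {xs} → xs ∈ choices xss → length xs ≡ length xss
choices-length []         (here ≡.refl) = ≡.refl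
choices-length (ys ∷ xss) xs∈ with _ , xs , _ , xs∈ , ≡.refl ← ∈-cartesianProductWith⁻ _∷_ ys (choices xss) xs∈ =
  ≡.cong suc (choices-length xss xs∈)

∈-choices-replicate : ∀ {A : Set} {xs : List A} {ys} → All (_∈ xs) ys → ys ∈ choices (replicate (length ys) xs)
∈-choices-replicate []         = here ≡.refl
∈-choices-replicate (y∈ ∷ ys∈) = ∈-cartesianProductWith⁺ _∷_ y∈ (∈-choices-replicate ys∈)

-- Ensures that no Schur function is counted twice. Lists of different lengths cannot coincide, and
-- within one length every list is chosen once.
partitions-unique : ∀ N → Unique (partitions N)
partitions-unique N = Unique.filter⁺ (λ ν → isPartition? ν ×-dec size ν ℕ.≟ N) {concatMap ofLength (upTo (suc N))}
  (Unique.concat⁺ {xss = map ofLength (upTo (suc N))}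
    (All.map⁺ {f = ofLength} (All.universal ofLength-unique (upTo (suc N))))
    (AllPairs.map⁺ {f = ofLength} (AllPairs.map disjoint (Unique.upTo⁺ (suc N)))))
  where
  ofLength : ℕ → List (List ℕ)
  ofLength ℓ = choices (replicate ℓ (upTo (suc N)))

  ofLength-unique : ∀ ℓ → Unique (ofLength ℓ)
  ofLength-unique ℓ = choices-unique (All.replicate⁺ ℓ (Unique.upTo⁺ (suc N)))

  disjoint : ∀ {ℓ ℓ′} → ℓ ≢ ℓ′ → Disjoint (ofLength ℓ) (ofLength ℓ′)
  disjoint {ℓ} {ℓ′} ℓ≢ℓ′ {xs} (xs∈ , xs∈′) = ℓ≢ℓ′ (≡.trans (≡.sym (len ℓ xs∈)) (len ℓ′ xs∈′))
    where
    len : ∀ ℓ → xs ∈ ofLength ℓ → length xs ≡ ℓ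
    len ℓ xs∈ = ≡.trans (choices-length (replicate ℓ (upTo (suc N))) xs∈) (length-replicate ℓ)

∈-partitions : ∀ {ν} → IsPartition ν → ν ∈ partitions (size ν)
∈-partitions {ν} ν-partition = ∈-filter⁺ (λ ν′ → isPartition? ν′ ×-dec size ν′ ℕ.≟ size ν)
  (∈-concatMap⁺ (λ ℓ → choices (replicate ℓ (upTo (suc (size ν)))))
    (lose (∈-upTo⁺ (s≤s (length≤size (proj₂ ν-partition)))) (∈-choices-replicate (All.map (∈-upTo⁺ ∘ s≤s) (parts≤size ν)))))
  (ν-partition , ≡.refl)
  where
  length≤size : ∀ {ν} → All (0 <_) ν → length ν ≤ size ν
  length≤size []          = z≤n
  length≤size (0<p ∷ 0<ν) = ℕ.+-mono-≤ 0<p (length≤size 0<ν)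

  parts≤size : ∀ ν → All (_≤ size ν) ν
  parts≤size []      = []
  parts≤size (p ∷ ν) = ℕ.m≤m+n p (size ν) ∷ All.map (λ q≤ → ℕ.≤-trans q≤ (ℕ.m≤n+m (size ν) p)) (parts≤size ν)

-- Inverts the passage from ν to the exponents νᵢ + n - i: the first part is the first exponent
-- minus the number of remaining variables.
partition-of-exponents : ∀ {n u} (β : Vec ℕ n) → StrictlyDecreasing u β →
  ∃ λ ν → IsPartition ν × length ν ≤ n × β ≡ exponents n (part ν) × Vec.sum β ≡ staircase n ℕ.+ size ν
partition-of-exponents [] [] = [] , ([] , []) , z≤n , ≡.refl , ≡.refl
partition-of-exponents {suc n} (b ∷ β) (b<u ∷ β↓)
  with ν , (ν↓ , 0<ν) , ℓ≤n , ≡.refl , sum≡ ← partition-of-exponents β β↓ = extend ν ν↓ 0<ν ℓ≤n (b≥ ν ℓ≤n β↓) sum≡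
  where
  b≥ : ∀ {n b} ν → length ν ≤ n → StrictlyDecreasing b (exponents n (part ν)) → part ν 1 ℕ.+ n ≤ b
  b≥ {zero}  []      _   []        = z≤n
  b≥ {suc n} {b} ν   ℓ≤n (c<b ∷ _) = ≡.subst (_≤ b) (≡.sym (ℕ.+-suc (part ν 1) n)) c<b

  add-part : ∀ {S} p q → b ≡ p ℕ.+ n → S ≡ staircase n ℕ.+ q → b ℕ.+ S ≡ staircase (suc n) ℕ.+ (p ℕ.+ q)
  add-part p q ≡.refl ≡.refl = begin
    (p ℕ.+ n) ℕ.+ (staircase n ℕ.+ q)  ≡⟨ solve 4 (λ s q p n → (p :+ n) :+ (s :+ q) := (n :+ s) :+ (p :+ q)) ≡.refl
                                            (staircase n) q p n ⟩
    staircase (suc n) ℕ.+ (p ℕ.+ q)    ∎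
    where
    open ≡.≡-Reasoning
    open +-*-Solver using (solve; _:+_; _:=_)

  extend : ∀ ν → Linked _≥_ ν → All (0 <_) ν → length ν ≤ n → part ν 1 ℕ.+ n ≤ b →
    Vec.sum (exponents n (part ν)) ≡ staircase n ℕ.+ size ν →
    ∃ λ ν′ → IsPartition ν′ × length ν′ ≤ suc n × b ∷ exponents n (part ν) ≡ exponents (suc n) (part ν′)
           × b ℕ.+ Vec.sum (exponents n (part ν)) ≡ staircase (suc n) ℕ.+ size ν′
  -- Parts are positive, so a difference of zero adds no part. The strict decrease of the exponents
  -- then forces the partition of the remaining ones to be empty.
  extend ν ν↓ 0<ν ℓ≤n b≥ sum≡ with b ∸ n in p≡
  extend [] _ _ _ b≥ sum≡ | zero = [] , ([] , []) , z≤n ,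
    ≡.cong (_∷ exponents n (part [])) b≡n , add-part 0 0 b≡n sum≡
    where
    b≡n : b ≡ n
    b≡n = ℕ.≤-antisym (ℕ.m∸n≡0⇒m≤n p≡) b≥
  extend (q ∷ ν) _ (0<q ∷ _) _ b≥ sum≡ | zero =
    contradiction (ℕ.m∸n≡0⇒m≤n p≡) (ℕ.<⇒≱ (ℕ.<-≤-trans (ℕ.m<n+m n 0<q) b≥))
  extend ν ν↓ 0<ν ℓ≤n b≥ sum≡ | suc p = suc p ∷ ν , (link ν ν↓ p≥ , s≤s z≤n ∷ 0<ν) , s≤s ℓ≤n ,
    ≡.cong (_∷ exponents n (part ν)) b≡ , add-part (suc p) (size ν) b≡ sum≡
    where
    b≡ : b ≡ suc p ℕ.+ n
    b≡ = ≡.trans (≡.sym (ℕ.m∸n+n≡m (ℕ.m+n≤o⇒n≤o (part ν 1) b≥))) (≡.cong (ℕ._+ n) p≡)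

    p≥ : part ν 1 ≤ suc p
    p≥ = ℕ.+-cancelʳ-≤ n (part ν 1) (suc p) (ℕ.≤-trans b≥ (ℕ.≤-reflexive b≡))

    link : ∀ ν → Linked _≥_ ν → part ν 1 ≤ suc p → Linked _≥_ (suc p ∷ ν)
    link []      _  _  = [-]
    link (q ∷ ν) ν↓ p≥ = p≥ ∷ ν↓

sumOver-unique : ∀ {A : Set} {xs : List A} {y f} → Unique xs → y ∈ xs →
                 (∀ {x} → x ∈ xs → x ≢ y → f x ≋ 0#) → sumOver xs f ≋ f y
sumOver-unique {xs = x ∷ xs} (x∉ ∷ _) (here ≡.refl) f≋0 =
  ≋-trans (⊕-cong ≋-refl (sumOver-0 xs λ z∈ → f≋0 (there z∈) λ z≡x → All.lookup x∉ z∈ (≡.sym z≡x))) (R.+-identityʳ _)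
sumOver-unique {xs = x ∷ xs} (x∉ ∷ unique) (there y∈) f≋0 =
  ≋-trans (⊕-cong (f≋0 (here ≡.refl) (All.lookup x∉ y∈)) (sumOver-unique unique y∈ (f≋0 ∘ there))) (⊕-identityˡ _)

-- The expansion into Schur functions

open Relation.Binary.Reasoning.Setoid R.setoid

filter-applyUpTo : ∀ {A : Set} {P : Pred A 0ℓ} (P? : Decidable P) {f : ℕ → A} {c n} → c ≤ n →
  (∀ {i} → i < c → P (f i)) → (∀ {i} → c ≤ i → ¬ P (f i)) → filter P? (applyUpTo f n) ≡ applyUpTo f c
filter-applyUpTo P? {f} {zero}  {n} _ before after = filter-none P? (All.applyUpTo⁺₂ f n λ i → after z≤n)
filter-applyUpTo P? {f} {suc c} {suc n} (s≤s c≤n) before after = ≡.trans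
  (filter-accept P? (before (s≤s z≤n)))
  (≡.cong (f 0 ∷_) (filter-applyUpTo P? c≤n (λ i<c → before (s≤s i<c)) (λ c≤i → after (s≤s c≤i))))

pointwise-tabulate : ∀ n {f : Fin n → R⟦x⟧} {g : ℕ → R⟦x⟧} → (∀ i → f i ≈₁ g (toℕ i)) →
                     Pointwise _≈₁_ (tabulate f) (applyUpTo g n)
pointwise-tabulate zero    f≈g = []
pointwise-tabulate (suc n) f≈g = f≈g zero ∷ pointwise-tabulate n (f≈g ∘ suc)

-- The dual alternant at the exponents of a partition

rowFlags : List ℕ → ℕ → ℕ
rowFlags μ i = if does (i ℕ.≤? diagonal μ) then suc (part μ i ∸ i) else i ∸ part μ i ∸ 1

rowFlags-upper : ∀ μ {i} → i ≤ diagonal μ → rowFlags μ i ≡ suc (part μ i ∸ i)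
rowFlags-upper μ {i} i≤d rewrite dec-true (i ℕ.≤? diagonal μ) i≤d = ≡.refl

rowFlags-lower : ∀ μ {i} → diagonal μ < i → rowFlags μ i ≡ i ∸ part μ i ∸ 1
rowFlags-lower μ {i} d<i rewrite dec-false (i ℕ.≤? diagonal μ) (ℕ.<⇒≱ d<i) = ≡.refl

entries-upper : ∀ μ {i j} → i ≤ diagonal μ → entries μ (i , j) ≡ applyUpTo (λ κ → ℤ.- (+ κ)) (suc (part μ i ∸ i))
entries-upper μ {i} i≤d rewrite dec-true (i ℕ.≤? diagonal μ) i≤d = ≡.refl

entries-lower : ∀ μ {i j} → diagonal μ < i → entries μ (i , j) ≡ applyUpTo (λ κ → + suc κ) (suc (conjugatePart μ j ∸ j))
entries-lower μ {i} d<i rewrite dec-false (i ℕ.≤? diagonal μ) (ℕ.<⇒≱ d<i) = ≡.refl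

dualColumn-upper : ∀ μ n (j : Fin n) (let i = suc (toℕ j)) → i ≤ diagonal μ →
  dualColumn μ n j ≡ x^ (part μ i ℕ.+ n ∸ i) ⊛ ∏ {suc (part μ i ∸ i)} (λ κ → 1/[1- upperVariable (toℕ κ) x])
dualColumn-upper μ n j j≤d rewrite dec-true (suc (toℕ j) ℕ.≤? diagonal μ) j≤d = ≡.refl

dualColumn-lower : ∀ μ n (j : Fin n) (let i = suc (toℕ j)) → diagonal μ < i →
  dualColumn μ n j ≡ x^ (part μ i ℕ.+ n ∸ i) ⊛ ∏ {i ∸ part μ i ∸ 1} (λ κ → 1- lowerVariable (toℕ κ) x)
dualColumn-lower μ n j d<j rewrite dec-false (suc (toℕ j) ℕ.≤? diagonal μ) (ℕ.<⇒≱ d<j) = ≡.refl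

module DualCoefficient {μ ν : List ℕ} {n : ℕ} (μ-partition : IsPartition μ) (ν-partition : IsPartition ν)
  (ℓμ≤n : length μ ≤ n) (ℓν≤n : length ν ≤ n) where

  d = diagonal μ

  d≤n : d ≤ n
  d≤n = ℕ.≤-trans (diagonal≤length μ-partition) ℓμ≤n

  open HookDeterminant n d (length ν) (part ν) d≤n ℓν≤n (part-beyond ν) (part-antitone (proj₁ ν-partition))
  open FillingSum (ordered? d) (ordered-refl d)

  -- The initial equality behind `lower-m+k` and `lower-gap`.
  lower-sum : ∀ {i} → d < i → suc (part μ i ℕ.+ rowFlags μ i) ≡ i
  lower-sum {i} d<i = ≡.trans (≡.cong (λ k → suc (part μ i ℕ.+ k)) (≡.trans (rowFlags-lower μ d<i) (ℕ.∸-+-assoc i (part μ i) 1)))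
    (≡.trans (≡.cong (λ t → suc (part μ i ℕ.+ (i ∸ t))) (ℕ.+-comm (part μ i) 1))
             (ℕ.m+[n∸m]≡n (diagonal<⇒part< μ-partition d<i)))

  invariant : Invariant (part μ) (rowFlags μ)
  invariant = record
    { m↓        = λ 0<i _ → part-antitone (proj₁ μ-partition) 0<i
    ; upper-m   = λ 0<i i≤d → ℕ.≤-trans (≤diagonal⇒≤part μ-partition (ℕ.<-≤-trans 0<i i≤d) ℕ.≤-refl)
                                        (part-decreasing μ-partition 0<i i≤d)
    ; upper-k↓  = λ {i} 0<i i<d → ≡.subst₂ _≤_ (≡.sym (rowFlags-upper μ i<d)) (≡.sym (rowFlags-upper μ (ℕ.<⇒≤ i<d)))
                    (s≤s (ℕ.∸-mono (part-antitone (proj₁ μ-partition) 0<i) (ℕ.n≤1+n i)))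
    ; lower-m+k = λ d<i _ → ℕ.≤-reflexive (lower-sum d<i)
    ; lower-k↑  = λ {i} d<i _ → ≡.subst₂ _≤_ (≡.sym (rowFlags-lower μ d<i)) (≡.sym (rowFlags-lower μ (ℕ.m<n⇒m<1+n d<i)))
                    (ℕ.∸-monoˡ-≤ 1 (ℕ.∸-mono (ℕ.n≤1+n i) (part-antitone (proj₁ μ-partition) (ℕ.≤-<-trans z≤n d<i))))
    ; lower-gap = λ {i} d<i _ → ℕ.≤-reflexive (≡.trans (ℕ.suc-injective (lower-sum (ℕ.m<n⇒m<1+n d<i))) (≡.sym (lower-sum d<i)))
    }

  dualColumn-column : ∀ j → dualColumn μ n j ≈₁ column (part μ) (rowFlags μ) (toℕ j)
  dualColumn-column j x = by-row (i ℕ.≤? d)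
    where
    i = suc (toℕ j)
    s = part μ i ℕ.+ n ∸ i

    s≡ : s ≡ part μ i ℕ.+ (n ∸ i)
    s≡ = ℕ.+-∸-assoc (part μ i) (Fin.toℕ<n j)

    by-row : Dec (i ≤ d) → dualColumn μ n j x ≋ column (part μ) (rowFlags μ) (toℕ j) x
    by-row (yes i≤d) = begin
      dualColumn μ n j x
        ≡⟨ ≡.cong (λ f → f x) (dualColumn-upper μ n j i≤d) ⟩
      (x^ s ⊛ ∏ {suc (part μ i ∸ i)} (λ κ → 1/[1- upperVariable (toℕ κ) x])) x
        ≈⟨ ≋-trans (shift-⊛ s _ x) (shift-cong s (∏-geometric upperVariable (suc (part μ i ∸ i))) x) ⟩
      shift s (complete upperVariable (suc (part μ i ∸ i))) x
        ≡⟨ ≡.cong (λ s → shift s (complete upperVariable (suc (part μ i ∸ i))) x) s≡ ⟩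
      shift (part μ i ℕ.+ (n ∸ i)) (complete upperVariable (suc (part μ i ∸ i))) x
        ≡⟨ ≡.cong (λ f → f x) (column-upper (part μ) (rowFlags μ) i≤d ≡.refl (rowFlags-upper μ i≤d)) ⟨
      column (part μ) (rowFlags μ) (toℕ j) x ∎
    by-row (no i≰d)  = begin
      dualColumn μ n j x
        ≡⟨ ≡.cong (λ f → f x) (dualColumn-lower μ n j (ℕ.≰⇒> i≰d)) ⟩
      (x^ s ⊛ ∏ {i ∸ part μ i ∸ 1} (λ κ → 1- lowerVariable (toℕ κ) x)) x
        ≈⟨ ≋-trans (shift-⊛ s _ x) (shift-cong s (∏-linear lowerVariable (i ∸ part μ i ∸ 1)) x) ⟩
      shift s (signedElementary lowerVariable (i ∸ part μ i ∸ 1)) x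
        ≡⟨ ≡.cong (λ s → shift s (signedElementary lowerVariable (i ∸ part μ i ∸ 1)) x) s≡ ⟩
      shift (part μ i ℕ.+ (n ∸ i)) (signedElementary lowerVariable (i ∸ part μ i ∸ 1)) x
        ≡⟨ ≡.cong (λ f → f x) (column-lower (part μ) (rowFlags μ) (ℕ.≤-pred (ℕ.≰⇒> i≰d)) ≡.refl (rowFlags-lower μ (ℕ.≰⇒> i≰d))) ⟨
      column (part μ) (rowFlags μ) (toℕ j) x ∎

  alternant-dualColumn : alternant (exponents n (part ν)) (tabulate (dualColumn μ n)) ≋ determinant (part μ) (rowFlags μ)
  alternant-dualColumn = alternant-cong (exponents n (part ν)) (pointwise-tabulate n dualColumn-column)

  module _ (good : Good (part μ)) where

    E = rowEntries (rowFlags μ)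

    -- φ bounds the entries of the lower part by columns, the determinant by rows.
    -- The column bounds follow from the row bounds: entries decrease strictly
    -- along the row of the top box of a column and weakly down the column.
    Bounded : Box × ℤ → Set
    Bounded ((i , j) , t) = d < i → t ℤ.≤ + suc (conjugatePart μ j ∸ j)

    bounded? : Decidable Bounded
    bounded? ((i , j) , t) = (d ℕ.<? i) →-dec (t ℤ.≤? + suc (conjugatePart μ j ∸ j))

    module _ {i j} (d<i : d < i) (ij∈ : (i , j) ∈ skewBoxes (part μ)) where
      private
        i≤ℓ = proj₁ (proj₂ (∈-skewBoxes⁻ (part μ) ij∈))
        μ<j = proj₁ (proj₂ (proj₂ (∈-skewBoxes⁻ (part μ) ij∈)))
        j≤ν = proj₂ (proj₂ (proj₂ (∈-skewBoxes⁻ (part μ) ij∈)))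

      lower-column : j ≤ d
      lower-column = ℕ.≤-trans j≤ν (proj₂ good d<i (ℕ.≤-trans i≤ℓ ℓν≤n))

      column-nonempty : 0 < j
      column-nonempty = ℕ.≤-<-trans z≤n μ<j

      -- The first row whose box in column j lies outside μ
      top : ℕ
      top = suc (conjugatePart μ j)

      d≤conjugate : d ≤ conjugatePart μ j
      d≤conjugate = ℕ.≮⇒≥ λ c<d → ℕ.<⇒≱ (conjugate<⇒part< μ-partition column-nonempty c<d)
        (ℕ.≤-trans lower-column (≤diagonal⇒≤part μ-partition (ℕ.<-≤-trans column-nonempty lower-column) ℕ.≤-refl))

      j≤conjugate : j ≤ conjugatePart μ j
      j≤conjugate = ℕ.≤-trans lower-column d≤conjugate

      top≤i : top ≤ i
      top≤i = ℕ.≰⇒> λ i≤c → ℕ.<⇒≱ μ<j (≤conjugate⇒≤part μ-partition (ℕ.≤-<-trans z≤n d<i) i≤c)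

      μtop<j : part μ top < j
      μtop<j = conjugate<⇒part< μ-partition column-nonempty (ℕ.n<1+n (conjugatePart μ j))

      j≤νtop : j ≤ part ν top
      j≤νtop = ℕ.≤-trans j≤ν (part-decreasing ν-partition (s≤s z≤n) top≤i)

      entries-restricted : filter (bounded? ∘ ((i , j) ,_)) (E (i , j)) ≡ entries μ (i , j)
      entries-restricted = ≡.trans
        (≡.cong (filter (bounded? ∘ ((i , j) ,_))) (rowEntries-lower (rowFlags μ) {j = j} d<i (rowFlags-lower μ d<i)))
        (≡.trans (filter-applyUpTo (bounded? ∘ ((i , j) ,_)) c≤flag
                   (λ κ<c _ → ℤ.+≤+ κ<c)
                   (λ c≤κ bounded → ℕ.<⇒≱ (s≤s c≤κ) (ℤ.drop‿+≤+ (bounded d<i))))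
                 (≡.sym (entries-lower μ {i} {j} d<i)))
        where
        -- The column bound is `top ∸ j` and the row flag is `i ∸ suc (part μ i)`. Since `top ≤ i`
        -- and `part μ i < j`, the former is at most the latter.
        c≤flag : suc (conjugatePart μ j ∸ j) ≤ i ∸ part μ i ∸ 1
        c≤flag = ≡.subst₂ _≤_ (ℕ.+-∸-assoc 1 j≤conjugate)
          (≡.sym (≡.trans (ℕ.∸-+-assoc i (part μ i) 1) (≡.cong (i ∸_) (ℕ.+-comm (part μ i) 1))))
          (ℕ.∸-mono top≤i μ<j)

      module _ {T} (T∈ : T ∈ allFillings (skewBoxes (part μ)) E) (valid : Valid T) where

        -- The first box of row `top` outside `μ` satisfies this bound with its flag as the
        -- right-hand side. Each step to the right lowers the entry by at least one, as rows
        -- decrease strictly in the first `d` columns.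
        top-row : ∀ x {t} → ((top , x) , t) ∈ T → x ≤ j → t ℤ.≤ + (top ∸ x)
        top-row x xt∈ x≤j
          with x∈ , t∈ ← ∈-allFillings-entry (skewBoxes (part μ)) T∈ xt∈
          with _ , _ , μ<x , x≤ν ← ∈-skewBoxes⁻ (part μ) x∈
          with κ , κ<flag , ≡.refl ← ∈-rowEntries-lower (rowFlags μ) {j = x} (s≤s d≤conjugate) t∈ = go x xt∈ x≤j μ<x x≤ν
          where
          flag≡ : rowFlags μ top ≡ top ∸ suc (part μ top)
          flag≡ = ≡.trans (rowFlags-lower μ (s≤s d≤conjugate))
            (≡.trans (ℕ.∸-+-assoc top (part μ top) 1) (≡.cong (top ∸_) (ℕ.+-comm (part μ top) 1)))

          go : ∀ x → ((top , x) , + suc κ) ∈ T → x ≤ j → part μ top < x → x ≤ part ν top → + suc κ ℤ.≤ + (top ∸ x)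
          go (suc x) xt∈ x<j (s≤s μ≤x) x<ν with ℕ.m≤n⇒m<n∨m≡n μ≤x
          ... | inj₂ ≡.refl = ℤ.+≤+ (≡.subst (κ <_) flag≡ κ<flag)
          ... | inj₁ μ<x with t , xt′∈ ← ∈-allFillings-box (skewBoxes (part μ)) T∈ (∈-skewBoxes⁺ (part μ) {top} (s≤s z≤n) μ<x (ℕ.<⇒≤ x<ν))
            with _ , _ , _ , decreasing ← All.lookup (All.lookup valid xt′∈) xt∈ =
            ℤ.+≤+ (≡.subst (suc κ ≤_) (ℕ.pred[m∸n]≡m∸[1+n] top x) (ℕ.<⇒≤pred (ℤ.drop‿+<+ (ℤ.<-≤-trans
              (decreasing (ℕ.≤-trans x<j lower-column , ≡.refl , ℕ.≤-refl)) (top-row x xt′∈ (ℕ.<⇒≤ x<j))))))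

        entry-bounded : ∀ {t} → ((i , j) , t) ∈ T → t ℤ.≤ + suc (conjugatePart μ j ∸ j)
        entry-bounded {t} ijt∈ = ≡.subst (λ c → t ℤ.≤ + c) (ℕ.+-∸-assoc 1 j≤conjugate) (by-row (ℕ.m≤n⇒m<n∨m≡n top≤i))
          where
          by-row : top < i ⊎ top ≡ i → t ℤ.≤ + (top ∸ j)
          by-row (inj₂ eq) = top-row j (≡.subst (λ i → ((i , j) , t) ∈ T) (≡.sym eq) ijt∈) ℕ.≤-refl
          by-row (inj₁ top<i)
            with t′ , jt′∈ ← ∈-allFillings-box (skewBoxes (part μ)) T∈ (∈-skewBoxes⁺ (part μ) {top} (s≤s z≤n) μtop<j j≤νtop)
            with _ , _ , decreasing , _ ← All.lookup (All.lookup valid jt′∈) ijt∈ =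
            ℤ.≤-trans (decreasing (lower-column , ≡.refl , top<i)) (top-row j jt′∈ ℕ.≤-refl)

    φ-tableauSum : φ ν μ ≋ tableauSum (part μ) (rowFlags μ)
    φ-tableauSum = begin
      φ ν μ
        ≈⟨ sumOver-valid (boxes ν μ) (entries μ) ⟩
      fillingSum (skewBoxes (part μ)) (entries μ)
        ≈⟨ fillingSum-cong (skewBoxes (part μ)) (λ {b} b∈ → restricted b b∈) ⟨
      fillingSum (skewBoxes (part μ)) (λ b → filter (bounded? ∘ (b ,_)) (E b))
        ≈⟨ fillingSum-filter bounded? (skewBoxes (part μ)) E (λ {T} T∈ valid →
             All.tabulate λ { {(i , j) , t} ijt∈ d<i → entry-bounded d<i
               (proj₁ (∈-allFillings-entry (skewBoxes (part μ)) T∈ ijt∈)) T∈ valid ijt∈ }) ⟩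
      tableauSum (part μ) (rowFlags μ) ∎
      where
      restricted : ∀ b → b ∈ skewBoxes (part μ) → filter (bounded? ∘ (b ,_)) (E b) ≡ entries μ b
      restricted (i , j) ij∈ = by-row (i ℕ.≤? d)
        where
        by-row : Dec (i ≤ d) → filter (bounded? ∘ ((i , j) ,_)) (E (i , j)) ≡ entries μ (i , j)
        by-row (no i≰d)  = entries-restricted (ℕ.≰⇒> i≰d) ij∈
        by-row (yes i≤d) = ≡.trans
          (filter-all (bounded? ∘ ((i , j) ,_)) (All.universal (λ _ d<i → contradiction i≤d (ℕ.<⇒≱ d<i)) (E (i , j))))
          (≡.trans (rowEntries-upper (rowFlags μ) {j = j} i≤d (rowFlags-upper μ i≤d)) (≡.sym (entries-upper μ {i} {j} i≤d)))

  good⇒coefficient : Good (part μ) →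
    alternant (exponents n (part ν)) (tabulate (dualColumn μ n)) ≋ (- 1#) ^ lowerBoxes ν μ * φ ν μ
  good⇒coefficient good = begin
    alternant (exponents n (part ν)) (tabulate (dualColumn μ n))          ≈⟨ alternant-dualColumn ⟩
    determinant (part μ) (rowFlags μ)                                     ≈⟨ proj₁ (claim invariant) good ⟩
    (- 1#) ^ lowerBoxes ν μ * tableauSum (part μ) (rowFlags μ)            ≈⟨ ⊗-cong ≋-refl (φ-tableauSum good) ⟨
    (- 1#) ^ lowerBoxes ν μ * φ ν μ                                       ∎

  ⊆⇒coefficient : μ ⊆ ν → diagonal ν ≡ diagonal μ →
    alternant (exponents n (part ν)) (tabulate (dualColumn μ n)) ≋ (- 1#) ^ lowerBoxes ν μ * φ ν μ
  ⊆⇒coefficient μ⊆ν eq = good⇒coefficient ((λ {i} _ _ → ⊆⇒part-≤ μ⊆ν i) , λ d<i _ →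
    ℕ.≤-trans (part-decreasing ν-partition (s≤s z≤n) d<i)
              (ℕ.≤-pred (diagonal<⇒part< ν-partition (s≤s (ℕ.≤-reflexive eq)))))

  -- If no row of `μ` sticks out, then `μ ⊆ ν` and the diagonal of `ν` is at least as long as that
  -- of `μ`; not being equal, it reaches the box (d + 1, d + 1).
  ⊈⇒coefficient : ¬ (μ ⊆ ν × diagonal ν ≡ diagonal μ) →
    alternant (exponents n (part ν)) (tabulate (dualColumn μ n)) ≋ 0#
  ⊈⇒coefficient ⊈ = ≋-trans alternant-dualColumn (proj₂ (claim invariant) bad)
    where
    bad : Bad (part μ)
    bad with find-failure (λ i → part μ i ℕ.≤? part ν i) n
    ... | inj₂ (i , 0<i , i≤n , ≰) = inj₁ (i , 0<i , i≤n , ℕ.≰⇒> ≰)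
    ... | inj₁ μ≤ν = inj₂ (ℕ.≤-trans d<dν (ℕ.≤-trans (diagonal≤length ν-partition) ℓν≤n) ,
                           ≤diagonal⇒≤part ν-partition (s≤s z≤n) d<dν)
      where
      dμ≤dν : ∀ {d} → d ≡ diagonal μ → d ≤ diagonal ν
      dμ≤dν {zero}  _  = z≤n
      dμ≤dν {suc d} eq = ≤part⇒≤diagonal ν-partition (ℕ.≤-trans
        (≤diagonal⇒≤part μ-partition (s≤s z≤n) (ℕ.≤-reflexive eq))
        (μ≤ν (s≤s z≤n) (ℕ.≤-trans (ℕ.≤-reflexive eq) d≤n)))

      d<dν : d < diagonal ν
      d<dν = ℕ.≤∧≢⇒< (dμ≤dν ≡.refl) λ eq →
        ⊈ (part-≤⇒⊆ ν (proj₂ μ-partition) (λ 0<i i≤ℓ → μ≤ν 0<i (ℕ.≤-trans i≤ℓ ℓμ≤n)) , ≡.sym eq)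

-- Numerators of Schur functions and their linear combinations

dualSchur-≤ : ∀ {μ n} → length μ ≤ n → dualSchur μ n ≡ bialternant (dualColumn μ n)
dualSchur-≤ {μ} {n} ℓ≤n rewrite dec-true (length μ ℕ.≤? n) ℓ≤n = ≡.refl

dualSchur-> : ∀ {μ n} → ¬ length μ ≤ n → dualSchur μ n ≡ 0ₛ
dualSchur-> {μ} {n} ℓ≰n rewrite dec-false (length μ ℕ.≤? n) ℓ≰n = ≡.refl

schur-> : ∀ {ν n} → ¬ length ν ≤ n → schur ν n ≡ 0ₛ
schur-> {ν} {n} ℓ≰n rewrite dec-false (length ν ℕ.≤? n) ℓ≰n = ≡.refl

-- Extended by zero to partitions with more than `n` parts, so that the sum over all shapes can be
-- formed before dividing by Δ.
schurNumerator : List ℕ → ∀ n → R⟦x₁⋯ n ⟧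
schurNumerator ν n β = if does (length ν ℕ.≤? n) then alternant β (tabulate (schurColumn ν n)) else 0#

schur-numerator : ∀ ν n → schur ν n ≈ₛ (schurNumerator ν n /Δ)
schur-numerator ν n α = go (does (length ν ℕ.≤? n))
  where
  go : ∀ b → (if b then bialternant (schurColumn ν n) else 0ₛ) α ≋
             ((λ β → if b then alternant β (tabulate (schurColumn ν n)) else 0#) /Δ) α
  go true  = /Δ-cong α λ β _ → det-alternant (schurColumn ν n) β
  go false = ≋-sym (divide-0 (pairs n) α)

schurNumerator-alternating : ∀ ν n → Alternating (schurNumerator ν n)
schurNumerator-alternating ν n = go (does (length ν ℕ.≤? n))
  where
  go : ∀ b → Alternating (λ β → if b then alternant β (tabulate (schurColumn ν n)) else 0#)
  go true  = alternant-alternating (tabulate (schurColumn ν n))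
  go false = alternating-0

module _ {ν} (ν-partition : IsPartition ν) {n : ℕ} where

  alternant-schurColumn : ∀ (β : Vec ℕ n) → alternant β (tabulate (schurColumn ν n)) ≋ alternant β (toList (Vec.map x^_ (exponents n (part ν))))
  alternant-schurColumn β = ≋-trans
    (alternant-cong β (pointwise-tabulate n λ i x →
      R.reflexive (≡.cong (λ s → (x^ s) x) (ℕ.+-∸-assoc (part ν (suc (toℕ i))) (Fin.toℕ<n i)))))
    (R.reflexive (≡.cong (alternant β) (≡.sym (toList-map-tabulate n x^_ λ i → part ν (suc i) ℕ.+ (n ∸ suc i)))))

  schurNumerator-≡ : length ν ≤ n → schurNumerator ν n (exponents n (part ν)) ≋ 1#
  schurNumerator-≡ ℓ≤n rewrite dec-true (length ν ℕ.≤? n) ℓ≤n = ≋-trans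
    (alternant-schurColumn (exponents n (part ν)))
    (alternant-monomials-≡ (exponents-decreasing n {part ν} λ 0<i _ → part-antitone (proj₁ ν-partition) 0<i))

  schurNumerator-≢ : ∀ {ν′} → IsPartition ν′ → length ν′ ≤ n → ν ≢ ν′ → schurNumerator ν n (exponents n (part ν′)) ≋ 0#
  schurNumerator-≢ {ν′} ν′-partition ℓ′≤n ν≢ν′ = by-length (length ν ℕ.≤? n)
    where
    by-length : (ℓ≤n? : Dec (length ν ≤ n)) →
      (if does ℓ≤n? then alternant (exponents n (part ν′)) (tabulate (schurColumn ν n)) else 0#) ≋ 0#
    by-length (no _)    = ≋-refl
    by-length (yes ℓ≤n) = ≋-trans (alternant-schurColumn (exponents n (part ν′)))
      (alternant-monomials-≢
        (exponents-decreasing n {part ν′} λ 0<i _ → part-antitone (proj₁ ν′-partition) 0<i)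
        (exponents-decreasing n {part ν} λ 0<i _ → part-antitone (proj₁ ν-partition) 0<i)
        λ eq → ν≢ν′ (part-injective (proj₂ ν-partition) (proj₂ ν′-partition) ℓ≤n ℓ′≤n
                  λ 0<i i≤n → ≡.sym (exponents-injective n {part ν′} {part ν} eq 0<i i≤n)))

alternating-sumOver : ∀ {A : Set} {n} xs {c : A → ℚ[a]} {S : A → R⟦x₁⋯ n ⟧} → (∀ x → Alternating (S x)) →
                      Alternating (λ β → sumOver xs λ x → c x * S x β)
alternating-sumOver []       S-alternating = alternating-0
alternating-sumOver (x ∷ xs) {c} S-alternating =
  alternating-+ (alternating-* (c x) (S-alternating x)) (alternating-sumOver xs S-alternating)

/Δ-sumOver : ∀ {A : Set} {n} xs (c : A → ℚ[a]) (S : A → R⟦x₁⋯ n ⟧) →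
             ((λ β → sumOver xs λ x → c x * S x β) /Δ) ≈ₛ λ α → sumOver xs λ x → c x * (S x /Δ) α
/Δ-sumOver {n = n} []       c S α = divide-0 (pairs n) α
/Δ-sumOver {n = n} (x ∷ xs) c S α = ≋-trans
  (divide-linear (c x) (S x) (λ β → sumOver xs λ x → c x * S x β) (pairs n) α)
  (⊕-cong ≋-refl (/Δ-sumOver xs c S α))

theorem3p17 : (μ : List ℕ) → IsPartition μ →
    dualSchur μ ≈Λ
    schurSeries (λ ν → μ ⊆? ν ×-dec diagonal ν ≟ diagonal μ)
    (λ ν → (- 1#) ^ lowerBoxes ν μ * φ ν μ)
theorem3p17 μ μ-partition n α = by-length (length μ ℕ.≤? n)
  where
  P? : ∀ ν → Dec (μ ⊆ ν × diagonal ν ≡ diagonal μ)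
  P? ν = μ ⊆? ν ×-dec diagonal ν ≟ diagonal μ

  N : ℕ
  N = Vec.sum α

  shapes : List (List ℕ)
  shapes = filter P? (partitions N)

  c : List ℕ → ℚ[a]
  c ν = (- 1#) ^ lowerBoxes ν μ * φ ν μ

  shape-partition : ∀ {ν} → ν ∈ shapes → IsPartition ν
  shape-partition ν∈ = proj₁ (proj₂ (∈-filter⁻ (λ ν → isPartition? ν ×-dec size ν ℕ.≟ N)
    {xs = concatMap (λ ℓ → choices (replicate ℓ (upTo (suc N)))) (upTo (suc N))}
    (proj₁ (∈-filter⁻ P? {xs = partitions N} ν∈))))

  -- The condition on the size puts `ν` into the list `shapes` whenever it satisfies `P?`; the sum
  -- then collapses to the term of `ν`.
  at-partition : ∀ {ν} → length μ ≤ n → IsPartition ν → length ν ≤ n → size ν ≡ N →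
    alternant (exponents n (part ν)) (tabulate (dualColumn μ n)) ≋
    sumOver shapes (λ ν′ → c ν′ * schurNumerator ν′ n (exponents n (part ν)))
  at-partition {ν} ℓμ≤n ν-partition ℓν≤n size≡N = by-shape (P? ν)
    where
    open DualCoefficient μ-partition ν-partition ℓμ≤n ℓν≤n using (⊆⇒coefficient; ⊈⇒coefficient)

    others : ∀ {ν′} → ν′ ∈ shapes → ν′ ≢ ν → c ν′ * schurNumerator ν′ n (exponents n (part ν)) ≋ 0#
    others ν′∈ ν′≢ν = ≋-trans
      (⊗-cong ≋-refl (schurNumerator-≢ (shape-partition ν′∈) ν-partition ℓν≤n ν′≢ν)) (R.zeroʳ _)

    by-shape : Dec (μ ⊆ ν × diagonal ν ≡ diagonal μ) → _
    by-shape (yes Pν@(μ⊆ν , eq)) = begin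
      alternant (exponents n (part ν)) (tabulate (dualColumn μ n))
        ≈⟨ ⊆⇒coefficient μ⊆ν eq ⟩
      c ν
        ≈⟨ R.*-identityʳ _ ⟨
      c ν * 1#
        ≈⟨ ⊗-cong ≋-refl (schurNumerator-≡ ν-partition ℓν≤n) ⟨
      c ν * schurNumerator ν n (exponents n (part ν))
        ≈⟨ sumOver-unique (Unique.filter⁺ P? (partitions-unique N))
             (∈-filter⁺ P? (≡.subst (λ N → ν ∈ partitions N) size≡N (∈-partitions ν-partition)) Pν) others ⟨
      sumOver shapes (λ ν′ → c ν′ * schurNumerator ν′ n (exponents n (part ν))) ∎
    by-shape (no ¬Pν) = ≋-trans (⊈⇒coefficient ¬Pν) (≋-sym (sumOver-0 shapes λ {ν′} ν′∈ →
      others ν′∈ λ where ≡.refl → ¬Pν (proj₂ (∈-filter⁻ P? {xs = partitions N} ν′∈))))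

  -- The equality is claimed only in the degree of Δ plus `N`. There the corresponding partitions
  -- have size `N`, as those in `shapes` do, and these are the coefficients that the quotient reads
  -- at `α`.
  numerators : length μ ≤ n → ∀ β → Vec.sum β ≡ length (pairs n) ℕ.+ N →
    detₛ (λ i j → dualColumn μ n j ⟨x i ⟩) β ≋ sumOver shapes (λ ν → c ν * schurNumerator ν n β)
  numerators ℓμ≤n β sum≡ = ≋-trans (det-alternant (dualColumn μ n) β)
    (alternating-unique {P = λ s → s ≡ length (pairs n) ℕ.+ N} (alternant-alternating (tabulate (dualColumn μ n)))
      (alternating-sumOver shapes λ ν → schurNumerator-alternating ν n) decreasing β sum≡)
    where
    decreasing : ∀ {u} β → StrictlyDecreasing u β → Vec.sum β ≡ length (pairs n) ℕ.+ N →
      alternant β (tabulate (dualColumn μ n)) ≋ sumOver shapes (λ ν → c ν * schurNumerator ν n β)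
    decreasing β β↓ sum≡ with ν , ν-partition , ℓ≤n , ≡.refl , sum≡′ ← partition-of-exponents β β↓ =
      at-partition ℓμ≤n ν-partition ℓ≤n (ℕ.+-cancelˡ-≡ (staircase n) (size ν) N
        (≡.trans (≡.sym sum≡′) (≡.trans sum≡ (≡.cong (ℕ._+ N) (length-pairs ℚ[a]-commutativeRing n)))))

  by-length : Dec (length μ ≤ n) → dualSchur μ n α ≋ sumOver shapes (λ ν → c ν * schur ν n α)
  -- A shape containing `μ` has at least as many rows, so every Schur function on the right vanishes
  -- too.
  by-length (no ℓμ≰n)  = ≋-trans (R.reflexive (≡.cong (λ F → F α) (dualSchur-> {μ} ℓμ≰n))) (≋-sym (sumOver-0 shapes λ {ν} ν∈ →
    let _ , μ⊆ν , _ = ∈-filter⁻ P? {xs = partitions N} ν∈ in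
    ≋-trans (⊗-cong ≋-refl (R.reflexive (≡.cong (λ F → F α)
      (schur-> {ν} λ ℓν≤n → ℓμ≰n (ℕ.≤-trans (⊆⇒length-≤ μ⊆ν) ℓν≤n))))) (R.zeroʳ _)))
  by-length (yes ℓμ≤n) = begin
    dualSchur μ n α
      ≡⟨ ≡.cong (λ F → F α) (dualSchur-≤ {μ} ℓμ≤n) ⟩
    bialternant (dualColumn μ n) α
      ≈⟨ /Δ-cong α (numerators ℓμ≤n) ⟩
    ((λ β → sumOver shapes λ ν → c ν * schurNumerator ν n β) /Δ) α
      ≈⟨ /Δ-sumOver shapes c (λ ν → schurNumerator ν n) α ⟩
    sumOver shapes (λ ν → c ν * (schurNumerator ν n /Δ) α)
      ≈⟨ sumOver-cong shapes (λ ν → ⊗-cong ≋-refl (schur-numerator ν n α)) ⟨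
    sumOver shapes (λ ν → c ν * schur ν n α) ∎
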